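{- Let $n$ be a Carmichael number and let $p_1$ be its smallest prime factor. If $$1+\log_2 n-\left(\frac{(1+\log_2 n)^{\log_n (n/2)}-\log_2 n}{\bigl(\log_n (n/2)\bigr)\cdot (1+\log_2 n)^{\log_n (1/2)}-1}\right)\leq p_1,$$ then the proportion of the integers $a\in\{1,2,\ldots,n-1\}$ that are Fermat witnesses for $n$ is less than $50\%$, i.e. $$\frac{\bigl|\{a\in\{1,\ldots,n-1\} : a^{n-1}\not\equiv 1 \pmod n\}\bigr|}{n-1}<\frac12 .$$
   Context: A Carmichael number is a composite positive integer $n$ such that $a^{n-1}\equiv 1\pmod n$ for every positive integer $a$ with $\gcd(a,n)=1$. A Fermat witness for $n$ is an integer $a\in\{1,2,\ldots,n-1\}$ with $a^{n-1}\not\equiv 1\pmod n$. For $b>0$, $b\neq 1$ and $x>0$, $\log_b x=\ln x/\ln b$ is the real logarithm of $x$ to base $b$; thus $\log_n(n/2)$ and $\log_n(1/2)$ are the base-$n$ logarithms of $n/2$ and $1/2$. -}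

module Defs where

open import Data.Nat as ℕ using (ℕ; zero; suc; z≤n; s≤s)
import Data.Nat.Properties as ℕ
open import Data.Nat.Divisibility using (_∣_; _∣?_)
open import Data.Nat.GCD using (gcd)
open import Data.Nat.Primality using (Prime; Composite; composite⇒nonTrivial)
open import Data.Integer as ℤ using (-[1+_]) renaming (+_ to int)
import Data.Integer.Properties as ℤ
open import Data.Rational
import Data.Rational.Unnormalised as ℚᵘ
import Data.Rational.Unnormalised.Properties as ℚᵘ
open import Data.Rational.Properties
open import Data.List using (List; []; _∷_; filter; applyUpTo)
open import Data.Product using (∃-syntax; _×_; _,_; proj₁; proj₂)
open import Data.Sum using (_⊎_; inj₁; inj₂)
open import Data.Empty using (⊥-elim)
open import Relation.Nullary using (Dec; yes; no; ¬?)
open import Relation.Nullary.Decidable using (dec⇒maybe; toWitness)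
open import Relation.Binary.PropositionalEquality
open import Algebra.Definitions.RawSemiring +-*-rawSemiring using (_^_)
import Algebra.Bundles as Bundles
import Algebra.Properties.CommutativeSemiring.Exp
  (Bundles.CommutativeRing.commutativeSemiring +-*-commutativeRing) as Exp
open import Tactic.RingSolver.Core.AlmostCommutativeRing
  using (AlmostCommutativeRing; fromCommutativeRing)
open import Tactic.RingSolver using (solve-∀)

------------------------------------------------------------------------
-- Carmichael numbers and Fermat witnesses

infix 4 _≡_[mod_] _≡?_[mod_]

_≡_[mod_] : ℕ → ℕ → ℕ → Set
a ≡ b [mod n ] = n ∣ ℕ.∣ a - b ∣

_≡?_[mod_] : ∀ a b n → Dec (a ≡ b [mod n ])
a ≡? b [mod n ] = n ∣? ℕ.∣ a - b ∣

record Carmichael (n : ℕ) : Set where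
  field
    isComposite : Composite n
    fermat      : ∀ a → 0 ℕ.< a → gcd a n ≡ 1 → a ℕ.^ (n ℕ.∸ 1) ≡ 1 [mod n ]

-- The elements of {1,…,n-1} that are Fermat witnesses for n.
fermatWitnesses : ℕ → List ℕ
fermatWitnesses n =
  filter (λ a → ¬? (a ℕ.^ (n ℕ.∸ 1) ≡? 1 [mod n ])) (applyUpTo suc (n ℕ.∸ 1))

record IsSmallestPrimeFactor (p n : ℕ) : Set where
  field
    isPrime  : Prime p
    divides  : p ∣ n
    smallest : ∀ q → Prime q → q ∣ n → p ℕ.≤ q

carmichael⇒1<n : ∀ {n} → Carmichael n → 1 ℕ.< n
carmichael⇒1<n {n} c =
  ℕ.nonTrivial⇒n>1 n {{composite⇒nonTrivial (Carmichael.isComposite c)}}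

1<n⇒nonZero[n∸1] : ∀ {n} → 1 ℕ.< n → ℕ.NonZero (n ℕ.∸ 1)
1<n⇒nonZero[n∸1] (s≤s (s≤s _)) = _

------------------------------------------------------------------------
-- Rational arithmetic

fromℕ : ℕ → ℚ
fromℕ n = int n / 1

-- Total inverse with inv 0 = 0.
inv : ℚ → ℚ
inv q with q ≟ 0ℚ
... | yes _   = 0ℚ
... | no q≢0 = (1/ q) {{≢-nonZero q≢0}}

∑ : ℕ → (ℕ → ℚ) → ℚ
∑ zero    f = 0ℚ
∑ (suc n) f = ∑ n f + f n

ℚ-ring : AlmostCommutativeRing _ _
ℚ-ring = fromCommutativeRing +-*-commutativeRing λ x → dec⇒maybe (0ℚ ≟ x)

abstract

  0≤1 : 0ℚ ≤ 1ℚ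
  0≤1 = nonNegative⁻¹ 1ℚ

  0≤½ : 0ℚ ≤ ½
  0≤½ = nonNegative⁻¹ ½

  0<1 : 0ℚ < 1ℚ
  0<1 = positive⁻¹ 1ℚ

  0<½ : 0ℚ < ½
  0<½ = positive⁻¹ ½

  ≤-by : ∀ {p q} c → 0ℚ ≤ c → q - p ≡ c → p ≤ q
  ≤-by {p} {q} c 0≤c eq = subst₂ _≤_ (+-identityˡ p) (lem p q)
    (+-monoˡ-≤ p (subst (0ℚ ≤_) (sym eq) 0≤c))
    where
    lem : ∀ p q → q - p + p ≡ q
    lem = solve-∀ ℚ-ring

  0≤- : ∀ {p q} → p ≤ q → 0ℚ ≤ q - p
  0≤- {p} {q} p≤q = subst (_≤ q - p) (+-inverseʳ p) (+-monoˡ-≤ (- p) p≤q)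

  0≤+ : ∀ {p q} → 0ℚ ≤ p → 0ℚ ≤ q → 0ℚ ≤ p + q
  0≤+ a b = +-mono-≤ a b

  0≤* : ∀ {p q} → 0ℚ ≤ p → 0ℚ ≤ q → 0ℚ ≤ p * q
  0≤* {p} {q} a b = nonNegative⁻¹ (p * q)
    {{nonNeg*nonNeg⇒nonNeg p {{nonNegative a}} q {{nonNegative b}}}}

  0<* : ∀ {p q} → 0ℚ < p → 0ℚ < q → 0ℚ < p * q
  0<* {p} {q} a b = positive⁻¹ (p * q)
    {{pos*pos⇒pos p {{positive a}} q {{positive b}}}}

  0<+ : ∀ {p q} → 0ℚ ≤ p → 0ℚ < q → 0ℚ < p + q
  0<+ a b = +-mono-≤-< a b

  *-mono : ∀ {p q r s} → 0ℚ ≤ p → 0ℚ ≤ s → p ≤ q → r ≤ s → p * r ≤ q * s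
  *-mono {p} {q} {r} {s} 0≤p 0≤s p≤q r≤s = ≤-trans
    (*-monoˡ-≤-nonNeg p {{nonNegative 0≤p}} r≤s)
    (*-monoʳ-≤-nonNeg s {{nonNegative 0≤s}} p≤q)

  *-monoˡ : ∀ {p q} r → 0ℚ ≤ r → p ≤ q → r * p ≤ r * q
  *-monoˡ r 0≤r = *-monoˡ-≤-nonNeg r {{nonNegative 0≤r}}

  *-monoʳ : ∀ {p q} r → 0ℚ ≤ r → p ≤ q → p * r ≤ q * r
  *-monoʳ r 0≤r = *-monoʳ-≤-nonNeg r {{nonNegative 0≤r}}

  0≤x² : ∀ x → 0ℚ ≤ x * x
  0≤x² x with ≤-total 0ℚ x
  ... | inj₁ 0≤x = 0≤* 0≤x 0≤x
  ... | inj₂ x≤0 = subst (0ℚ ≤_) (neg² x) (0≤* (neg-antimono-≤ x≤0) (neg-antimono-≤ x≤0))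
    where
    neg² : ∀ x → - x * - x ≡ x * x
    neg² = solve-∀ ℚ-ring

  -- Absolute values

  p≤∣p∣ : ∀ p → p ≤ ∣ p ∣
  p≤∣p∣ p with ≤-total 0ℚ p
  ... | inj₁ 0≤p = ≤-reflexive (sym (0≤p⇒∣p∣≡p 0≤p))
  ... | inj₂ p≤0 = ≤-trans p≤0 (0≤∣p∣ p)

  -p≤∣p∣ : ∀ p → - p ≤ ∣ p ∣
  -p≤∣p∣ p = subst (- p ≤_) (∣-p∣≡∣p∣ p) (p≤∣p∣ (- p))

  ∣∣-≤ : ∀ {p c} → p ≤ c → - p ≤ c → ∣ p ∣ ≤ c
  ∣∣-≤ {p} a b with ∣p∣≡p∨∣p∣≡-p p
  ... | inj₁ e = ≤-trans (≤-reflexive e) a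
  ... | inj₂ e = ≤-trans (≤-reflexive e) b

  ∣p-q∣≡∣q-p∣ : ∀ p q → ∣ p - q ∣ ≡ ∣ q - p ∣
  ∣p-q∣≡∣q-p∣ p q = trans (cong ∣_∣ (lem p q)) (∣-p∣≡∣p∣ (q - p))
    where
    lem : ∀ p q → p - q ≡ - (q - p)
    lem = solve-∀ ℚ-ring

  ∣∣-via : ∀ {p a b} q r → p ≡ q + r → ∣ q ∣ ≤ a → ∣ r ∣ ≤ b → ∣ p ∣ ≤ a + b
  ∣∣-via q r refl h k = ≤-trans (∣p+q∣≤∣p∣+∣q∣ q r) (+-mono-≤ h k)

  ∣∣-* : ∀ {a b} p q → ∣ p ∣ ≤ a → ∣ q ∣ ≤ b → ∣ p * q ∣ ≤ a * b
  ∣∣-* p q h k = ≤-trans (≤-reflexive (∣p*q∣≡∣p∣*∣q∣ p q))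
    (*-mono (0≤∣p∣ p) (≤-trans (0≤∣p∣ q) k) h k)

  ∣∣-nonNeg : ∀ {p c} → 0ℚ ≤ p → p ≤ c → ∣ p ∣ ≤ c
  ∣∣-nonNeg h k = ≤-trans (≤-reflexive (0≤p⇒∣p∣≡p h)) k

  half+half : ∀ ε → ½ * ε + ½ * ε ≡ ε
  half+half = solve-∀ ℚ-ring

  -- fromℕ

  fromℕ-suc : ∀ n → fromℕ (suc n) ≡ fromℕ n + 1ℚ
  fromℕ-suc n = toℚᵘ-injective (ℚᵘ.≃-trans (toℚᵘ-fromℚᵘ (ℚᵘ.mkℚᵘ (int (suc n)) 0))
    (ℚᵘ.≃-trans (ℚᵘ.*≡* lem)
    (ℚᵘ.≃-sym (ℚᵘ.≃-trans (toℚᵘ-homo-+ (fromℕ n) 1ℚ)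
      (ℚᵘ.+-cong (toℚᵘ-fromℚᵘ (ℚᵘ.mkℚᵘ (int n) 0)) ℚᵘ.≃-refl)))))
    where
    lem : int (suc n) ℤ.* (int 1) ≡ (int n ℤ.* (int 1) ℤ.+ (int 1) ℤ.* (int 1)) ℤ.* (int 1)
    lem = cong (ℤ._* (int 1)) (trans (cong int (ℕ.+-comm 1 n))
      (cong (ℤ._+ int 1) (sym (ℤ.*-identityʳ (int n)))))

  fromℕ-+ : ∀ m n → fromℕ (m ℕ.+ n) ≡ fromℕ m + fromℕ n
  fromℕ-+ zero    n = sym (+-identityˡ (fromℕ n))
  fromℕ-+ (suc m) n = trans (fromℕ-suc (m ℕ.+ n)) (trans (cong (_+ 1ℚ) (fromℕ-+ m n))
    (trans (lem (fromℕ m) (fromℕ n)) (cong (_+ fromℕ n) (sym (fromℕ-suc m)))))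
    where
    lem : ∀ a b → a + b + 1ℚ ≡ a + 1ℚ + b
    lem = solve-∀ ℚ-ring

  fromℕ-2* : ∀ n → fromℕ (2 ℕ.* n) ≡ fromℕ n + fromℕ n
  fromℕ-2* n = trans (cong (λ m → fromℕ (n ℕ.+ m)) (ℕ.+-identityʳ n)) (fromℕ-+ n n)

  0≤fromℕ : ∀ n → 0ℚ ≤ fromℕ n
  0≤fromℕ n = nonNegative⁻¹ (fromℕ n) {{normalize-nonNeg n 1}}

  fromℕ-mono : ∀ {m n} → m ℕ.≤ n → fromℕ m ≤ fromℕ n
  fromℕ-mono {m} {n} m≤n = ≤-by (fromℕ (n ℕ.∸ m)) (0≤fromℕ (n ℕ.∸ m))
    (trans (cong (_- fromℕ m) (trans (cong fromℕ (sym (ℕ.m+[n∸m]≡n m≤n))) (fromℕ-+ m (n ℕ.∸ m))))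
      (lem (fromℕ m) (fromℕ (n ℕ.∸ m))))
    where
    lem : ∀ a b → a + b - a ≡ b
    lem = solve-∀ ℚ-ring

  archimedean : ∀ q → ∃[ n ] q ≤ fromℕ n
  archimedean q@(mkℚ i d c) = ℤ.∣ i ∣ , toℚᵘ-cancel-≤
    (ℚᵘ.≤-respʳ-≃ (ℚᵘ.≃-sym (toℚᵘ-fromℚᵘ (ℚᵘ.mkℚᵘ (int ℤ.∣ i ∣) 0))) (ℚᵘ.*≤* (lem i)))
    where
    lem : ∀ i → i ℤ.* (int 1) ℤ.≤ int ℤ.∣ i ∣ ℤ.* (int (suc d))
    lem (int n)     = ℤ.*-monoˡ-≤-nonNeg (int n) (ℤ.+≤+ (s≤s z≤n))
    lem (-[1+ n ]) = ℤ.-≤+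

  -- inv

  inv-inverse : ∀ {q} → q ≢ 0ℚ → q * inv q ≡ 1ℚ
  inv-inverse {q} q≢0 with q ≟ 0ℚ
  ... | yes q≡0 = ⊥-elim (q≢0 q≡0)
  ... | no q≢0′ = *-inverseʳ q {{≢-nonZero q≢0′}}

  pos⇒≢0 : ∀ {q} → 0ℚ < q → q ≢ 0ℚ
  pos⇒≢0 0<q refl = <-irrefl refl 0<q

  inv-pos : ∀ {q} → 0ℚ < q → 0ℚ < inv q
  inv-pos {q} 0<q with q ≟ 0ℚ
  ... | yes refl = ⊥-elim (<-irrefl refl 0<q)
  ... | no q≢0  = positive⁻¹ _ {{1/pos⇒pos q {{positive 0<q}}}}

  inv-nonNeg : ∀ {q} → 0ℚ ≤ q → 0ℚ ≤ inv q
  inv-nonNeg {q} 0≤q with q ≟ 0ℚ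
  ... | yes _   = ≤-refl
  ... | no q≢0 = <⇒≤ (positive⁻¹ _ {{1/pos⇒pos q {{positive (≤∧≢⇒< 0≤q (λ e → q≢0 (sym e)))}}}})
    where
    ≤∧≢⇒< : ∀ {p q} → p ≤ q → p ≢ q → p < q
    ≤∧≢⇒< p≤q p≢q = ≰⇒> λ q≤p → p≢q (≤-antisym p≤q q≤p)

  inv-diff : ∀ {p q} → p ≢ 0ℚ → q ≢ 0ℚ → inv p - inv q ≡ (q - p) * (inv p * inv q)
  inv-diff {p} {q} p≢0 q≢0 = trans (sym (cong₂ _-_
      (trans (cong (inv p *_) (inv-inverse q≢0)) (*-identityʳ (inv p)))
      (trans (cong (inv q *_) (inv-inverse p≢0)) (*-identityʳ (inv q)))))
    (lem p q (inv p) (inv q))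
    where
    lem : ∀ p q i j → i * (q * j) - j * (p * i) ≡ (q - p) * (i * j)
    lem = solve-∀ ℚ-ring

  inv-antimono : ∀ {p q} → 0ℚ < p → p ≤ q → inv q ≤ inv p
  inv-antimono {p} {q} 0<p p≤q =
    ≤-by _ (0≤* (0≤- p≤q) (<⇒≤ (0<* (inv-pos 0<p) (inv-pos 0<q))))
      (inv-diff (pos⇒≢0 0<p) (pos⇒≢0 0<q))
    where
    0<q : 0ℚ < q
    0<q = <-≤-trans 0<p p≤q

  -- Powers

  1^ : ∀ n → 1ℚ ^ n ≡ 1ℚ
  1^ zero    = refl
  1^ (suc n) = trans (*-identityˡ _) (1^ n)

  ^-nonNeg : ∀ {q} → 0ℚ ≤ q → ∀ n → 0ℚ ≤ q ^ n
  ^-nonNeg 0≤q zero    = 0≤1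
  ^-nonNeg 0≤q (suc n) = 0≤* 0≤q (^-nonNeg 0≤q n)

  ^-pos : ∀ {q} → 0ℚ < q → ∀ n → 0ℚ < q ^ n
  ^-pos 0<q zero    = 0<1
  ^-pos 0<q (suc n) = 0<* 0<q (^-pos 0<q n)

  ^-mono : ∀ {p q} → 0ℚ ≤ p → p ≤ q → ∀ n → p ^ n ≤ q ^ n
  ^-mono 0≤p p≤q zero    = ≤-refl
  ^-mono 0≤p p≤q (suc n) =
    *-mono 0≤p (^-nonNeg (≤-trans 0≤p p≤q) n) p≤q (^-mono 0≤p p≤q n)

  ^≤1 : ∀ {p} → 0ℚ ≤ p → p ≤ 1ℚ → ∀ n → p ^ n ≤ 1ℚ
  ^≤1 0≤p p≤1 n = ≤-trans (^-mono 0≤p p≤1 n) (≤-reflexive (1^ n))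

  bernoulli : ∀ {x} → 0ℚ ≤ 1ℚ + x → ∀ n → 1ℚ + fromℕ n * x ≤ (1ℚ + x) ^ n
  bernoulli {x} h zero    = ≤-reflexive (trans (cong (1ℚ +_) (*-zeroˡ x)) (+-identityʳ 1ℚ))
  bernoulli {x} h (suc n) = ≤-trans
    (≤-by (fromℕ n * (x * x)) (0≤* (0≤fromℕ n) (0≤x² x))
      (trans (cong (λ m → (1ℚ + x) * (1ℚ + fromℕ n * x) - (1ℚ + m * x)) (fromℕ-suc n))
        (lem (fromℕ n) x)))
    (*-monoˡ (1ℚ + x) h (bernoulli h n))
    where
    lem : ∀ m x → (1ℚ + x) * (1ℚ + m * x) - (1ℚ + (m + 1ℚ) * x) ≡ m * (x * x)
    lem = solve-∀ ℚ-ring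

  ^-lipschitz : ∀ {u v M d} → 1ℚ ≤ M → ∣ u ∣ ≤ M → ∣ v ∣ ≤ M → ∣ u - v ∣ ≤ d →
                ∀ n → ∣ u ^ n - v ^ n ∣ ≤ fromℕ n * (d * M ^ n)
  ^-lipschitz {u} {v} {M} {d} 1≤M u≤M v≤M h zero = ≤-reflexive (sym (*-zeroˡ (d * 1ℚ)))
  ^-lipschitz {u} {v} {M} {d} 1≤M u≤M v≤M h (suc n) = ≤-trans
    (∣∣-via (u * (u ^ n - v ^ n)) ((u - v) * v ^ n) (split u v (u ^ n) (v ^ n))
      (∣∣-* u (u ^ n - v ^ n) u≤M (^-lipschitz 1≤M u≤M v≤M h n)) (∣∣-* (u - v) (v ^ n) h ∣v^n∣≤))
    (≤-reflexive (trans (merge (fromℕ n) d M (M ^ n))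
      (cong (_* (d * (M * M ^ n))) (sym (fromℕ-suc n)))))
    where
    split : ∀ u v x y → u * x - v * y ≡ u * (x - y) + (u - v) * y
    split = solve-∀ ℚ-ring
    merge : ∀ n d M x → M * (n * (d * x)) + d * (M * x) ≡ (n + 1ℚ) * (d * (M * x))
    merge = solve-∀ ℚ-ring
    0≤M : 0ℚ ≤ M
    0≤M = ≤-trans 0≤1 1≤M
    ∣v^∣≤ : ∀ n → ∣ v ^ n ∣ ≤ M ^ n
    ∣v^∣≤ zero    = ≤-refl
    ∣v^∣≤ (suc n) = ∣∣-* v (v ^ n) v≤M (∣v^∣≤ n)
    ∣v^n∣≤ : ∣ v ^ n ∣ ≤ M * M ^ n
    ∣v^n∣≤ = ≤-trans (∣v^∣≤ n) (≤-by ((M - 1ℚ) * M ^ n)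
      (0≤* (0≤- 1≤M) (^-nonNeg 0≤M n)) (lem M (M ^ n)))
      where
      lem : ∀ M x → M * x - x ≡ (M - 1ℚ) * x
      lem = solve-∀ ℚ-ring

  0<½^ : ∀ k → 0ℚ < ½ ^ k
  0<½^ = ^-pos 0<½

  0≤½^ : ∀ k → 0ℚ ≤ ½ ^ k
  0≤½^ k = <⇒≤ (0<½^ k)

  ½^≤1 : ∀ k → ½ ^ k ≤ 1ℚ
  ½^≤1 = ^≤1 0≤½ (≤-by ½ 0≤½ refl)

  fromℕ-2^ : ∀ k → fromℕ (2 ℕ.^ k) * ½ ^ k ≡ 1ℚ
  fromℕ-2^ zero    = refl
  fromℕ-2^ (suc k) = trans (cong (_* (½ * ½ ^ k)) (fromℕ-2* (2 ℕ.^ k)))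
    (trans (lem (fromℕ (2 ℕ.^ k)) (½ ^ k)) (fromℕ-2^ k))
    where
    lem : ∀ n x → (n + n) * (½ * x) ≡ n * x
    lem = solve-∀ ℚ-ring

  n½^n≤1 : ∀ n → fromℕ n * ½ ^ n ≤ 1ℚ
  n½^n≤1 zero    = 0≤1
  n½^n≤1 (suc n) = ≤-by (½ * (1ℚ - fromℕ n * ½ ^ n) + ½ * (1ℚ - ½ ^ n))
    (0≤+ (0≤* 0≤½ (0≤- (n½^n≤1 n))) (0≤* 0≤½ (0≤- (½^≤1 n))))
    (trans (cong (λ m → 1ℚ - m * (½ * ½ ^ n)) (fromℕ-suc n)) (lem (fromℕ n) (½ ^ n)))
    where
    lem : ∀ n x → 1ℚ - (n + 1ℚ) * (½ * x) ≡ ½ * (1ℚ - n * x) + ½ * (1ℚ - x)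
    lem = solve-∀ ℚ-ring

  -- Every C is eventually dominated by 2^k ε.
  ½^-small : ∀ C {ε} → 0ℚ < ε → ∃[ N ] ∀ k → N ℕ.≤ k → C * ½ ^ k ≤ ε
  ½^-small C {ε} 0<ε with archimedean (C * inv ε)
  ... | N , h = N , λ k N≤k → let open ≤-Reasoning in begin
    C * ½ ^ k                    ≡⟨ cong (_* ½ ^ k) (trans (sym (*-identityʳ C)) (trans (cong (C *_) (sym (inv-inverse (pos⇒≢0 0<ε)))) (lem C ε (inv ε)))) ⟩
    C * inv ε * ε * ½ ^ k        ≤⟨ *-monoʳ (½ ^ k) (0≤½^ k) (*-monoʳ ε (<⇒≤ 0<ε) (≤-trans h (fromℕ-mono N≤k))) ⟩
    fromℕ k * ε * ½ ^ k          ≡⟨ lem₂ (fromℕ k) ε (½ ^ k) ⟩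
    ε * (fromℕ k * ½ ^ k)        ≤⟨ *-monoˡ ε (<⇒≤ 0<ε) (n½^n≤1 k) ⟩
    ε * 1ℚ                       ≡⟨ *-identityʳ ε ⟩
    ε                            ∎
    where
    lem : ∀ C ε i → C * (ε * i) ≡ C * i * ε
    lem = solve-∀ ℚ-ring
    lem₂ : ∀ n ε x → n * ε * x ≡ ε * (n * x)
    lem₂ = solve-∀ ℚ-ring

  -- Sums

  ∑-const : ∀ n c → ∑ n (λ _ → c) ≡ fromℕ n * c
  ∑-const zero    c = sym (*-zeroˡ c)
  ∑-const (suc n) c = trans (cong (_+ c) (∑-const n c))
    (trans (lem (fromℕ n) c) (cong (_* c) (sym (fromℕ-suc n))))
    where
    lem : ∀ n c → n * c + c ≡ (n + 1ℚ) * c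
    lem = solve-∀ ℚ-ring

  ∑-mono : ∀ n {f g} → (∀ i → i ℕ.< n → f i ≤ g i) → ∑ n f ≤ ∑ n g
  ∑-mono zero    h = ≤-refl
  ∑-mono (suc n) h =
    +-mono-≤ (∑-mono n λ i i<n → h i (ℕ.m≤n⇒m≤1+n i<n)) (h n ℕ.≤-refl)

  ∑-diff : ∀ n {f g} c → (∀ i → i ℕ.< n → ∣ f i - g i ∣ ≤ c) →
           ∣ ∑ n f - ∑ n g ∣ ≤ fromℕ n * c
  ∑-diff zero            c h = ≤-reflexive (sym (*-zeroˡ c))
  ∑-diff (suc n) {f} {g} c h = ≤-trans
    (∣∣-via (∑ n f - ∑ n g) (f n - g n) (split (∑ n f) (f n) (∑ n g) (g n))
      (∑-diff n c λ i i<n → h i (ℕ.m≤n⇒m≤1+n i<n)) (h n ℕ.≤-refl))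
    (≤-reflexive (trans (merge (fromℕ n) c) (cong (_* c) (sym (fromℕ-suc n)))))
    where
    split : ∀ a b c d → a + b - (c + d) ≡ (a - c) + (b - d)
    split = solve-∀ ℚ-ring
    merge : ∀ n c → n * c + c ≡ (n + 1ℚ) * c
    merge = solve-∀ ℚ-ring

  ∑-gap : ∀ n {f g c} → (∀ i → i ℕ.< n → c ≤ f i - g i) → fromℕ n * c ≤ ∑ n f - ∑ n g
  ∑-gap zero    {c = c} h = ≤-reflexive (*-zeroˡ c)
  ∑-gap (suc n) {f} {g} {c} h = ≤-trans
    (≤-reflexive (trans (cong (_* c) (fromℕ-suc n)) (split (fromℕ n) c)))
    (≤-trans (+-mono-≤ (∑-gap n {f} {g} {c} λ i i<n → h i (ℕ.m≤n⇒m≤1+n i<n)) (h n ℕ.≤-refl))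
      (≤-reflexive (merge (∑ n f) (f n) (∑ n g) (g n))))
    where
    split : ∀ n c → (n + 1ℚ) * c ≡ n * c + c
    split = solve-∀ ℚ-ring
    merge : ∀ a b c d → (a - c) + (b - d) ≡ a + b - (c + d)
    merge = solve-∀ ℚ-ring

  ∑-double : ∀ n f → ∑ (2 ℕ.* n) f ≡ ∑ n (λ i → f (2 ℕ.* i) + f (suc (2 ℕ.* i)))
  ∑-double zero    f = refl
  ∑-double (suc n) f = trans (cong (λ m → ∑ m f) (ℕ.*-suc 2 n))
    (trans (+-assoc (∑ (2 ℕ.* n) f) (f (2 ℕ.* n)) (f (suc (2 ℕ.* n))))
      (cong (_+ (f (2 ℕ.* n) + f (suc (2 ℕ.* n)))) (∑-double n f)))

------------------------------------------------------------------------
-- The real numbers, as Cauchy sequences of rationals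

Eventually : (ℕ → Set) → Set
Eventually P = ∃[ N ] (∀ n → N ℕ.≤ n → P n)

IsCauchy : (ℕ → ℚ) → Set
IsCauchy x = ∀ ε → 0ℚ < ε →
  ∃[ N ] (∀ m n → N ℕ.≤ m → N ℕ.≤ n → ∣ x m - x n ∣ ≤ ε)

-- Equal reals may have different representatives; order and apartness below
-- do not distinguish them.
record ℝ : Set where
  constructor mkℝ
  field
    seq    : ℕ → ℚ
    cauchy : IsCauchy seq

open ℝ public

infix 4 _≤ℝ_ _<ℝ_ _#_

_≤ℝ_ : ℝ → ℝ → Set
x ≤ℝ y = ∀ ε → 0ℚ < ε → Eventually λ n → seq x n ≤ seq y n + ε

_<ℝ_ : ℝ → ℝ → Set
x <ℝ y = ∃[ ε ] (0ℚ < ε × Eventually λ n → seq x n + ε ≤ seq y n)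

_#_ : ℝ → ℝ → Set
x # y = x <ℝ y ⊎ y <ℝ x

abstract

  _and_ : ∀ {P Q} → Eventually P → Eventually Q → Eventually λ n → P n × Q n
  (M , p) and (N , q) = M ℕ.⊔ N , λ n h →
    p n (ℕ.≤-trans (ℕ.m≤m⊔n M N) h) , q n (ℕ.≤-trans (ℕ.m≤n⊔m M N) h)

  eventually-map : ∀ {P Q : ℕ → Set} → (∀ n → P n → Q n) → Eventually P → Eventually Q
  eventually-map f (N , p) = N , λ n h → f n (p n h)

  fromOrdered : ∀ x →
    (∀ ε → 0ℚ < ε → ∃[ N ] (∀ m n → N ℕ.≤ n → n ℕ.≤ m → ∣ x m - x n ∣ ≤ ε)) → IsCauchy x
  fromOrdered x h ε 0<ε with h ε 0<ε
  ... | N , p = N , λ m n N≤m N≤n → helper m n N≤m N≤n (ℕ.≤-total n m)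
    where
    helper : ∀ m n → N ℕ.≤ m → N ℕ.≤ n → n ℕ.≤ m ⊎ m ℕ.≤ n → ∣ x m - x n ∣ ≤ ε
    helper m n N≤m N≤n (inj₁ n≤m) = p m n N≤n n≤m
    helper m n N≤m N≤n (inj₂ m≤n) =
      ≤-trans (≤-reflexive (∣p-q∣≡∣q-p∣ (x m) (x n))) (p n m N≤m m≤n)

  const-cauchy : ∀ q → IsCauchy λ _ → q
  const-cauchy q ε 0<ε = 0 , λ _ _ _ _ →
    ≤-trans (≤-reflexive (cong ∣_∣ (+-inverseʳ q))) (<⇒≤ 0<ε)

  bounded : ∀ x → IsCauchy x → ∃[ c ] Eventually λ n → ∣ x n ∣ ≤ fromℕ c
  bounded x hx with hx 1ℚ 0<1
  ... | N , p with archimedean (1ℚ + ∣ x N ∣)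
  ...   | c , h = c , N , λ n N≤n →
    ≤-trans (∣∣-via (x n - x N) (x N) (lem (x n) (x N)) (p n N N≤n ℕ.≤-refl) ≤-refl) h
    where
    lem : ∀ a b → a ≡ a - b + b
    lem = solve-∀ ℚ-ring

  boundedℚ : ∀ x → IsCauchy x → ∃[ c ] (0ℚ ≤ c × Eventually λ n → ∣ x n ∣ ≤ c)
  boundedℚ x hx = fromℕ (proj₁ (bounded x hx)) , 0≤fromℕ (proj₁ (bounded x hx)) , proj₂ (bounded x hx)

  ≤-⊔₁ : ∀ {n} K M N → K ℕ.⊔ (M ℕ.⊔ N) ℕ.≤ n → K ℕ.≤ n
  ≤-⊔₁ K M N = ℕ.≤-trans (ℕ.m≤m⊔n K (M ℕ.⊔ N))

  ≤-⊔₂ : ∀ {n} K M N → K ℕ.⊔ (M ℕ.⊔ N) ℕ.≤ n → M ℕ.≤ n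
  ≤-⊔₂ K M N h = ℕ.≤-trans (ℕ.m≤m⊔n M N) (ℕ.≤-trans (ℕ.m≤n⊔m K (M ℕ.⊔ N)) h)

  ≤-⊔₃ : ∀ {n} K M N → K ℕ.⊔ (M ℕ.⊔ N) ℕ.≤ n → N ℕ.≤ n
  ≤-⊔₃ K M N h = ℕ.≤-trans (ℕ.m≤n⊔m M N) (ℕ.≤-trans (ℕ.m≤n⊔m K (M ℕ.⊔ N)) h)

  -- For B ≥ 0 and ε > 0 there is δ > 0 with B δ ≤ ε.
  shrink : ∀ B ε → 0ℚ ≤ B → 0ℚ < ε → ∃[ δ ] (0ℚ < δ × B * δ ≤ ε)
  shrink B ε 0≤B 0<ε = ε * inv (B + 1ℚ) , 0<* 0<ε (inv-pos 0<B+1) ,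
    ≤-by (ε * inv (B + 1ℚ)) (0≤* (<⇒≤ 0<ε) (<⇒≤ (inv-pos 0<B+1)))
      (trans (cong (_- B * (ε * inv (B + 1ℚ)))
          (trans (sym (*-identityʳ ε)) (cong (ε *_) (sym (inv-inverse (pos⇒≢0 0<B+1))))))
        (lem B ε (inv (B + 1ℚ))))
    where
    0<B+1 : 0ℚ < B + 1ℚ
    0<B+1 = 0<+ 0≤B 0<1
    lem : ∀ B ε i → ε * ((B + 1ℚ) * i) - B * (ε * i) ≡ ε * i
    lem = solve-∀ ℚ-ring

  0<½* : ∀ ε → 0ℚ < ε → 0ℚ < ½ * ε
  0<½* ε = 0<* {½} {ε} 0<½

  +-cauchy : ∀ x y → IsCauchy x → IsCauchy y → IsCauchy λ n → x n + y n
  +-cauchy x y hx hy ε 0<ε with hx (½ * ε) (0<½* ε 0<ε) | hy (½ * ε) (0<½* ε 0<ε)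
  ... | M , p | N , q = M ℕ.⊔ N , λ m n hm hn → ≤-trans
    (∣∣-via (x m - x n) (y m - y n) (lem (x m) (y m) (x n) (y n))
      (p m n (ℕ.≤-trans (ℕ.m≤m⊔n M N) hm) (ℕ.≤-trans (ℕ.m≤m⊔n M N) hn))
      (q m n (ℕ.≤-trans (ℕ.m≤n⊔m M N) hm) (ℕ.≤-trans (ℕ.m≤n⊔m M N) hn)))
    (≤-reflexive (half+half ε))
    where
    lem : ∀ a b c d → a + b - (c + d) ≡ (a - c) + (b - d)
    lem = solve-∀ ℚ-ring

  neg-cauchy : ∀ x → IsCauchy x → IsCauchy λ n → - x n
  neg-cauchy x hx ε 0<ε with hx ε 0<ε
  ... | N , p = N , λ m n hm hn → ≤-trans
    (≤-reflexive (trans (cong ∣_∣ (lem (x m) (x n))) (∣p-q∣≡∣q-p∣ (x n) (x m)))) (p m n hm hn)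
    where
    lem : ∀ a b → - a - - b ≡ b - a
    lem = solve-∀ ℚ-ring

  *-close : ∀ a b c d p q r s → ∣ a ∣ ≤ p → ∣ b - d ∣ ≤ q → ∣ d ∣ ≤ r → ∣ a - c ∣ ≤ s →
            ∣ a * b - c * d ∣ ≤ p * q + r * s
  *-close a b c d p q r s h₁ h₂ h₃ h₄ =
    ∣∣-via (a * (b - d)) (d * (a - c)) (lem a b c d) (∣∣-* a (b - d) h₁ h₂) (∣∣-* d (a - c) h₃ h₄)
    where
    lem : ∀ a b c d → a * b - c * d ≡ a * (b - d) + d * (a - c)
    lem = solve-∀ ℚ-ring

  *-cauchy : ∀ x y → IsCauchy x → IsCauchy y → IsCauchy λ n → x n * y n
  *-cauchy x y hx hy ε 0<ε =
    let b , 0≤b , bx       = boundedℚ x hx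
        c , 0≤c , by       = boundedℚ y hy
        δ , 0<δ , bδ       = shrink b (½ * ε) 0≤b (0<½* ε 0<ε)
        η , 0<η , cη       = shrink c (½ * ε) 0≤c (0<½* ε 0<ε)
        K , k              = bx and by
        M , p              = hy δ 0<δ
        N , q              = hx η 0<η
        toK                = λ {n} → ≤-⊔₁ {n} K M N
        toM                = λ {n} → ≤-⊔₂ {n} K M N
        toN                = λ {n} → ≤-⊔₃ {n} K M N
    in K ℕ.⊔ (M ℕ.⊔ N) , λ m n hm hn → ≤-trans
      (*-close (x m) (y m) (x n) (y n) b δ c η (proj₁ (k m (toK hm))) (p m n (toM hm) (toM hn))
                       (proj₂ (k n (toK hn))) (q m n (toN hm) (toN hn)))
      (≤-trans (+-mono-≤ bδ cη) (≤-reflexive (half+half ε)))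

  -- Let F k converge geometrically and be Lipschitz, uniformly on P. Then
  -- lim (F k) can be evaluated along the diagonal at any real eventually in P.
  diagonal-cauchy : (F : ℕ → ℚ → ℚ) (P : ℚ → Set) (C B : ℚ) → 0ℚ ≤ C → 0ℚ ≤ B →
    (∀ k q → P q → ∣ F (suc k) q - F k q ∣ ≤ C * ½ ^ k) →
    (∀ k q r → P q → P r → ∣ F k q - F k r ∣ ≤ B * ∣ q - r ∣) →
    ∀ x → IsCauchy x → Eventually (λ n → P (x n)) → IsCauchy λ k → F k (x k)
  diagonal-cauchy F P C B 0≤C 0≤B step lip x hx (K , k) = fromOrdered (λ k → F k (x k)) main
    where
    telescope : ∀ k j q → P q → ∣ F (j ℕ.+ k) q - F k q ∣ ≤ (C + C) * (½ ^ k - ½ ^ (j ℕ.+ k))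
    telescope k zero    q Pq = ≤-reflexive (trans (cong ∣_∣ (+-inverseʳ (F k q)))
      (sym (trans (cong ((C + C) *_) (+-inverseʳ (½ ^ k))) (*-zeroʳ (C + C)))))
    telescope k (suc j) q Pq = ≤-trans
      (∣∣-via (F (suc j ℕ.+ k) q - F (j ℕ.+ k) q) (F (j ℕ.+ k) q - F k q) (split (F (suc j ℕ.+ k) q) (F (j ℕ.+ k) q) (F k q))
        (step (j ℕ.+ k) q Pq) (telescope k j q Pq))
      (≤-reflexive (merge C (½ ^ (j ℕ.+ k)) (½ ^ k)))
      where
      split : ∀ a b c → a - c ≡ (a - b) + (b - c)
      split = solve-∀ ℚ-ring
      merge : ∀ C x y → C * x + (C + C) * (y - x) ≡ (C + C) * (y - ½ * x)
      merge = solve-∀ ℚ-ring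

    geometric : ∀ k m q → k ℕ.≤ m → P q → ∣ F m q - F k q ∣ ≤ (C + C) * ½ ^ k
    geometric k m q k≤m Pq = subst (λ m → ∣ F m q - F k q ∣ ≤ (C + C) * ½ ^ k) (ℕ.m∸n+n≡m k≤m)
      (≤-trans (telescope k (m ℕ.∸ k) q Pq) (≤-by ((C + C) * ½ ^ (m ℕ.∸ k ℕ.+ k))
        (0≤* {C + C} {½ ^ (m ℕ.∸ k ℕ.+ k)} (0≤+ {C} {C} 0≤C 0≤C) (0≤½^ (m ℕ.∸ k ℕ.+ k))) (lem (C + C) (½ ^ k) (½ ^ (m ℕ.∸ k ℕ.+ k)))))
      where
      lem : ∀ C x y → C * x - C * (x - y) ≡ C * y
      lem = solve-∀ ℚ-ring

    main : ∀ ε → 0ℚ < ε →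
      ∃[ N ] (∀ m n → N ℕ.≤ n → n ℕ.≤ m → ∣ F m (x m) - F n (x n) ∣ ≤ ε)
    main ε 0<ε =
      let δ , 0<δ , Bδ = shrink B (½ * ε) 0≤B (0<½* ε 0<ε)
          M , small    = ½^-small (C + C) (0<½* ε 0<ε)
          N , p        = hx δ 0<δ
          toK          = λ {n} → ≤-⊔₁ {n} K M N
          toM          = λ {n} → ≤-⊔₂ {n} K M N
          toN          = λ {n} → ≤-⊔₃ {n} K M N
      in K ℕ.⊔ (M ℕ.⊔ N) , λ m n hn n≤m → ≤-trans
        (∣∣-via (F m (x m) - F m (x n)) (F m (x n) - F n (x n))
          (split (F m (x m)) (F m (x n)) (F n (x n)))
          (≤-trans (lip m (x m) (x n) (k m (ℕ.≤-trans (toK hn) n≤m)) (k n (toK hn)))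
            (≤-trans (*-monoˡ B 0≤B (p m n (ℕ.≤-trans (toN hn) n≤m) (toN hn))) Bδ))
          (≤-trans (geometric n m (x n) n≤m (k n (toK hn))) (small n (toM hn))))
        (≤-reflexive (half+half ε))
      where
      split : ∀ a b c → a - c ≡ (a - b) + (b - c)
      split = solve-∀ ℚ-ring

infixl 6 _+ℝ_ _-ℝ_
infixl 7 _*ℝ_

fromℚ : ℚ → ℝ
fromℚ q = mkℝ (λ _ → q) (const-cauchy q)

0ℝ 1ℝ : ℝ
0ℝ = fromℚ 0ℚ
1ℝ = fromℚ 1ℚ

_+ℝ_ _-ℝ_ _*ℝ_ : ℝ → ℝ → ℝ
x +ℝ y = mkℝ (λ n → seq x n + seq y n) (+-cauchy (seq x) (seq y) (cauchy x) (cauchy y))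
x -ℝ y = mkℝ (λ n → seq x n - seq y n) (+-cauchy (seq x) (λ n → - seq y n) (cauchy x) (neg-cauchy (seq y) (cauchy y)))
x *ℝ y = mkℝ (λ n → seq x n * seq y n) (*-cauchy (seq x) (seq y) (cauchy x) (cauchy y))

abstract

  #0⇒bounded-away : ∀ x → x # 0ℝ →
    ∃[ δ ] (0ℚ < δ × Eventually λ n → δ ≤ ∣ seq x n ∣)
  #0⇒bounded-away x (inj₁ (δ , 0<δ , h)) = δ , 0<δ , eventually-map
    (λ n p → ≤-trans (≤-by _ (0≤- p) (lem (seq x n) δ)) (-p≤∣p∣ (seq x n))) h
    where
    lem : ∀ a δ → - a - δ ≡ 0ℚ - (a + δ)
    lem = solve-∀ ℚ-ring
  #0⇒bounded-away x (inj₂ (δ , 0<δ , h)) = δ , 0<δ , eventually-map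
    (λ n p → ≤-trans (subst (_≤ seq x n) (+-identityˡ δ) p) (p≤∣p∣ (seq x n))) h

  inv-cauchy : ∀ x → x # 0ℝ → IsCauchy λ n → inv (seq x n)
  inv-cauchy x x#0 with #0⇒bounded-away x x#0
  ... | δ , 0<δ , h = diagonal-cauchy (λ _ → inv) (λ q → δ ≤ ∣ q ∣) 0ℚ (S * S) ≤-refl (0≤* 0≤S 0≤S)
    (λ k q _ → ≤-reflexive (trans (cong ∣_∣ (+-inverseʳ (inv q))) (sym (*-zeroˡ (½ ^ k)))))
    (λ _ q r hq hr → ≤-trans (≤-reflexive (cong ∣_∣ (inv-diff (≢0 hq) (≢0 hr))))
      (≤-trans (∣∣-* (r - q) (inv q * inv r) (≤-reflexive (∣p-q∣≡∣q-p∣ r q)) (∣∣-* (inv q) (inv r) (∣inv∣≤ hq) (∣inv∣≤ hr)))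
        (≤-reflexive (*-comm ∣ q - r ∣ (S * S)))))
    (seq x) (cauchy x) h
    where
    S : ℚ
    S = inv δ
    0≤S : 0ℚ ≤ S
    0≤S = <⇒≤ (inv-pos 0<δ)
    ≢0 : ∀ {q} → δ ≤ ∣ q ∣ → q ≢ 0ℚ
    ≢0 h refl = <-irrefl refl (<-≤-trans 0<δ h)
    ∣inv∣≤ : ∀ {q} → δ ≤ ∣ q ∣ → ∣ inv q ∣ ≤ S
    ∣inv∣≤ {q} h = subst₂ _≤_ eq (*-identityˡ S)
      (≤-trans (*-monoʳ ∣ inv q ∣ (0≤∣p∣ (inv q)) (subst (_≤ S * ∣ q ∣) (trans (*-comm S δ) (inv-inverse (pos⇒≢0 0<δ))) (*-monoˡ S 0≤S h)))
        (≤-reflexive (trans (*-assoc S ∣ q ∣ ∣ inv q ∣) (trans (cong (S *_) one) (*-comm S 1ℚ)))))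
      where
      one : ∣ q ∣ * ∣ inv q ∣ ≡ 1ℚ
      one = trans (sym (∣p*q∣≡∣p∣*∣q∣ q (inv q))) (cong ∣_∣ (inv-inverse (≢0 h)))
      eq : 1ℚ * ∣ inv q ∣ ≡ ∣ inv q ∣
      eq = *-identityˡ ∣ inv q ∣

-- The proof after ∵ is the side condition of the operation; the value does
-- not depend on it.
infixl 7 _÷ℝ_∵_

_÷ℝ_∵_ : (x y : ℝ) → y # 0ℝ → ℝ
x ÷ℝ y ∵ y#0 = mkℝ (λ n → seq x n * inv (seq y n)) (*-cauchy (seq x) (λ n → inv (seq y n)) (cauchy x) (inv-cauchy y y#0))

------------------------------------------------------------------------
-- The exponential function: exp x = lim (1 + x/N)^N along N = 2^k

expₛ : ℕ → ℚ → ℚ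
expₛ k q = (1ℚ + q * ½ ^ k) ^ (2 ℕ.^ k)

abstract

  0≤2ℚ : 0ℚ ≤ 1ℚ + 1ℚ
  0≤2ℚ = 0≤+ {1ℚ} {1ℚ} 0≤1 0≤1

  expₛ-bound : ∀ d k → expₛ k (fromℕ d) ≤ (1ℚ + 1ℚ) ^ (2 ℕ.* d)
  expₛ-bound d k = begin
    (1ℚ + fromℕ d * ½ ^ k) ^ N    ≤⟨ ^-mono base≥0 base≤ N ⟩
    ((1ℚ + t) ^ (2 ℕ.* d)) ^ N    ≡⟨ Exp.^-assocʳ (1ℚ + t) (2 ℕ.* d) N ⟩
    (1ℚ + t) ^ (2 ℕ.* d ℕ.* N)    ≡⟨ cong ((1ℚ + t) ^_) (ℕ.*-comm (2 ℕ.* d) N) ⟩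
    (1ℚ + t) ^ (N ℕ.* (2 ℕ.* d))  ≡⟨ Exp.^-assocʳ (1ℚ + t) N (2 ℕ.* d) ⟨
    ((1ℚ + t) ^ N) ^ (2 ℕ.* d)    ≤⟨ ^-mono (^-nonNeg 0≤1+t N) u≤2 (2 ℕ.* d) ⟩
    (1ℚ + 1ℚ) ^ (2 ℕ.* d)         ∎
    where
    open ≤-Reasoning
    N : ℕ
    N = 2 ℕ.^ k
    t u v : ℚ
    t = ½ * ½ ^ k
    u = (1ℚ + t) ^ N
    v = (1ℚ + - t) ^ N
    0≤t : 0ℚ ≤ t
    0≤t = 0≤½^ (suc k)
    0≤1+t : 0ℚ ≤ 1ℚ + t
    0≤1+t = 0≤+ {1ℚ} {t} 0≤1 0≤t
    0≤1-t : 0ℚ ≤ 1ℚ + - t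
    0≤1-t = 0≤- {t} {1ℚ} (½^≤1 (suc k))
    base≥0 : 0ℚ ≤ 1ℚ + fromℕ d * ½ ^ k
    base≥0 = 0≤+ {1ℚ} {fromℕ d * ½ ^ k} 0≤1 (0≤* {fromℕ d} {½ ^ k} (0≤fromℕ d) (0≤½^ k))
    base≤ : 1ℚ + fromℕ d * ½ ^ k ≤ (1ℚ + t) ^ (2 ℕ.* d)
    base≤ = ≤-trans (≤-reflexive (trans (lem (fromℕ d) (½ ^ k))
      (cong (λ z → 1ℚ + z * t) (sym (fromℕ-2* d))))) (bernoulli {t} 0≤1+t (2 ℕ.* d))
      where
      lem : ∀ d x → 1ℚ + d * x ≡ 1ℚ + (d + d) * (½ * x)
      lem = solve-∀ ℚ-ring
    ½≤v : ½ ≤ v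
    ½≤v = ≤-trans (≤-reflexive (sym (trans (lem (fromℕ N) (½ ^ k)) (cong (λ z → 1ℚ + - (½ * z)) (fromℕ-2^ k)))))
      (bernoulli { - t} 0≤1-t N)
      where
      lem : ∀ n x → 1ℚ + n * (- (½ * x)) ≡ 1ℚ + - (½ * (n * x))
      lem = solve-∀ ℚ-ring
    uv≤1 : u * v ≤ 1ℚ
    uv≤1 = ≤-trans (≤-reflexive (sym (Exp.^-distrib-* (1ℚ + t) (1ℚ + - t) N)))
      (^≤1 (0≤* {1ℚ + t} {1ℚ + - t} 0≤1+t 0≤1-t)
        (≤-by (t * t) (0≤* {t} {t} 0≤t 0≤t) (lem t)) N)
      where
      lem : ∀ t → 1ℚ - (1ℚ + t) * (1ℚ + - t) ≡ t * t
      lem = solve-∀ ℚ-ring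
    u≤2 : u ≤ 1ℚ + 1ℚ
    u≤2 = ≤-by ((1ℚ + 1ℚ) * ((1ℚ - u * v) + u * (v - ½)))
      (0≤* {1ℚ + 1ℚ} {(1ℚ - u * v) + u * (v - ½)} 0≤2ℚ
        (0≤+ {1ℚ - u * v} {u * (v - ½)} (0≤- uv≤1)
          (0≤* {u} {v - ½} (^-nonNeg 0≤1+t N) (0≤- ½≤v))))
      (lem u v)
      where
      lem : ∀ u v → 1ℚ + 1ℚ - u ≡ (1ℚ + 1ℚ) * ((1ℚ - u * v) + u * (v - ½))
      lem = solve-∀ ℚ-ring

  module _ (d : ℕ) where

    private
      c B : ℚ
      c = fromℕ d
      B = (1ℚ + 1ℚ) ^ (2 ℕ.* d)

      0≤c : 0ℚ ≤ c
      0≤c = 0≤fromℕ d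

      0≤B : 0ℚ ≤ B
      0≤B = ^-nonNeg 0≤2ℚ (2 ℕ.* d)

      base : ∀ {q} e → 0ℚ ≤ e → ∣ q ∣ ≤ c → ∣ 1ℚ + q * e ∣ ≤ 1ℚ + c * e
      base {q} e 0≤e h = ∣∣-via 1ℚ (q * e) refl ≤-refl (∣∣-* q e h (∣∣-nonNeg 0≤e ≤-refl))

    expₛ-step : ∀ k q → ∣ q ∣ ≤ c → ∣ expₛ (suc k) q - expₛ k q ∣ ≤ (c * c * (½ * ½) * B) * ½ ^ k
    expₛ-step k q h = begin
      ∣ w ^ (2 ℕ.* N) - v ^ N ∣                  ≡⟨ cong (λ z → ∣ z - v ^ N ∣) (Exp.^-assocʳ w 2 N) ⟨
      ∣ (w ^ 2) ^ N - v ^ N ∣                    ≤⟨ ^-lipschitz 1≤M w²≤ v≤ diff N ⟩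
      fromℕ N * ((c * e) * (c * e) * (M₁ ^ 2) ^ N)  ≡⟨ cong (λ z → fromℕ N * ((c * e) * (c * e) * z)) (Exp.^-assocʳ M₁ 2 N) ⟩
      fromℕ N * ((c * e) * (c * e) * expₛ (suc k) c) ≤⟨ *-monoˡ (fromℕ N) (0≤fromℕ N) (*-monoˡ ((c * e) * (c * e)) (0≤* {c * e} {c * e} 0≤ce 0≤ce) (expₛ-bound d (suc k))) ⟩
      fromℕ N * ((c * e) * (c * e) * B)          ≡⟨ lem (fromℕ N) c (½ ^ k) B ⟩
      (c * c * (½ * ½) * B) * ½ ^ k * (fromℕ N * ½ ^ k) ≡⟨ cong ((c * c * (½ * ½) * B) * ½ ^ k *_) (fromℕ-2^ k) ⟩
      (c * c * (½ * ½) * B) * ½ ^ k * 1ℚ         ≡⟨ *-identityʳ ((c * c * (½ * ½) * B) * ½ ^ k) ⟩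
      (c * c * (½ * ½) * B) * ½ ^ k              ∎
      where
      open ≤-Reasoning
      N : ℕ
      N = 2 ℕ.^ k
      e w v M₁ : ℚ
      e = ½ * ½ ^ k
      w = 1ℚ + q * e
      v = 1ℚ + q * ½ ^ k
      M₁ = 1ℚ + c * e
      lem : ∀ n c x B → n * ((c * (½ * x)) * (c * (½ * x)) * B) ≡ (c * c * (½ * ½) * B) * x * (n * x)
      lem = solve-∀ ℚ-ring
      0≤ce : 0ℚ ≤ c * e
      0≤ce = 0≤* {c} {e} 0≤c (0≤½^ (suc k))
      w≤ : ∣ w ∣ ≤ M₁
      w≤ = base {q} e (0≤½^ (suc k)) h
      w²≤ : ∣ w ^ 2 ∣ ≤ M₁ ^ 2
      w²≤ = ∣∣-* w (w * 1ℚ) w≤ (∣∣-* w 1ℚ w≤ ≤-refl)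
      v≤ : ∣ v ∣ ≤ M₁ ^ 2
      v≤ = ≤-trans (base {q} (½ ^ k) (0≤½^ k) h)
        (≤-by ((c * e) * (c * e)) (0≤* {c * e} {c * e} 0≤ce 0≤ce) (lem′ c (½ ^ k)))
        where
        lem′ : ∀ c x → (1ℚ + c * (½ * x)) * ((1ℚ + c * (½ * x)) * 1ℚ) - (1ℚ + c * x)
             ≡ (c * (½ * x)) * (c * (½ * x))
        lem′ = solve-∀ ℚ-ring
      1≤M : 1ℚ ≤ M₁ ^ 2
      1≤M = ≤-by (c * e + c * e + (c * e) * (c * e))
        (0≤+ {c * e + c * e} {(c * e) * (c * e)} (0≤+ {c * e} {c * e} 0≤ce 0≤ce)
          (0≤* {c * e} {c * e} 0≤ce 0≤ce)) (lem′ (c * e))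
        where
        lem′ : ∀ y → (1ℚ + y) * ((1ℚ + y) * 1ℚ) - 1ℚ ≡ y + y + y * y
        lem′ = solve-∀ ℚ-ring
      diff : ∣ w ^ 2 - v ∣ ≤ (c * e) * (c * e)
      diff = ≤-trans (≤-reflexive (cong ∣_∣ (lem′ q (½ ^ k))))
        (∣∣-* (q * e) (q * e) qe≤ qe≤)
        where
        qe≤ : ∣ q * e ∣ ≤ c * e
        qe≤ = ∣∣-* q e h (∣∣-nonNeg (0≤½^ (suc k)) ≤-refl)
        lem′ : ∀ q x → (1ℚ + q * (½ * x)) * ((1ℚ + q * (½ * x)) * 1ℚ) - (1ℚ + q * x)
             ≡ (q * (½ * x)) * (q * (½ * x))
        lem′ = solve-∀ ℚ-ring

    expₛ-lipschitz : ∀ k q r → ∣ q ∣ ≤ c → ∣ r ∣ ≤ c → ∣ expₛ k q - expₛ k r ∣ ≤ B * ∣ q - r ∣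
    expₛ-lipschitz k q r hq hr = begin
      ∣ u ^ N - v ^ N ∣                              ≤⟨ ^-lipschitz 1≤M (base {q} x (0≤½^ k) hq) (base {r} x (0≤½^ k) hr) diff N ⟩
      fromℕ N * (∣ q - r ∣ * x * expₛ k c)           ≤⟨ *-monoˡ (fromℕ N) (0≤fromℕ N) (*-monoˡ (∣ q - r ∣ * x) (0≤* {∣ q - r ∣} {x} (0≤∣p∣ (q - r)) (0≤½^ k)) (expₛ-bound d k)) ⟩
      fromℕ N * (∣ q - r ∣ * x * B)                  ≡⟨ lem (fromℕ N) ∣ q - r ∣ x B ⟩
      B * ∣ q - r ∣ * (fromℕ N * x)                  ≡⟨ cong (B * ∣ q - r ∣ *_) (fromℕ-2^ k) ⟩
      B * ∣ q - r ∣ * 1ℚ                             ≡⟨ *-identityʳ (B * ∣ q - r ∣) ⟩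
      B * ∣ q - r ∣                                  ∎
      where
      open ≤-Reasoning
      N : ℕ
      N = 2 ℕ.^ k
      x u v : ℚ
      x = ½ ^ k
      u = 1ℚ + q * x
      v = 1ℚ + r * x
      lem : ∀ n a x B → n * (a * x * B) ≡ B * a * (n * x)
      lem = solve-∀ ℚ-ring
      1≤M : 1ℚ ≤ 1ℚ + c * x
      1≤M = ≤-by (c * x) (0≤* {c} {x} 0≤c (0≤½^ k)) (lem′ (c * x))
        where
        lem′ : ∀ y → 1ℚ + y - 1ℚ ≡ y
        lem′ = solve-∀ ℚ-ring
      diff : ∣ u - v ∣ ≤ ∣ q - r ∣ * x
      diff = ≤-trans (≤-reflexive (cong ∣_∣ (lem′ q r x))) (∣∣-* (q - r) x ≤-refl (∣∣-nonNeg (0≤½^ k) ≤-refl))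
        where
        lem′ : ∀ q r x → 1ℚ + q * x - (1ℚ + r * x) ≡ (q - r) * x
        lem′ = solve-∀ ℚ-ring

    expₛ-cauchy : ∀ x → IsCauchy x → Eventually (λ n → ∣ x n ∣ ≤ c) → IsCauchy λ k → expₛ k (x k)
    expₛ-cauchy = diagonal-cauchy expₛ (λ q → ∣ q ∣ ≤ c) (c * c * (½ * ½) * B) B
      (0≤* {c * c * (½ * ½)} {B} (0≤* {c * c} {½ * ½} (0≤* {c} {c} 0≤c 0≤c) (0≤* {½} {½} 0≤½ 0≤½)) 0≤B)
      0≤B expₛ-step expₛ-lipschitz

exp : ℝ → ℝ
exp x = mkℝ (λ k → expₛ k (seq x k))
  (let d , h = bounded (seq x) (cauchy x) in expₛ-cauchy d (seq x) (cauchy x) h)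

------------------------------------------------------------------------
-- The natural logarithm: ln x = ∫₁ˣ dt/t, by left Riemann sums on 2^k
-- equal subintervals (x < 1 is covered by a negative mesh)

mesh : ℕ → ℚ → ℚ
mesh k q = (q - 1ℚ) * ½ ^ k

node : ℕ → ℚ → ℕ → ℚ
node k q i = 1ℚ + fromℕ i * mesh k q

lnₛ : ℕ → ℚ → ℚ
lnₛ k q = ∑ (2 ℕ.^ k) λ i → mesh k q * inv (node k q i)

abstract

  -- node k q i = (1 - s) + s q with s = i / 2^k.
  node-convex : ∀ k q i c → node k q i - c ≡
    (1ℚ - fromℕ i * ½ ^ k) * (1ℚ - c) + fromℕ i * ½ ^ k * (q - c)
  node-convex k q i c = lem (fromℕ i) q c (½ ^ k)
    where
    lem : ∀ i q c x → 1ℚ + i * ((q - 1ℚ) * x) - c ≡ (1ℚ - i * x) * (1ℚ - c) + i * x * (q - c)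
    lem = solve-∀ ℚ-ring

  fraction≤1 : ∀ k i → i ℕ.≤ 2 ℕ.^ k → 0ℚ ≤ 1ℚ - fromℕ i * ½ ^ k
  fraction≤1 k i i≤ = 0≤- (≤-trans (*-monoʳ (½ ^ k) (0≤½^ k) (fromℕ-mono i≤)) (≤-reflexive (fromℕ-2^ k)))

  0≤fraction : ∀ k i → 0ℚ ≤ fromℕ i * ½ ^ k
  0≤fraction k i = 0≤* {fromℕ i} {½ ^ k} (0≤fromℕ i) (0≤½^ k)

  node-lower : ∀ k q i δ → δ ≤ 1ℚ → δ ≤ q → i ℕ.≤ 2 ℕ.^ k → δ ≤ node k q i
  node-lower k q i δ δ≤1 δ≤q i≤ = ≤-by
    ((1ℚ - fromℕ i * ½ ^ k) * (1ℚ - δ) + fromℕ i * ½ ^ k * (q - δ))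
    (0≤+ {(1ℚ - fromℕ i * ½ ^ k) * (1ℚ - δ)} {fromℕ i * ½ ^ k * (q - δ)}
      (0≤* {1ℚ - fromℕ i * ½ ^ k} {1ℚ - δ} (fraction≤1 k i i≤) (0≤- δ≤1))
      (0≤* {fromℕ i * ½ ^ k} {q - δ} (0≤fraction k i) (0≤- δ≤q)))
    (node-convex k q i δ)

  node-upper : ∀ k q i c → 1ℚ ≤ c → q ≤ c → i ℕ.≤ 2 ℕ.^ k → node k q i ≤ c
  node-upper k q i c 1≤c q≤c i≤ = ≤-by
    ((1ℚ - s) * (c - 1ℚ) + s * (c - q))
    (0≤+ {(1ℚ - s) * (c - 1ℚ)} {s * (c - q)}
      (0≤* {1ℚ - s} {c - 1ℚ} (fraction≤1 k i i≤) (0≤- 1≤c))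
      (0≤* {s} {c - q} (0≤fraction k i) (0≤- q≤c)))
    (trans (neg-diff c (node k q i)) (trans (cong -_ (node-convex k q i c)) (lem s q c)))
    where
    s : ℚ
    s = fromℕ i * ½ ^ k
    neg-diff : ∀ a b → a - b ≡ - (b - a)
    neg-diff = solve-∀ ℚ-ring
    lem : ∀ s q c → - ((1ℚ - s) * (1ℚ - c) + s * (q - c)) ≡ (1ℚ - s) * (c - 1ℚ) + s * (c - q)
    lem = solve-∀ ℚ-ring

  2^k*mesh : ∀ k q → fromℕ (2 ℕ.^ k) * mesh k q ≡ q - 1ℚ
  2^k*mesh k q = trans (lem (fromℕ (2 ℕ.^ k)) (q - 1ℚ) (½ ^ k))
    (trans (cong ((q - 1ℚ) *_) (fromℕ-2^ k)) (*-identityʳ (q - 1ℚ)))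
    where
    lem : ∀ n a x → n * (a * x) ≡ a * (n * x)
    lem = solve-∀ ℚ-ring

  -- m/(1+im) - m′/(1+im′) = (m-m′)/((1+im)(1+im′))
  term-diff : ∀ k q r i → node k q i ≢ 0ℚ → node k r i ≢ 0ℚ →
    mesh k q * inv (node k q i) - mesh k r * inv (node k r i) ≡
    (q - r) * ½ ^ k * (inv (node k q i) * inv (node k r i))
  term-diff k q r i u≢0 v≢0 = begin
    m * inv u - m′ * inv v
      ≡⟨ cong₂ (λ y z → m * inv u * y - m′ * inv v * z) (inv-inverse v≢0) (inv-inverse u≢0) ⟨∙⟩ lem₁ (m * inv u) (m′ * inv v) ⟩
    m * inv u * (v * inv v) - m′ * inv v * (u * inv u)
      ≡⟨ lem₂ (fromℕ i) q r (½ ^ k) (inv u) (inv v) ⟩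
    (q - r) * ½ ^ k * (inv u * inv v) ∎
    where
    open ≡-Reasoning
    m m′ u v : ℚ
    m = mesh k q
    m′ = mesh k r
    u = node k q i
    v = node k r i
    _⟨∙⟩_ : ∀ {a b c : ℚ} → a ≡ b → c ≡ b → c ≡ a
    p ⟨∙⟩ q = trans q (sym p)
    lem₁ : ∀ a b → a - b ≡ a * 1ℚ - b * 1ℚ
    lem₁ = solve-∀ ℚ-ring
    lem₂ : ∀ i q r x p s →
      (q - 1ℚ) * x * p * ((1ℚ + i * ((r - 1ℚ) * x)) * s) - (r - 1ℚ) * x * s * ((1ℚ + i * ((q - 1ℚ) * x)) * p)
      ≡ (q - r) * x * (p * s)
    lem₂ = solve-∀ ℚ-ring

  module _ (δ A : ℚ) (0<δ : 0ℚ < δ) (δ≤1 : δ ≤ 1ℚ) where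

    private
      Near : ℚ → Set
      Near q = δ ≤ q × ∣ q - 1ℚ ∣ ≤ A

      D : ℚ
      D = inv δ

      0≤D : 0ℚ ≤ D
      0≤D = <⇒≤ (inv-pos 0<δ)

      0≤DD : 0ℚ ≤ D * D
      0≤DD = 0≤* {D} {D} 0≤D 0≤D

      node≢0 : ∀ k q i → δ ≤ q → i ℕ.≤ 2 ℕ.^ k → node k q i ≢ 0ℚ
      node≢0 k q i δ≤q i≤ = pos⇒≢0 (<-≤-trans 0<δ (node-lower k q i δ δ≤1 δ≤q i≤))

      ∣inv-node∣≤ : ∀ k q i → δ ≤ q → i ℕ.≤ 2 ℕ.^ k → ∣ inv (node k q i) ∣ ≤ D
      ∣inv-node∣≤ k q i δ≤q i≤ = ∣∣-nonNeg
        (<⇒≤ (inv-pos (<-≤-trans 0<δ (node-lower k q i δ δ≤1 δ≤q i≤))))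
        (inv-antimono 0<δ (node-lower k q i δ δ≤1 δ≤q i≤))

    lnₛ-lipschitz : ∀ k q r → Near q → Near r → ∣ lnₛ k q - lnₛ k r ∣ ≤ (D * D) * ∣ q - r ∣
    lnₛ-lipschitz k q r (hq , _) (hr , _) = begin
      ∣ lnₛ k q - lnₛ k r ∣                   ≤⟨ ∑-diff N (∣ q - r ∣ * ½ ^ k * (D * D)) term ⟩
      fromℕ N * (∣ q - r ∣ * ½ ^ k * (D * D)) ≡⟨ lem (fromℕ N) ∣ q - r ∣ (½ ^ k) (D * D) ⟩
      D * D * ∣ q - r ∣ * (fromℕ N * ½ ^ k)   ≡⟨ cong (D * D * ∣ q - r ∣ *_) (fromℕ-2^ k) ⟩
      D * D * ∣ q - r ∣ * 1ℚ                  ≡⟨ *-identityʳ (D * D * ∣ q - r ∣) ⟩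
      D * D * ∣ q - r ∣                       ∎
      where
      open ≤-Reasoning
      N : ℕ
      N = 2 ℕ.^ k
      lem : ∀ n a x d → n * (a * x * d) ≡ d * a * (n * x)
      lem = solve-∀ ℚ-ring
      term : ∀ i → i ℕ.< N → ∣ mesh k q * inv (node k q i) - mesh k r * inv (node k r i) ∣ ≤ ∣ q - r ∣ * ½ ^ k * (D * D)
      term i i<N = ≤-trans
        (≤-reflexive (cong ∣_∣ (term-diff k q r i (node≢0 k q i hq (ℕ.<⇒≤ i<N)) (node≢0 k r i hr (ℕ.<⇒≤ i<N)))))
        (∣∣-* ((q - r) * ½ ^ k) (inv (node k q i) * inv (node k r i))
          (∣∣-* (q - r) (½ ^ k) ≤-refl (∣∣-nonNeg (0≤½^ k) ≤-refl))
          (∣∣-* (inv (node k q i)) (inv (node k r i))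
            (∣inv-node∣≤ k q i hq (ℕ.<⇒≤ i<N)) (∣inv-node∣≤ k r i hr (ℕ.<⇒≤ i<N))))

    lnₛ-step : ∀ k q → Near q → ∣ lnₛ (suc k) q - lnₛ k q ∣ ≤ (A * A * (½ * ½) * (D * D)) * ½ ^ k
    lnₛ-step k q (hq , hA) = begin
      ∣ lnₛ (suc k) q - lnₛ k q ∣
        ≡⟨ cong (λ z → ∣ z - lnₛ k q ∣) (∑-double N (λ i → mesh (suc k) q * inv (node (suc k) q i))) ⟩
      ∣ ∑ N (λ i → m * inv (node (suc k) q (2 ℕ.* i)) + m * inv (node (suc k) q (suc (2 ℕ.* i)))) - lnₛ k q ∣
        ≤⟨ ∑-diff N ((A * e) * ((A * e) * (D * D))) term ⟩
      fromℕ N * ((A * e) * ((A * e) * (D * D)))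
        ≡⟨ lem (fromℕ N) A (½ ^ k) (D * D) ⟩
      (A * A * (½ * ½) * (D * D)) * ½ ^ k * (fromℕ N * ½ ^ k)
        ≡⟨ cong ((A * A * (½ * ½) * (D * D)) * ½ ^ k *_) (fromℕ-2^ k) ⟩
      (A * A * (½ * ½) * (D * D)) * ½ ^ k * 1ℚ
        ≡⟨ *-identityʳ ((A * A * (½ * ½) * (D * D)) * ½ ^ k) ⟩
      (A * A * (½ * ½) * (D * D)) * ½ ^ k ∎
      where
      open ≤-Reasoning
      N : ℕ
      N = 2 ℕ.^ k
      e m : ℚ
      e = ½ * ½ ^ k
      m = mesh (suc k) q
      lem : ∀ n A x d → n * ((A * (½ * x)) * ((A * (½ * x)) * d)) ≡ (A * A * (½ * ½) * d) * x * (n * x)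
      lem = solve-∀ ℚ-ring
      ∣m∣≤ : ∣ m ∣ ≤ A * e
      ∣m∣≤ = ∣∣-* (q - 1ℚ) e hA (∣∣-nonNeg (0≤½^ (suc k)) ≤-refl)
      term : ∀ i → i ℕ.< N →
        ∣ (m * inv (node (suc k) q (2 ℕ.* i)) + m * inv (node (suc k) q (suc (2 ℕ.* i)))) - mesh k q * inv (node k q i) ∣
        ≤ (A * e) * ((A * e) * (D * D))
      term i i<N = ≤-trans
        (≤-reflexive (cong ∣_∣ eq))
        (∣∣-* m (- m * (inv v * inv u)) ∣m∣≤
          (∣∣-* (- m) (inv v * inv u) (≤-trans (≤-reflexive (∣-p∣≡∣p∣ m)) ∣m∣≤)
            (∣∣-* (inv v) (inv u)
              (∣inv-node∣≤ (suc k) q (suc (2 ℕ.* i)) hq odd≤) (∣inv-node∣≤ (suc k) q (2 ℕ.* i) hq even≤))))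
        where
        u v : ℚ
        u = node (suc k) q (2 ℕ.* i)
        v = node (suc k) q (suc (2 ℕ.* i))
        even≤ : 2 ℕ.* i ℕ.≤ 2 ℕ.^ suc k
        even≤ = ℕ.*-monoʳ-≤ 2 (ℕ.<⇒≤ i<N)
        odd≤ : suc (2 ℕ.* i) ℕ.≤ 2 ℕ.^ suc k
        odd≤ = ℕ.≤-trans (ℕ.n≤1+n (suc (2 ℕ.* i)))
          (ℕ.≤-trans (ℕ.≤-reflexive (sym (ℕ.*-suc 2 i))) (ℕ.*-monoʳ-≤ 2 i<N))
        node-even : node k q i ≡ u
        node-even = trans (lem₁ (fromℕ i) (q - 1ℚ) (½ ^ k))
          (cong (λ z → 1ℚ + z * m) (sym (fromℕ-2* i)))
          where
          lem₁ : ∀ i a x → 1ℚ + i * (a * x) ≡ 1ℚ + (i + i) * (a * (½ * x))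
          lem₁ = solve-∀ ℚ-ring
        u-v : u - v ≡ - m
        u-v = trans (cong (λ z → u - (1ℚ + z * m)) (fromℕ-suc (2 ℕ.* i))) (lem₂ (fromℕ (2 ℕ.* i)) m)
          where
          lem₂ : ∀ i m → 1ℚ + i * m - (1ℚ + (i + 1ℚ) * m) ≡ - m
          lem₂ = solve-∀ ℚ-ring
        eq : (m * inv u + m * inv v) - mesh k q * inv (node k q i) ≡ m * (- m * (inv v * inv u))
        eq = trans (cong (λ z → (m * inv u + m * inv v) - mesh k q * inv z) node-even)
          (trans (lem₃ (q - 1ℚ) (½ ^ k) (inv u) (inv v))
          (cong (m *_) (trans
            (inv-diff (node≢0 (suc k) q (suc (2 ℕ.* i)) hq odd≤) (node≢0 (suc k) q (2 ℕ.* i) hq even≤))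
            (cong (_* (inv v * inv u)) u-v))))
          where
          lem₃ : ∀ a x p r → (a * (½ * x)) * p + (a * (½ * x)) * r - a * x * p ≡ (a * (½ * x)) * (r - p)
          lem₃ = solve-∀ ℚ-ring

    lnₛ-cauchy : 0ℚ ≤ A → ∀ x → IsCauchy x → Eventually (λ n → Near (x n)) → IsCauchy λ k → lnₛ k (x k)
    lnₛ-cauchy 0≤A = diagonal-cauchy lnₛ Near (A * A * (½ * ½) * (D * D)) (D * D)
      (0≤* {A * A * (½ * ½)} {D * D} (0≤* {A * A} {½ * ½} (0≤* {A} {A} 0≤A 0≤A) (0≤* {½} {½} 0≤½ 0≤½)) 0≤DD)
      0≤DD lnₛ-step lnₛ-lipschitz

  0<⊓1 : ∀ q → 0ℚ < q → 0ℚ < q ⊓ 1ℚ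
  0<⊓1 q 0<q with ⊓-sel q 1ℚ
  ... | inj₁ e = subst (0ℚ <_) (sym e) 0<q
  ... | inj₂ e = subst (0ℚ <_) (sym e) 0<1

  ln-cauchy : ∀ x → 0ℝ <ℝ x → IsCauchy λ k → lnₛ k (seq x k)
  ln-cauchy x (η , 0<η , h) =
    let c , 0≤c , hc = boundedℚ (seq x) (cauchy x)
    in lnₛ-cauchy (η ⊓ 1ℚ) (c + 1ℚ) (0<⊓1 η 0<η) (p⊓q≤q η 1ℚ) (0≤+ {c} {1ℚ} 0≤c 0≤1) (seq x) (cauchy x)
      (eventually-map (λ n p → ≤-trans (p⊓q≤p η 1ℚ) (subst (_≤ seq x n) (+-identityˡ η) (proj₁ p)) ,
          ∣∣-via (seq x n) (- 1ℚ) refl (proj₂ p) ≤-refl)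
        (h and hc))

ln : (x : ℝ) → 0ℝ <ℝ x → ℝ
ln x 0<x = mkℝ (λ k → lnₛ k (seq x k)) (ln-cauchy x 0<x)

abstract

  lnₛ-upper : ∀ k q → 0ℚ < q → lnₛ k q ≤ q - 1ℚ
  lnₛ-upper k q 0<q = ≤-trans (∑-mono N term)
    (≤-reflexive (trans (∑-const N (mesh k q)) (2^k*mesh k q)))
    where
    N : ℕ
    N = 2 ℕ.^ k
    0<q⊓1 : 0ℚ < q ⊓ 1ℚ
    0<q⊓1 = 0<⊓1 q 0<q
    term : ∀ i → i ℕ.< N → mesh k q * inv (node k q i) ≤ mesh k q
    term i i<N = ≤-by (fromℕ i * (m * m) * inv u)
      (0≤* {fromℕ i * (m * m)} {inv u} (0≤* {fromℕ i} {m * m} (0≤fromℕ i) (0≤x² m)) (<⇒≤ (inv-pos 0<u)))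
      (trans (cong (_- m * inv u) (trans (sym (*-identityʳ m)) (cong (m *_) (sym (inv-inverse (pos⇒≢0 0<u))))))
        (lem (fromℕ i) m (inv u)))
      where
      m u : ℚ
      m = mesh k q
      u = node k q i
      0<u : 0ℚ < u
      0<u = <-≤-trans 0<q⊓1 (node-lower k q i (q ⊓ 1ℚ) (p⊓q≤q q 1ℚ) (p⊓q≤p q 1ℚ) (ℕ.<⇒≤ i<N))
      lem : ∀ i m p → m * ((1ℚ + i * m) * p) - m * p ≡ i * (m * m) * p
      lem = solve-∀ ℚ-ring

  lnₛ-lower : ∀ k q c → 1ℚ ≤ q → q ≤ c → (q - 1ℚ) * inv c ≤ lnₛ k q
  lnₛ-lower k q c 1≤q q≤c = ≤-trans
    (≤-reflexive (sym (trans (∑-const N (mesh k q * inv c))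
      (trans (sym (*-assoc (fromℕ N) (mesh k q) (inv c))) (cong (_* inv c) (2^k*mesh k q))))))
    (∑-mono N λ i i<N → *-monoˡ (mesh k q) (0≤* {q - 1ℚ} {½ ^ k} (0≤- 1≤q) (0≤½^ k))
      (inv-antimono (<-≤-trans 0<1 (node-lower k q i 1ℚ ≤-refl 1≤q (ℕ.<⇒≤ i<N)))
        (node-upper k q i c (≤-trans 1≤q q≤c) q≤c (ℕ.<⇒≤ i<N))))
    where
    N : ℕ
    N = 2 ℕ.^ k

  lnₛ-nonNeg : ∀ k q → 1ℚ ≤ q → 0ℚ ≤ lnₛ k q
  lnₛ-nonNeg k q 1≤q = ≤-trans
    (0≤* {q - 1ℚ} {inv q} (0≤- 1≤q) (inv-nonNeg (≤-trans 0≤1 1≤q)))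
    (lnₛ-lower k q q 1≤q ≤-refl)

  lnₛ-gap : ∀ k q r → 1ℚ ≤ r → r ≤ q → (q - r) * (inv q * inv q) ≤ lnₛ k q - lnₛ k r
  lnₛ-gap k q r 1≤r r≤q = subst (_≤ lnₛ k q - lnₛ k r) total (∑-gap N term)
    where
    N : ℕ
    N = 2 ℕ.^ k
    g : ℚ
    g = (q - r) * ½ ^ k * (inv q * inv q)
    1≤q : 1ℚ ≤ q
    1≤q = ≤-trans 1≤r r≤q
    total : fromℕ N * g ≡ (q - r) * (inv q * inv q)
    total = trans (lem (fromℕ N) (q - r) (½ ^ k) (inv q * inv q))
      (trans (cong ((q - r) * (inv q * inv q) *_) (fromℕ-2^ k)) (*-identityʳ ((q - r) * (inv q * inv q))))
      where
      lem : ∀ n a x d → n * (a * x * d) ≡ a * d * (n * x)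
      lem = solve-∀ ℚ-ring
    node≥1 : ∀ s i → 1ℚ ≤ s → i ℕ.< N → 1ℚ ≤ node k s i
    node≥1 s i 1≤s i<N = node-lower k s i 1ℚ ≤-refl 1≤s (ℕ.<⇒≤ i<N)
    inv≥ : ∀ s i → 1ℚ ≤ s → s ≤ q → i ℕ.< N → inv q ≤ inv (node k s i)
    inv≥ s i 1≤s s≤q i<N = inv-antimono (<-≤-trans 0<1 (node≥1 s i 1≤s i<N))
      (node-upper k s i q 1≤q s≤q (ℕ.<⇒≤ i<N))
    node≢0 : ∀ s i → 1ℚ ≤ s → i ℕ.< N → node k s i ≢ 0ℚ
    node≢0 s i 1≤s i<N = pos⇒≢0 (<-≤-trans 0<1 (node≥1 s i 1≤s i<N))
    term : ∀ i → i ℕ.< N → g ≤ mesh k q * inv (node k q i) - mesh k r * inv (node k r i)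
    term i i<N = ≤-trans
      (*-monoˡ ((q - r) * ½ ^ k) (0≤* {q - r} {½ ^ k} (0≤- r≤q) (0≤½^ k))
        (*-mono (inv-nonNeg (≤-trans 0≤1 1≤q))
          (≤-trans (inv-nonNeg (≤-trans 0≤1 1≤q)) (inv≥ r i 1≤r r≤q i<N))
          (inv≥ q i 1≤q ≤-refl i<N) (inv≥ r i 1≤r r≤q i<N)))
      (≤-reflexive (sym (term-diff k q r i (node≢0 q i 1≤q i<N) (node≢0 r i 1≤r i<N))))

  ln-#0 : ∀ b (0<b : 0ℝ <ℝ b) → b # 1ℝ → ln b 0<b # 0ℝ
  ln-#0 b (η , 0<η , pos-b) (inj₁ (ε , 0<ε , h)) = inj₁ (ε , 0<ε , eventually-map
    (λ k p → ≤-trans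
      (+-monoˡ-≤ ε (lnₛ-upper k (seq b k) (<-≤-trans 0<η (subst (_≤ seq b k) (+-identityˡ η) (proj₁ p)))))
      (≤-by (1ℚ - (seq b k + ε)) (0≤- (proj₂ p)) (lem (seq b k) ε)))
    (pos-b and h))
    where
    lem : ∀ b ε → 0ℚ - (b - 1ℚ + ε) ≡ 1ℚ - (b + ε)
    lem = solve-∀ ℚ-ring
  ln-#0 b 0<b (inj₂ (ε , 0<ε , h)) =
    let c , 0≤c , hc = boundedℚ (seq b) (cauchy b)
        0<inv = inv-pos (0<+ {c} {1ℚ} 0≤c 0<1)
    in inj₂ (ε * inv (c + 1ℚ) , 0<* {ε} {inv (c + 1ℚ)} 0<ε 0<inv , eventually-map
      (λ k p → ≤-trans (≤-reflexive (+-identityˡ (ε * inv (c + 1ℚ))))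
        (≤-trans (*-monoʳ {ε} {seq b k - 1ℚ} (inv (c + 1ℚ)) (<⇒≤ 0<inv) (≤-by (seq b k - (1ℚ + ε)) (0≤- (proj₁ p)) (lem (seq b k) ε)))
          (lnₛ-lower k (seq b k) (c + 1ℚ)
            (≤-trans (≤-by ε (<⇒≤ 0<ε) (lem₂ ε)) (proj₁ p))
            (≤-trans (p≤∣p∣ (seq b k)) (≤-trans (proj₂ p) (≤-by 1ℚ 0≤1 (lem₃ c)))))))
      (h and hc))
    where
    lem : ∀ b ε → b - 1ℚ - ε ≡ b - (1ℚ + ε)
    lem = solve-∀ ℚ-ring
    lem₂ : ∀ ε → 1ℚ + ε - 1ℚ ≡ ε
    lem₂ = solve-∀ ℚ-ring
    lem₃ : ∀ c → c + 1ℚ - c ≡ 1ℚ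
    lem₃ = solve-∀ ℚ-ring

  exp≤1 : ∀ y → (∀ k → seq y k ≤ 0ℚ) →
    Eventually λ k → 0ℚ ≤ seq (exp y) k × seq (exp y) k ≤ 1ℚ
  exp≤1 y y≤0 =
    let c , 0≤c , hc = boundedℚ (seq y) (cauchy y)
    in eventually-map (λ k p → bounds c k (proj₁ p) (proj₂ p)) (hc and ½^-small c 0<1)
    where
    bounds : ∀ c k → ∣ seq y k ∣ ≤ c → c * ½ ^ k ≤ 1ℚ → 0ℚ ≤ expₛ k (seq y k) × expₛ k (seq y k) ≤ 1ℚ
    bounds c k hc small = ^-nonNeg base≥0 (2 ℕ.^ k) , ^≤1 base≥0 base≤1 (2 ℕ.^ k)
      where
      z : ℚ
      z = seq y k
      base≥0 : 0ℚ ≤ 1ℚ + z * ½ ^ k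
      base≥0 = ≤-trans (0≤- (≤-trans (*-monoʳ (½ ^ k) (0≤½^ k) (≤-trans (-p≤∣p∣ z) hc)) small))
        (≤-reflexive (lem z (½ ^ k)))
        where
        lem : ∀ z x → 1ℚ - - z * x ≡ 1ℚ + z * x
        lem = solve-∀ ℚ-ring
      base≤1 : 1ℚ + z * ½ ^ k ≤ 1ℚ
      base≤1 = ≤-by (- z * ½ ^ k) (0≤* { - z} {½ ^ k} (neg-antimono-≤ (y≤0 k)) (0≤½^ k)) (lem z (½ ^ k))
        where
        lem : ∀ z x → 1ℚ - (1ℚ + z * x) ≡ - z * x
        lem = solve-∀ ℚ-ring

------------------------------------------------------------------------
-- Real powers and logarithms to a real base

infix 8 _^ℝ_∵_

_^ℝ_∵_ : (x y : ℝ) → 0ℝ <ℝ x → ℝ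
x ^ℝ y ∵ 0<x = exp (y *ℝ ln x 0<x)

log : (b x : ℝ) → 0ℝ <ℝ b → b # 1ℝ → 0ℝ <ℝ x → ℝ
log b x 0<b b#1 0<x = ln x 0<x ÷ℝ ln b 0<b ∵ ln-#0 b 0<b b#1

abstract

  fromℚ-pos : ∀ q → 0ℚ < q → 0ℝ <ℝ fromℚ q
  fromℚ-pos q 0<q = q , 0<q , 0 , λ _ _ → ≤-reflexive (+-identityˡ q)

  fromℚ-#1 : ∀ q → 1ℚ < q → fromℚ q # 1ℝ
  fromℚ-#1 q 1<q = inj₂ (q - 1ℚ , subst (_< q - 1ℚ) (+-inverseʳ 1ℚ) (+-monoˡ-< (- 1ℚ) 1<q) ,
    0 , λ _ _ → ≤-reflexive (lem q))
    where
    lem : ∀ q → 1ℚ + (q - 1ℚ) ≡ q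
    lem = solve-∀ ℚ-ring

  1<fromℕ : ∀ n → 1 ℕ.< n → 1ℚ < fromℕ n
  1<fromℕ n 1<n = <-≤-trans 1<2 (fromℕ-mono 1<n)
    where
    1<2 : 1ℚ < fromℕ 2
    1<2 = toWitness {a? = 1ℚ <? fromℕ 2} _

  0<fromℕ : ∀ n → 1 ℕ.< n → 0ℚ < fromℕ n
  0<fromℕ n 1<n = <-trans 0<1 (1<fromℕ n 1<n)

  1≤½n : ∀ n → 1 ℕ.< n → 1ℚ ≤ fromℕ n * ½
  1≤½n n 1<n = *-monoʳ ½ 0≤½ (fromℕ-mono 1<n)

  -- α e ≤ 1 - g/n whenever α = a/l with 0 ≤ a ≤ l - g and l ≤ n, and 0 ≤ e ≤ 1.
  quotient-gap : ∀ a l g n e → 0ℚ ≤ a → 0ℚ < g → g ≤ l - a → l ≤ n → 0ℚ ≤ e → e ≤ 1ℚ →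
    a * inv l * e - 1ℚ + g * inv n ≤ 0ℚ
  quotient-gap a l g n e 0≤a 0<g g≤ l≤n 0≤e e≤1 = ≤-by
    (a * inv l * (1ℚ - e) + ((l - a - g) * inv l + g * (inv l - inv n)))
    (0≤+ {a * inv l * (1ℚ - e)} {(l - a - g) * inv l + g * (inv l - inv n)}
      (0≤* {a * inv l} {1ℚ - e} (0≤* {a} {inv l} 0≤a 0≤il) (0≤- e≤1))
      (0≤+ {(l - a - g) * inv l} {g * (inv l - inv n)}
        (0≤* {l - a - g} {inv l} (0≤- g≤) 0≤il)
        (0≤* {g} {inv l - inv n} (<⇒≤ 0<g) (0≤- (inv-antimono 0<l l≤n)))))
    (trans (cong (λ o → 0ℚ - (a * inv l * e - o + g * inv n)) (sym (inv-inverse (pos⇒≢0 0<l))))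
      (lem a l g e (inv l) (inv n)))
    where
    0<l : 0ℚ < l
    0<l = subst (0ℚ <_) (cancel a l) (0<+ {a} {l - a} 0≤a (<-≤-trans 0<g g≤))
      where
      cancel : ∀ a l → a + (l - a) ≡ l
      cancel = solve-∀ ℚ-ring
    0≤il : 0ℚ ≤ inv l
    0≤il = <⇒≤ (inv-pos 0<l)
    lem : ∀ a l g e p r → 0ℚ - (a * p * e - l * p + g * r) ≡ a * p * (1ℚ - e) + ((l - a - g) * p + g * (p - r))
    lem = solve-∀ ℚ-ring

------------------------------------------------------------------------
-- The logarithms to base 2 and n occurring in the bound, for n > 1

module Logarithms (n : ℕ) (1<n : 1 ℕ.< n) where

  log₂ logₙ : (x : ℝ) → 0ℝ <ℝ x → ℝ
  log₂ x = log (fromℚ (fromℕ 2)) x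
    (fromℚ-pos (fromℕ 2) (0<fromℕ 2 ℕ.≤-refl)) (fromℚ-#1 (fromℕ 2) (1<fromℕ 2 ℕ.≤-refl))
  logₙ x = log (fromℚ (fromℕ n)) x
    (fromℚ-pos (fromℕ n) (0<fromℕ n 1<n)) (fromℚ-#1 (fromℕ n) (1<fromℕ n 1<n))

  log₂[n] logₙ[n/2] logₙ[1/2] : ℝ
  log₂[n]   = log₂ (fromℚ (fromℕ n)) (fromℚ-pos (fromℕ n) (0<fromℕ n 1<n))
  logₙ[n/2] = logₙ (fromℚ (fromℕ n * ½)) (fromℚ-pos (fromℕ n * ½) (<-≤-trans 0<1 (1≤½n n 1<n)))
  logₙ[1/2] = logₙ (fromℚ ½) (fromℚ-pos ½ 0<½)

  abstract

    0≤log₂[n] : ∀ k → 0ℚ ≤ seq log₂[n] k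
    0≤log₂[n] k = 0≤* {lnₛ k (fromℕ n)} {inv (lnₛ k (fromℕ 2))}
      (lnₛ-nonNeg k (fromℕ n) (<⇒≤ (1<fromℕ n 1<n)))
      (inv-nonNeg (lnₛ-nonNeg k (fromℕ 2) (<⇒≤ (1<fromℕ 2 ℕ.≤-refl))))

    0<1+log₂[n] : 0ℝ <ℝ 1ℝ +ℝ log₂[n]
    0<1+log₂[n] = 1ℚ , 0<1 , 0 , λ k _ → ≤-by (seq log₂[n] k) (0≤log₂[n] k) (lem (seq log₂[n] k))
      where
      lem : ∀ x → 1ℚ + x - (0ℚ + 1ℚ) ≡ x
      lem = solve-∀ ℚ-ring

    exponent≤0 : ∀ k → seq (logₙ[1/2] *ℝ ln (1ℝ +ℝ log₂[n]) 0<1+log₂[n]) k ≤ 0ℚ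
    exponent≤0 k = ≤-by
      (- a * i * l)
      (0≤* { - a * i} {l} (0≤* { - a} {i} (neg-antimono-≤ a≤0) 0≤i) 0≤l) (lem a i l)
      where
      a i l : ℚ
      a = lnₛ k ½
      i = inv (lnₛ k (fromℕ n))
      l = lnₛ k (1ℚ + seq log₂[n] k)
      a≤0 : a ≤ 0ℚ
      a≤0 = ≤-trans (lnₛ-upper k ½ 0<½) (≤-by ½ 0≤½ refl)
      0≤i : 0ℚ ≤ i
      0≤i = inv-nonNeg (lnₛ-nonNeg k (fromℕ n) (<⇒≤ (1<fromℕ n 1<n)))
      0≤l : 0ℚ ≤ l
      0≤l = lnₛ-nonNeg k (1ℚ + seq log₂[n] k) (≤-by (seq log₂[n] k) (0≤log₂[n] k) (lem′ (seq log₂[n] k)))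
        where
        lem′ : ∀ x → 1ℚ + x - 1ℚ ≡ x
        lem′ = solve-∀ ℚ-ring
      lem : ∀ a i l → 0ℚ - a * i * l ≡ - a * i * l
      lem = solve-∀ ℚ-ring

    denominator#0 :
      logₙ[n/2] *ℝ ((1ℝ +ℝ log₂[n]) ^ℝ logₙ[1/2] ∵ 0<1+log₂[n]) -ℝ 1ℝ # 0ℝ
    denominator#0 = inj₁ (g * inv N , 0<* {g} {inv N} 0<g (inv-pos 0<N) , eventually-map
      (λ k p → quotient-gap (lnₛ k (N * ½)) (lnₛ k N) g N _
        (lnₛ-nonNeg k (N * ½) (1≤½n n 1<n)) 0<g
        (lnₛ-gap k N (N * ½) (1≤½n n 1<n) ½N≤N)
        (≤-trans (lnₛ-upper k N 0<N) (≤-by 1ℚ 0≤1 (lem N)))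
        (proj₁ p) (proj₂ p))
      (exp≤1 (logₙ[1/2] *ℝ ln (1ℝ +ℝ log₂[n]) 0<1+log₂[n]) exponent≤0))
      where
      N g : ℚ
      N = fromℕ n
      g = (N - N * ½) * (inv N * inv N)
      0<N : 0ℚ < N
      0<N = 0<fromℕ n 1<n
      half : ∀ N → N - N * ½ ≡ N * ½
      half = solve-∀ ℚ-ring
      ½N≤N : N * ½ ≤ N
      ½N≤N = ≤-by (N * ½) (<⇒≤ (0<* {N} {½} 0<N 0<½)) (half N)
      0<g : 0ℚ < g
      0<g = 0<* {N - N * ½} {inv N * inv N} (subst (0ℚ <_) (sym (half N)) (0<* {N} {½} 0<N 0<½))
        (0<* {inv N} {inv N} (inv-pos 0<N) (inv-pos 0<N))
      lem : ∀ N → N - (N - 1ℚ) ≡ 1ℚ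
      lem = solve-∀ ℚ-ring

module Submission where

-- Let q range over the r distinct prime factors of n. Since n is Carmichael,
-- the integers below n divisible by no q are not witnesses, and there are
-- n ∏ (1 - 1/q) of them. The q are distinct and at least p₁, so the product is
-- at least ∏_{i<r} (p₁+i-1)/(p₁+i) = (p₁-1)/(p₁+r-1), which is ≥ 1/2 as soon as
-- r < p₁.
--
-- If r ≥ p₁ then n ≥ p₁^p₁, and the hypothesis fails. Put L = log₂ n,
-- x = 1 + L, α = log_n (n/2) = 1 - 1/L and y = x^(-1/L). As x^α = x y, the
-- hypothesis says y (p₁ + 1 - (p₁-1)/L) ≤ p₁ - 1. With y ≥ 1 - (ln x)/L it gives
-- 2 L ≤ (p₁-1) + (p₁+1) ln x, which is contradicted by
-- ln x ≤ ln (2p₁) + x/(2p₁) - 1, ln n ≥ p₁ ln p₁, ln 2 ≤ 71/100 and ln p₁ ≥ 1.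
--
-- All this is carried out on the k-th approximations, where the functional
-- equations of ln and exp hold up to multiples of 2^(-k).

open import Defs

-- The left side of the hypothesis is one Newton step, started at x = 1 + log₂ n, for the equation
-- t^α = t - 1. That equation says (1 - 1/t)^(log_t n) = 1/2, which is the borderline case when n
-- has at most log_t n prime factors, all at least t.
--
-- The obstacle is that ln and exp are bare limits of `lnₛ k` and `expₛ k`, without functional
-- equations. One notion replaces these, `ExpBound`: certificates q ≤ (1 + z/m)^m multiply by AM-GM,
-- and q ≥ 1 forces z ≥ 0. Left and right Riemann sums of dt/t both yield such certificates, so an
-- inequality between logarithms is proved by multiplying certificates until the product is at least
-- 1.
--
-- The room is smallest at p₁ = 3, the least possible value because n is odd. There n = p₁^p₁ gives
-- x = 1 + 3 log₂ 3, about 5.75, which is why the tangent is taken at 2p₁ = 6. With ln p₁ replaced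
-- by 1 the final inequality then tolerates values of ln 2 up to about 0.72.

module Sieve where

  open import Data.Nat
  open import Data.Nat.Properties
  open import Data.Nat.Divisibility
  open import Data.Nat.GCD using (gcd; gcd[m,n]∣m; gcd[m,n]∣n)
  open import Data.Nat.Primality
  open import Data.Nat.Primality.Factorisation
  open import Data.Nat.Tactic.RingSolver using (solve-∀)
  open import Data.List using (List; []; _∷_; _∷ʳ_; length; filter; map; _++_; applyUpTo; downFrom)
  open import Data.Nat.ListAction using (product)
  open import Data.List.Properties using (applyUpTo-∷ʳ; filter-++; length-++)
  open import Data.List.Membership.Propositional using (_∈_)
  open import Data.List.Membership.Propositional.Properties using (∈-filter⁺; ∈-downFrom⁺)
  open import Data.List.Relation.Unary.All as All using (All; []; _∷_; all?)
  open import Data.List.Relation.Unary.All.Properties using (all-filter)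
  open import Data.List.Relation.Unary.AllPairs using (AllPairs; []; _∷_)
  import Data.List.Relation.Unary.AllPairs.Properties as AllPairs
  open import Data.Product using (_×_; _,_; proj₁; proj₂; ∃-syntax)
  open import Data.Sum using (inj₁; inj₂; [_,_]′)
  open import Function using (id)
  open import Relation.Nullary using (¬_; Dec; yes; no; ¬?; contradiction; _×-dec_)
  open import Relation.Unary using (Decidable)
  open import Relation.Binary.PropositionalEquality

  -- Counting in an initial segment of the integers

  indicator : {A : Set} → Dec A → ℕ
  indicator (yes _) = 1
  indicator (no  _) = 0

  indicator-cong : {A B : Set} → (A → B) → (B → A) → (a? : Dec A) (b? : Dec B) → indicator a? ≡ indicator b?
  indicator-cong f g (yes a) (yes b) = refl
  indicator-cong f g (yes a) (no ¬b) = contradiction (f a) ¬b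
  indicator-cong f g (no ¬a) (yes b) = contradiction (g b) ¬a
  indicator-cong f g (no ¬a) (no ¬b) = refl

  indicator-no : {A : Set} → ¬ A → (a? : Dec A) → indicator a? ≡ 0
  indicator-no ¬a (yes a) = contradiction a ¬a
  indicator-no ¬a (no _)  = refl

  count : {P : ℕ → Set} → Decidable P → ℕ → ℕ
  count P? zero    = 0
  count P? (suc m) = count P? m + indicator (P? m)

  length-filter-singleton : {P : ℕ → Set} (P? : Decidable P) → ∀ x → length (filter P? (x ∷ [])) ≡ indicator (P? x)
  length-filter-singleton P? x with P? x
  ... | yes _ = refl
  ... | no  _ = refl

  length-filter-snoc : {P : ℕ → Set} (P? : Decidable P) → ∀ m →
    length (filter P? (applyUpTo suc (suc m))) ≡ length (filter P? (applyUpTo suc m)) + indicator (P? (suc m))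
  length-filter-snoc P? m = begin
    length (filter P? (applyUpTo suc (suc m)))
      ≡⟨ cong (λ xs → length (filter P? xs)) (applyUpTo-∷ʳ suc m) ⟨
    length (filter P? (applyUpTo suc m ∷ʳ suc m))
      ≡⟨ cong length (filter-++ P? (applyUpTo suc m) (suc m ∷ [])) ⟩
    length (filter P? (applyUpTo suc m) ++ filter P? (suc m ∷ []))
      ≡⟨ length-++ (filter P? (applyUpTo suc m)) ⟩
    length (filter P? (applyUpTo suc m)) + length (filter P? (suc m ∷ []))
      ≡⟨ cong (length (filter P? (applyUpTo suc m)) +_) (length-filter-singleton P? (suc m)) ⟩
    length (filter P? (applyUpTo suc m)) + indicator (P? (suc m)) ∎
    where open ≡-Reasoning

  -- The filtered list runs over 1, ..., m but `count` runs over 0, ..., m; that 0 fails `Q`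
  -- reconciles the two ranges.
  filter+count≤ : {P Q : ℕ → Set} (P? : Decidable P) (Q? : Decidable Q) → ¬ Q 0 →
    (∀ a → 0 < a → Q a → ¬ P a) → ∀ m → length (filter P? (applyUpTo suc m)) + count Q? (suc m) ≤ m
  filter+count≤ P? Q? ¬Q0 disjoint zero    = ≤-reflexive (indicator-no ¬Q0 (Q? 0))
  filter+count≤ P? Q? ¬Q0 disjoint (suc m) = begin
    length (filter P? (applyUpTo suc (suc m))) + (count Q? (suc m) + indicator (Q? (suc m)))
      ≡⟨ cong (_+ (count Q? (suc m) + indicator (Q? (suc m)))) (length-filter-snoc P? m) ⟩
    w + indicator (P? (suc m)) + (count Q? (suc m) + indicator (Q? (suc m)))
      ≡⟨ lem w (indicator (P? (suc m))) (count Q? (suc m)) (indicator (Q? (suc m))) ⟩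
    w + count Q? (suc m) + (indicator (P? (suc m)) + indicator (Q? (suc m)))
      ≤⟨ +-mono-≤ (filter+count≤ P? Q? ¬Q0 disjoint m) (one (P? (suc m)) (Q? (suc m))) ⟩
    m + 1
      ≡⟨ +-comm m 1 ⟩
    suc m ∎
    where
    open ≤-Reasoning
    w : ℕ
    w = length (filter P? (applyUpTo suc m))
    lem : ∀ w p c q → w + p + (c + q) ≡ w + c + (p + q)
    lem = solve-∀
    one : (p? : Dec _) (q? : Dec _) → indicator p? + indicator q? ≤ 1
    one (yes p) (yes q) = contradiction p (disjoint (suc m) (s≤s z≤n) q)
    one (yes p) (no _)  = ≤-refl
    one (no _)  (yes q) = ≤-refl
    one (no _)  (no _)  = z≤n

  -- Sieving by distinct primes

  Unsieved : List ℕ → ℕ → Set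
  Unsieved qs a = All (λ q → ¬ q ∣ a) qs

  unsieved? : ∀ qs → Decidable (Unsieved qs)
  unsieved? qs a = all? (λ q → ¬? (q ∣? a)) qs

  prime-∣-prime : ∀ {p q} → Prime p → Prime q → p ∣ q → p ≡ q
  prime-∣-prime p-prime q-prime p∣q with prime⇒irreducible q-prime p∣q
  ... | inj₁ refl = contradiction p-prime ¬prime[1]
  ... | inj₂ p≡q  = p≡q

  unsieved-* : ∀ {q qs a} → Prime q → All Prime qs → All (q >_) qs → Unsieved qs a → Unsieved qs (q * a)
  unsieved-* q-prime [] [] [] = []
  unsieved-* {q} {q′ ∷ qs} {a} q-prime (q′-prime ∷ ps) (q>q′ ∷ gs) (q′∤a ∷ us) =
    (λ q′∣qa → [ (λ q′∣q → <⇒≢ q>q′ (prime-∣-prime q′-prime q-prime q′∣q)) , q′∤a ]′ (euclidsLemma q a q′-prime q′∣qa))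
    ∷ unsieved-* q-prime ps gs us

  unsieved-*⁻ : ∀ {q qs a} → Unsieved qs (q * a) → Unsieved qs a
  unsieved-*⁻ {q} = All.map (λ ∤qa ∣a → ∤qa (∣n⇒∣m*n q ∣a))

  -- The multiples q a below q m are unsieved by `qs` exactly when a is, since q differs from every
  -- prime in `qs`. Raising m by one adds a block of q integers, of which only the first is a
  -- multiple of q.
  count-sieve : ∀ q qs → Prime q → All Prime qs → All (q >_) qs → ∀ m →
    count (unsieved? (q ∷ qs)) (q * m) + count (unsieved? qs) m ≡ count (unsieved? qs) (q * m)
  count-sieve q qs q-prime ps gs zero rewrite *-zeroʳ q = refl
  count-sieve q@(suc q′) qs q-prime ps gs (suc m) =
    subst (λ t → F t + count (unsieved? qs) (suc m) ≡ H t) (trans (+-comm (q * m) q) (sym (*-suc q m))) (block q′ ≤-refl)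
    where
    open ≡-Reasoning
    F H : ℕ → ℕ
    F = count (unsieved? (q ∷ qs))
    H = count (unsieved? qs)
    block : ∀ i → i < q → F (q * m + suc i) + H (suc m) ≡ H (q * m + suc i)
    block zero i<q = begin
      F (q * m + 1) + (H m + indicator (unsieved? qs m))
        ≡⟨ cong (λ t → F t + (H m + indicator (unsieved? qs m))) (+-comm (q * m) 1) ⟩
      F (q * m) + indicator (unsieved? (q ∷ qs) (q * m)) + (H m + indicator (unsieved? qs m))
        ≡⟨ cong₂ (λ s t → F (q * m) + s + (H m + t))
          (indicator-no (λ { (q∤ ∷ _) → q∤ (m∣m*n m) }) (unsieved? (q ∷ qs) (q * m)))
          (indicator-cong (unsieved-* q-prime ps gs) (unsieved-*⁻ {q}) (unsieved? qs m) (unsieved? qs (q * m))) ⟩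
      F (q * m) + 0 + (H m + indicator (unsieved? qs (q * m)))
        ≡⟨ lem (F (q * m)) (H m) (indicator (unsieved? qs (q * m))) ⟩
      F (q * m) + H m + indicator (unsieved? qs (q * m))
        ≡⟨ cong (_+ indicator (unsieved? qs (q * m))) (count-sieve q qs q-prime ps gs m) ⟩
      H (suc (q * m))
        ≡⟨ cong H (+-comm (q * m) 1) ⟨
      H (q * m + 1) ∎
      where
      lem : ∀ f h i → f + 0 + (h + i) ≡ f + h + i
      lem = solve-∀
    block (suc i) 1+i<q = begin
      F (q * m + suc (suc i)) + H (suc m)
        ≡⟨ cong (λ t → F t + H (suc m)) (+-suc (q * m) (suc i)) ⟩
      F a + indicator (unsieved? (q ∷ qs) a) + H (suc m)
        ≡⟨ cong (λ t → F a + t + H (suc m)) (indicator-cong (λ { (_ ∷ us) → us }) (q∤a ∷_) (unsieved? (q ∷ qs) a) (unsieved? qs a)) ⟩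
      F a + indicator (unsieved? qs a) + H (suc m)
        ≡⟨ lem (F a) (indicator (unsieved? qs a)) (H (suc m)) ⟩
      F a + H (suc m) + indicator (unsieved? qs a)
        ≡⟨ cong (_+ indicator (unsieved? qs a)) (block i (<-trans (n<1+n i) 1+i<q)) ⟩
      H (suc a)
        ≡⟨ cong H (+-suc (q * m) (suc i)) ⟨
      H (q * m + suc (suc i)) ∎
      where
      a : ℕ
      a = q * m + suc i
      q∤a : ¬ q ∣ a
      q∤a q∣a = >⇒∤ 1+i<q (∣m+n∣m⇒∣n q∣a (m∣m*n m))
      lem : ∀ f i h → f + i + h ≡ f + h + i
      lem = solve-∀

  totients : List ℕ → ℕ
  totients qs = product (map pred qs)

  -- The number t of periods has to vary: the sieve identity for the head q calls the induction
  -- hypothesis at both t and q t.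
  count-unsieved : ∀ qs → All Prime qs → AllPairs _>_ qs → ∀ t →
    count (unsieved? qs) (t * product qs) ≡ t * totients qs
  count-unsieved [] [] [] t = trans (cong (count (unsieved? [])) (*-identityʳ t)) (trans (all t) (sym (*-identityʳ t)))
    where
    all : ∀ m → count (unsieved? []) m ≡ m
    all zero    = refl
    all (suc m) = trans (cong (_+ 1) (all m)) (+-comm m 1)
  count-unsieved (zero ∷ qs) (0-prime ∷ _) _ t = contradiction 0-prime ¬prime[0]
  count-unsieved (q@(suc q′) ∷ qs) (q-prime ∷ ps) (gs ∷ desc) t = +-cancelʳ-≡ (t * φ) _ _ (begin
    count (unsieved? (q ∷ qs)) (t * (q * Q)) + t * φ
      ≡⟨ cong₂ (λ s r → count (unsieved? (q ∷ qs)) s + r) (lem t q Q) (sym (count-unsieved qs ps desc t)) ⟩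
    count (unsieved? (q ∷ qs)) (q * (t * Q)) + count (unsieved? qs) (t * Q)
      ≡⟨ count-sieve q qs q-prime ps gs (t * Q) ⟩
    count (unsieved? qs) (q * (t * Q))
      ≡⟨ cong (count (unsieved? qs)) (*-assoc q t Q) ⟨
    count (unsieved? qs) (q * t * Q)
      ≡⟨ count-unsieved qs ps desc (q * t) ⟩
    q * t * φ
      ≡⟨ lem′ q′ t φ ⟩
    t * (q′ * φ) + t * φ ∎)
    where
    open ≡-Reasoning
    Q φ : ℕ
    Q = product qs
    φ = totients qs
    lem : ∀ t q Q → t * (q * Q) ≡ q * (t * Q)
    lem = solve-∀
    lem′ : ∀ q t φ → suc q * t * φ ≡ t * (q * φ) + t * φ
    lem′ = solve-∀

  product-∣ : ∀ {n} qs → All Prime qs → AllPairs _>_ qs → All (_∣ n) qs → product qs ∣ n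
  product-∣ [] [] [] [] = 1∣ _
  product-∣ {n} (q ∷ qs) (q-prime ∷ ps) (gs ∷ desc) (q∣n ∷ ds) with product-∣ qs ps desc ds
  ... | divides k refl with euclidsLemma k (product qs) q-prime q∣n
  ...   | inj₁ (divides l refl) = divides l (*-assoc l q (product qs))
  ...   | inj₂ q∣Q = contradiction refl (<⇒≢ (All.lookup gs (factorisationHasAllPrimeFactors q-prime q∣Q ps)))

  -- Each strict descent along the list costs at least 1, and the last entry is still at least p.
  head-large : ∀ {p q qs} → All (p ≤_) (q ∷ qs) → AllPairs _>_ (q ∷ qs) → p + length qs ≤ q
  head-large {p} {q} {[]} (p≤q ∷ []) _ = ≤-trans (≤-reflexive (+-identityʳ p)) p≤q
  head-large {p} {q} {q′ ∷ qs} (_ ∷ ls) ((q>q′ ∷ _) ∷ desc) =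
    ≤-trans (≤-reflexive (+-suc p (length qs))) (<-≤-trans (s≤s (head-large ls desc)) q>q′)

  -- ∏ (q-1)/q over r distinct q ≥ p is at least the telescoping product
  -- ∏ (p+i-1)/(p+i) = (p-1)/(p+r-1), here with p = p′ + 1.
  totients-large : ∀ p′ qs → All (suc p′ ≤_) qs → AllPairs _>_ qs →
    p′ * product qs ≤ totients qs * (p′ + length qs)
  totients-large p′ [] _ _ = ≤-reflexive (lem p′)
    where
    lem : ∀ p → p * 1 ≡ 1 * (p + 0)
    lem = solve-∀
  totients-large p′ (suc q′ ∷ qs) ls@(_ ∷ ls′) desc@(_ ∷ desc′) = begin
    p′ * (suc q′ * Q)            ≡⟨ lem₁ p′ q′ Q ⟩
    suc q′ * (p′ * Q)            ≤⟨ *-monoʳ-≤ (suc q′) (totients-large p′ qs ls′ desc′) ⟩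
    suc q′ * (φ * (p′ + r))      ≡⟨ lem₂ q′ φ (p′ + r) ⟩
    φ * (q′ * (p′ + r) + (p′ + r)) ≤⟨ *-monoʳ-≤ φ (+-monoʳ-≤ (q′ * (p′ + r)) (s≤s⁻¹ (head-large ls desc))) ⟩
    φ * (q′ * (p′ + r) + q′)     ≡⟨ lem₃ q′ φ p′ r ⟩
    q′ * φ * (p′ + suc r)        ∎
    where
    open ≤-Reasoning
    Q φ r : ℕ
    Q = product qs
    φ = totients qs
    r = length qs
    lem₁ : ∀ p q Q → p * (suc q * Q) ≡ suc q * (p * Q)
    lem₁ = solve-∀
    lem₂ : ∀ q φ s → suc q * (φ * s) ≡ φ * (q * s + s)
    lem₂ = solve-∀
    lem₃ : ∀ q φ p r → φ * (q * (p + r) + q) ≡ q * φ * (p + suc r)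
    lem₃ = solve-∀

  ^-≤-product : ∀ p qs → All (p ≤_) qs → p ^ length qs ≤ product qs
  ^-≤-product p [] [] = ≤-refl
  ^-≤-product p (q ∷ qs) (p≤q ∷ ls) = *-mono-≤ p≤q (^-≤-product p qs ls)

  -- Prime divisors of a Carmichael number and the count of witnesses

  primeDivisor? : ∀ n → Decidable (λ q → Prime q × q ∣ n)
  primeDivisor? n q = prime? q ×-dec (q ∣? n)

  primeDivisors : ℕ → List ℕ
  primeDivisors n = filter (primeDivisor? n) (downFrom (suc n))

  primeDivisors-desc : ∀ n → AllPairs _>_ (primeDivisors n)
  primeDivisors-desc n = AllPairs.filter⁺ (primeDivisor? n) (AllPairs.applyDownFrom⁺₁ id (suc n) (λ j<i _ → j<i))

  ∈-primeDivisors : ∀ {n q} → 0 < n → Prime q → q ∣ n → q ∈ primeDivisors n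
  ∈-primeDivisors {n@(suc _)} 0<n q-prime q∣n =
    ∈-filter⁺ (primeDivisor? n) (∈-downFrom⁺ (s≤s (∣⇒≤ q∣n))) (q-prime , q∣n)

  primeDivisor-exists : ∀ m → 0 < m → m ≢ 1 → ∃[ q ] Prime q × q ∣ m
  primeDivisor-exists m@(suc _) _ m≢1 with factorise m
  ... | record { factors = []    ; isFactorisation = m≡1 } = contradiction m≡1 m≢1
  ... | record { factors = q ∷ qs ; isFactorisation = eq ; factorsPrime = q-prime ∷ _ } =
    q , q-prime , subst (q ∣_) (sym eq) (m∣m*n (product qs))

  unsieved⇒coprime : ∀ {n a} → 0 < n → 0 < a → Unsieved (primeDivisors n) a → gcd a n ≡ 1
  unsieved⇒coprime {n} {a} 0<n 0<a us with gcd a n ≟ 1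
  ... | yes eq = eq
  ... | no g≢1 with primeDivisor-exists (gcd a n) 0<g g≢1
    where
    0<g : 0 < gcd a n
    0<g = n≢0⇒n>0 λ g≡0 → <⇒≢ 0<a (sym (0∣⇒≡0 (subst (_∣ a) g≡0 (gcd[m,n]∣m a n))))
  ...   | q , q-prime , q∣g = contradiction (∣-trans q∣g (gcd[m,n]∣m a n))
    (All.lookup us (∈-primeDivisors 0<n q-prime (∣-trans q∣g (gcd[m,n]∣n a n))))

  module _ {n p} (carmichael : Carmichael n) (smallest : IsSmallestPrimeFactor p n) where

    open IsSmallestPrimeFactor smallest renaming (isPrime to p-prime; divides to p∣n; smallest to p-smallest)

    private
      qs : List ℕ
      qs = primeDivisors n
      primes×divisors : All (λ q → Prime q × q ∣ n) qs
      primes×divisors = all-filter (primeDivisor? n) (downFrom (suc n))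
      primes : All Prime qs
      primes = All.map proj₁ primes×divisors
      large : All (p ≤_) qs
      large = All.map (λ { (q-prime , q∣n) → p-smallest _ q-prime q∣n }) primes×divisors
      0<n : 0 < n
      0<n = <-trans (s≤s z≤n) (carmichael⇒1<n carmichael)
      Q∣n : product qs ∣ n
      Q∣n = product-∣ qs primes (primeDivisors-desc n) (All.map proj₂ primes×divisors)

    fermatWitnesses+unsieved≤ : length (fermatWitnesses n) + count (unsieved? qs) n ≤ n ∸ 1
    fermatWitnesses+unsieved≤ = subst (λ t → length (fermatWitnesses n) + count (unsieved? qs) t ≤ n ∸ 1) (m+[n∸m]≡n 0<n)
      (filter+count≤ (λ a → ¬? (a ^ (n ∸ 1) ≡? 1 [mod n ])) (unsieved? qs)
        (λ us → All.lookup us (∈-primeDivisors 0<n p-prime p∣n) (p ∣0))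
        (λ a 0<a us witness → witness (Carmichael.fermat carmichael a 0<a (unsieved⇒coprime 0<n 0<a us)))
        (n ∸ 1))

    fewWitnesses : n < p ^ p → 2 * length (fermatWitnesses n) < n ∸ 1
    fewWitnesses n<p^p = bound p refl Q∣n
      where
      open ≤-Reasoning
      W r : ℕ
      W = length (fermatWitnesses n)
      r = length qs
      r<p : r < p
      r<p = ≰⇒> λ p≤r → <⇒≱ n<p^p (≤-trans (^-monoʳ-≤ p {{prime⇒nonZero p-prime}} p≤r)
        (≤-trans (^-≤-product p qs large) (∣⇒≤ {{>-nonZero 0<n}} Q∣n)))
      -- Splitting the copy s of p exhibits p - 1 as a successor, which the cancellation in `Q≤2φ`
      -- requires.
      bound : ∀ s → p ≡ s → product qs ∣ n → 2 * W < n ∸ 1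
      bound zero    refl _ = contradiction p-prime ¬prime[0]
      bound (suc zero) refl _ = contradiction p-prime ¬prime[1]
      bound (suc p′@(suc _)) refl (divides t n≡tQ) = s≤s⁻¹ (subst (suc (suc (2 * W)) ≤_) (sym (m+[n∸m]≡n 0<n)) goal)
        where
        φ : ℕ
        φ = totients qs
        count≡ : count (unsieved? qs) n ≡ t * φ
        count≡ = trans (cong (count (unsieved? qs)) n≡tQ) (count-unsieved qs primes (primeDivisors-desc n) t)
        Q≤2φ : product qs ≤ 2 * φ
        Q≤2φ = *-cancelˡ-≤ p′ (begin
          p′ * product qs   ≤⟨ totients-large p′ qs large (primeDivisors-desc n) ⟩
          φ * (p′ + r)      ≤⟨ *-monoʳ-≤ φ (+-monoʳ-≤ p′ (s≤s⁻¹ r<p)) ⟩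
          φ * (p′ + p′)     ≡⟨ lem p′ φ ⟩
          p′ * (2 * φ)      ∎)
          where
          lem : ∀ p φ → φ * (p + p) ≡ p * (2 * φ)
          lem = solve-∀
        n≤ : n ≤ 2 * (t * φ)
        n≤ = begin
          n              ≡⟨ n≡tQ ⟩
          t * product qs ≤⟨ *-monoʳ-≤ t Q≤2φ ⟩
          t * (2 * φ)    ≡⟨ lem t φ ⟩
          2 * (t * φ)    ∎
          where
          lem : ∀ t φ → t * (2 * φ) ≡ 2 * (t * φ)
          lem = solve-∀
        W+≤ : suc (W + t * φ) ≤ n
        W+≤ = ≤-trans (s≤s (subst (λ s → W + s ≤ n ∸ 1) count≡ fermatWitnesses+unsieved≤)) (≤-reflexive (m+[n∸m]≡n 0<n))
        goal : suc (suc (2 * W)) ≤ n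
        goal = +-cancelʳ-≤ n (suc (suc (2 * W))) n (begin
          suc (suc (2 * W)) + n               ≤⟨ +-monoʳ-≤ (suc (suc (2 * W))) n≤ ⟩
          suc (suc (2 * W)) + 2 * (t * φ)     ≡⟨ lem W (t * φ) ⟩
          suc (W + t * φ) + suc (W + t * φ)   ≤⟨ +-mono-≤ W+≤ W+≤ ⟩
          n + n                               ∎)
          where
          lem : ∀ w s → suc (suc (2 * w)) + 2 * s ≡ suc (w + s) + suc (w + s)
          lem = solve-∀

  -- Carmichael numbers are odd

  -- m ≡ -1 mod m+1
  odd-power : ∀ l j → suc (suc l) ∣ suc l ^ suc (j * 2) + 1
  odd-power l zero    = ∣-reflexive (lem l)
    where
    lem : ∀ l → suc (suc l) ≡ suc l * 1 + 1
    lem = solve-∀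
  odd-power l (suc j) = ∣m+n∣m⇒∣n
    (subst (suc (suc l) ∣_) (sym (lem l (suc l ^ suc (j * 2)))) (∣n⇒∣m*n (suc l * suc l) (odd-power l j)))
    (∣n⇒∣m*n l ∣-refl)
    where
    lem : ∀ l x → l * suc (suc l) + (suc l * (suc l * x) + 1) ≡ suc l * suc l * (x + 1)
    lem = solve-∀

  consecutive-coprime : ∀ m → gcd m (suc m) ≡ 1
  consecutive-coprime m = ∣1⇒≡1 (∣m+n∣m⇒∣n
    (subst (gcd m (suc m) ∣_) (+-comm 1 m) (gcd[m,n]∣n m (suc m))) (gcd[m,n]∣m m (suc m)))

  -- For even n > 2 the exponent n - 1 is odd, so (n - 1)^(n - 1) is -1 mod n. As n - 1 is coprime
  -- to n, the power is also 1 mod n, and n would divide 2.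
  carmichael⇒odd : ∀ {n} → Carmichael n → ¬ 2 ∣ n
  carmichael⇒odd {n} c (divides zero refl) = ¬composite[0] (Carmichael.isComposite c)
  carmichael⇒odd {n} c (divides (suc zero) refl) = composite⇒¬prime (Carmichael.isComposite c) prime[2]
  carmichael⇒odd {n} c (divides (suc (suc j)) refl) = contradiction (∣⇒≤ n∣2) (<⇒≱ (s≤s (s≤s (s≤s z≤n))))
    where
    x : ℕ
    x = (n ∸ 1) ^ (n ∸ 1)
    1≤x : 1 ≤ x
    1≤x = m^n>0 (n ∸ 1) (n ∸ 1)
    n∣x-1 : n ∣ x ∸ 1
    n∣x-1 = subst (n ∣_) (trans (∣-∣-comm x 1) (m≤n⇒∣m-n∣≡n∸m 1≤x))
      (Carmichael.fermat c (n ∸ 1) (s≤s z≤n) (consecutive-coprime (n ∸ 1)))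
    n∣2 : n ∣ 2
    n∣2 = ∣m+n∣m⇒∣n (subst (n ∣_) eq (odd-power (suc (suc (j * 2))) (suc j))) n∣x-1
      where
      eq : x + 1 ≡ (x ∸ 1) + 2
      eq = trans (cong (_+ 1) (sym (m∸n+n≡m 1≤x))) (+-assoc (x ∸ 1) 1 1)

  -- The value 3 matters because it exceeds e: the analytic part relies on ln p ≥ 1.
  smallest-≥3 : ∀ {n p} → Carmichael n → IsSmallestPrimeFactor p n → 3 ≤ p
  smallest-≥3 {p = 0} c s = contradiction (IsSmallestPrimeFactor.isPrime s) ¬prime[0]
  smallest-≥3 {p = 1} c s = contradiction (IsSmallestPrimeFactor.isPrime s) ¬prime[1]
  smallest-≥3 {p = 2} c s = contradiction (IsSmallestPrimeFactor.divides s) (carmichael⇒odd c)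
  smallest-≥3 {p = suc (suc (suc _))} c s = s≤s (s≤s (s≤s z≤n))

open import Data.Nat as ℕ using (ℕ; zero; suc; z≤n; s≤s; _∸_)
import Data.Nat.Properties as ℕ
open import Data.Integer as ℤ using () renaming (+_ to int)
import Data.Integer.Properties as ℤ
open import Data.Rational
open import Data.Rational.Properties
import Data.Rational.Unnormalised as ℚᵘ
import Data.Rational.Unnormalised.Properties as ℚᵘ
open import Data.List using (length)
open import Data.Product using (∃-syntax; _×_; _,_)
open import Data.Sum using ([_,_]′)
open import Relation.Nullary using (¬_; contradiction)
open import Relation.Nullary.Decidable using (True; toWitness)
open import Relation.Binary.PropositionalEquality
open import Algebra.Definitions.RawSemiring +-*-rawSemiring using (_^_)
import Algebra.Bundles as Bundles
import Algebra.Properties.CommutativeSemiring.Exp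
  (Bundles.CommutativeRing.commutativeSemiring +-*-commutativeRing) as Exp
open import Tactic.RingSolver using (solve-∀)

-- Certificates for lower bounds of the exponential

-- Convexity: the graph of t^(m+1) lies above its tangent at x. Each induction step loses only a
-- multiple of the square of y - x.
^-tangent : ∀ {x y} → 0ℚ ≤ x → 0ℚ ≤ y → ∀ m →
  x ^ m * (x + fromℕ (suc m) * (y - x)) ≤ y ^ suc m
^-tangent {x} {y} 0≤x 0≤y zero = ≤-reflexive (lem x y)
  where
  lem : ∀ x y → 1ℚ * (x + 1ℚ * (y - x)) ≡ y * 1ℚ
  lem = solve-∀ ℚ-ring
^-tangent {x} {y} 0≤x 0≤y (suc m) = ≤-trans
  (≤-by (x ^ m * (fromℕ (suc m) * ((y - x) * (y - x))))
    (0≤* {x ^ m} (^-nonNeg 0≤x m) (0≤* {fromℕ (suc m)} (0≤fromℕ (suc m)) (0≤x² (y - x))))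
    (trans (cong (λ z → y * (x ^ m * (x + fromℕ (suc m) * (y - x))) - x * x ^ m * (x + z * (y - x))) (fromℕ-suc (suc m)))
      (lem x y (x ^ m) (fromℕ (suc m)))))
  (*-monoˡ y 0≤y (^-tangent 0≤x 0≤y m))
  where
  lem : ∀ x y t m → y * (t * (x + m * (y - x))) - x * t * (x + (m + 1ℚ) * (y - x))
                  ≡ t * (m * ((y - x) * (y - x)))
  lem = solve-∀ ℚ-ring

-- A certificate for q ≤ e^z, namely q ≤ (1 + z/m)^m with mean = 1 + z/m ≥ 0.
record ExpBound (m : ℕ) (z q : ℚ) : Set where
  constructor expBound
  field
    mean      : ℚ
    mean≥0    : 0ℚ ≤ mean
    mean-sum  : fromℕ m * (mean - 1ℚ) ≡ z
    mean-prod : q ≤ mean ^ m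

open ExpBound

0<fromℕ-suc : ∀ m → 0ℚ < fromℕ (suc m)
0<fromℕ-suc m = <-≤-trans 0<1 (fromℕ-mono {1} {suc m} (s≤s z≤n))

one : ExpBound 0 0ℚ 1ℚ
one = expBound 1ℚ 0≤1 refl ≤-refl

-- c^m d ≤ c′^(m+1) for c′ = (m c + d)/(m+1): one step of the AM-GM inequality.
step : ∀ {m z q w} → 0ℚ ≤ 1ℚ + w → ExpBound m z q → ExpBound (suc m) (z + w) (q * (1ℚ + w))
step {m} {z} {q} {w} 0≤1+w E = expBound c′ 0≤c′ sum′ prod′
  where
  c M i c′ : ℚ
  c = mean E
  M = fromℕ m
  i = inv (fromℕ (suc m))
  c′ = (M * c + (1ℚ + w)) * i
  0≤c′ : 0ℚ ≤ c′
  0≤c′ = 0≤* {M * c + (1ℚ + w)} (0≤+ {M * c} (0≤* {M} (0≤fromℕ m) (mean≥0 E)) 0≤1+w)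
    (<⇒≤ (inv-pos (0<fromℕ-suc m)))
  Mi : fromℕ (suc m) * i ≡ 1ℚ
  Mi = inv-inverse (pos⇒≢0 (0<fromℕ-suc m))
  Mc′ : fromℕ (suc m) * c′ ≡ M * c + (1ℚ + w)
  Mc′ = trans (lem (fromℕ (suc m)) (M * c + (1ℚ + w)) i)
    (trans (cong ((M * c + (1ℚ + w)) *_) Mi) (*-identityʳ (M * c + (1ℚ + w))))
    where
    lem : ∀ s t i → s * (t * i) ≡ t * (s * i)
    lem = solve-∀ ℚ-ring
  sum′ : fromℕ (suc m) * (c′ - 1ℚ) ≡ z + w
  sum′ = trans (lem (fromℕ (suc m)) c′) (trans (cong₂ _-_ Mc′ (fromℕ-suc m))
    (trans (lem′ M c w) (cong (_+ w) (mean-sum E))))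
    where
    lem : ∀ s c → s * (c - 1ℚ) ≡ s * c - s
    lem = solve-∀ ℚ-ring
    lem′ : ∀ M c w → M * c + (1ℚ + w) - (M + 1ℚ) ≡ M * (c - 1ℚ) + w
    lem′ = solve-∀ ℚ-ring
  prod′ : q * (1ℚ + w) ≤ c′ ^ suc m
  prod′ = ≤-trans (*-monoʳ (1ℚ + w) 0≤1+w (mean-prod E))
    (≤-trans (≤-reflexive (cong (c ^ m *_) (sym eq))) (^-tangent (mean≥0 E) 0≤c′ m))
    where
    lem : ∀ s c c′ → c + s * (c′ - c) ≡ c + (s * c′ - s * c)
    lem = solve-∀ ℚ-ring
    lem′ : ∀ M c w → c + (M * c + (1ℚ + w) - (M + 1ℚ) * c) ≡ 1ℚ + w
    lem′ = solve-∀ ℚ-ring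
    eq : c + fromℕ (suc m) * (c′ - c) ≡ 1ℚ + w
    eq = trans (lem (fromℕ (suc m)) c c′)
      (trans (cong₂ (λ s t → c + (s - t * c)) Mc′ (fromℕ-suc m)) (lem′ M c w))

steps : ∀ {m z q w} → 0ℚ ≤ 1ℚ + w → ExpBound m z q → ∀ j →
  ExpBound (j ℕ.+ m) (z + fromℕ j * w) (q * (1ℚ + w) ^ j)
steps {m} {z} {q} {w} h E zero = subst₂ (ExpBound m)
  (sym (trans (cong (z +_) (*-zeroˡ w)) (+-identityʳ z))) (sym (*-identityʳ q)) E
steps {m} {z} {q} {w} h E (suc j) = subst₂ (ExpBound (suc (j ℕ.+ m)))
  (trans (lem z w (fromℕ j)) (cong (λ t → z + t * w) (sym (fromℕ-suc j))))
  (lem′ q (1ℚ + w) ((1ℚ + w) ^ j))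
  (step h (steps h E j))
  where
  lem : ∀ z w j → z + j * w + w ≡ z + (j + 1ℚ) * w
  lem = solve-∀ ℚ-ring
  lem′ : ∀ q w t → q * t * w ≡ q * (w * t)
  lem′ = solve-∀ ℚ-ring

weaken : ∀ {m z q r} → r ≤ q → ExpBound m z q → ExpBound m z r
weaken r≤q (expBound c h s p) = expBound c h s (≤-trans r≤q p)

-- The second certificate is absorbed as m′ equal steps with w = `mean F` - 1.
_⊕_ : ∀ {m m′ z z′ q q′} → ExpBound m z q → ExpBound m′ z′ q′ → 0ℚ ≤ q →
  ExpBound (m′ ℕ.+ m) (z + z′) (q * q′)
_⊕_ {m} {m′} {z} {z′} {q} {q′} E F 0≤q =
  weaken (≤-trans (*-monoˡ q 0≤q (mean-prod F)) (≤-reflexive (cong (λ t → q * t ^ m′) (sym (lem (mean F))))))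
    (subst (λ t → ExpBound (m′ ℕ.+ m) (z + t) (q * (1ℚ + (mean F - 1ℚ)) ^ m′)) (mean-sum F)
      (steps (subst (0ℚ ≤_) (sym (lem (mean F))) (mean≥0 F)) E m′))
  where
  lem : ∀ c → 1ℚ + (c - 1ℚ) ≡ c
  lem = solve-∀ ℚ-ring

-- A mean below 1 would have powers below 1. This is how a product of certificates becomes an
-- inequality between exponents.
exponent-nonNeg : ∀ {m z q} → 1ℚ ≤ q → ExpBound m z q → 0ℚ ≤ z
exponent-nonNeg {zero}  {z} 1≤q E = ≤-reflexive (trans (sym (*-zeroˡ (mean E - 1ℚ))) (mean-sum E))
exponent-nonNeg {suc m} {z} 1≤q E = subst (0ℚ ≤_) (mean-sum E)
  (0≤* {fromℕ (suc m)} (0≤fromℕ (suc m)) (0≤- (≮⇒≥ mean≮1)))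
  where
  mean≮1 : ¬ (mean E < 1ℚ)
  mean≮1 c<1 = <-irrefl refl (≤-<-trans (≤-trans 1≤q (≤-trans (mean-prod E)
    (≤-trans (*-monoˡ (mean E) (mean≥0 E) (^≤1 (mean≥0 E) (<⇒≤ c<1) m)) (≤-reflexive (*-identityʳ (mean E)))))) c<1)

-- Riemann sums of the logarithm as certificates

node-zero : ∀ k q → node k q 0 ≡ 1ℚ
node-zero k q = trans (cong (1ℚ +_) (*-zeroˡ (mesh k q))) (+-identityʳ 1ℚ)

node-suc : ∀ k q i → node k q (suc i) ≡ node k q i + mesh k q
node-suc k q i = trans (cong (λ t → 1ℚ + t * mesh k q) (fromℕ-suc i)) (lem (fromℕ i) (mesh k q))
  where
  lem : ∀ i m → 1ℚ + (i + 1ℚ) * m ≡ 1ℚ + i * m + m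
  lem = solve-∀ ℚ-ring

node-last : ∀ k q → node k q (2 ℕ.^ k) ≡ q
node-last k q = trans (cong (1ℚ +_) (2^k*mesh k q)) (lem q)
  where
  lem : ∀ q → 1ℚ + (q - 1ℚ) ≡ q
  lem = solve-∀ ℚ-ring

node-pos : ∀ k q i → 0ℚ < q → i ℕ.≤ 2 ℕ.^ k → 0ℚ < node k q i
node-pos k q i 0<q i≤ = <-≤-trans (0<⊓1 q 0<q)
  (node-lower k q i (q ⊓ 1ℚ) (p⊓q≤q q 1ℚ) (p⊓q≤p q 1ℚ) i≤)

1+m/u : ∀ {u} m → u ≢ 0ℚ → 1ℚ + m * inv u ≡ (u + m) * inv u
1+m/u {u} m u≢0 = trans (cong (_+ m * inv u) (sym (inv-inverse u≢0))) (lem u m (inv u))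
  where
  lem : ∀ u m i → u * i + m * i ≡ (u + m) * i
  lem = solve-∀ ℚ-ring

-- The factor 1 + m/uᵢ equals uᵢ₊₁/uᵢ, so the product telescopes to q while the exponents add up to
-- the left Riemann sum.
lnₛ-expBound : ∀ k q → 0ℚ < q → ExpBound (2 ℕ.^ k) (lnₛ k q) q
lnₛ-expBound k q 0<q = subst (ExpBound (2 ℕ.^ k) (lnₛ k q)) (node-last k q) (go (2 ℕ.^ k) ℕ.≤-refl)
  where
  m : ℚ
  m = mesh k q
  u : ℕ → ℚ
  u = node k q
  go : ∀ j → j ℕ.≤ 2 ℕ.^ k → ExpBound j (∑ j λ i → m * inv (u i)) (u j)
  go zero    _ = subst (ExpBound 0 0ℚ) (sym (node-zero k q)) one
  go (suc j) h = subst (ExpBound (suc j) (∑ (suc j) λ i → m * inv (u i)))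
    (trans (cong (u j *_) eq) (trans (lem (u j) (u (suc j)) (inv (u j)))
      (trans (cong (u (suc j) *_) (inv-inverse (pos⇒≢0 0<u))) (*-identityʳ (u (suc j))))))
    (step (subst (0ℚ ≤_) (sym eq) (0≤* {u (suc j)} (<⇒≤ (node-pos k q (suc j) 0<q h)) (<⇒≤ (inv-pos 0<u))))
      (go j (ℕ.<⇒≤ h)))
    where
    0<u : 0ℚ < u j
    0<u = node-pos k q j 0<q (ℕ.<⇒≤ h)
    eq : 1ℚ + m * inv (u j) ≡ u (suc j) * inv (u j)
    eq = trans (1+m/u m (pos⇒≢0 0<u)) (cong (_* inv (u j)) (sym (node-suc k q j)))
    lem : ∀ u v i → u * (v * i) ≡ v * (u * i)
    lem = solve-∀ ℚ-ring

-- The negated right Riemann sum of ∫ dt/t bounds the reciprocal, and differs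
-- from the left one by the telescoping sum of mesh (1/uᵢ - 1/uᵢ₊₁).
lnₛ-reciprocal : ∀ k q → 0ℚ < q →
  ∃[ z ] ExpBound (2 ℕ.^ k) z (inv q) × lnₛ k q + z ≡ mesh k q * (1ℚ - inv q)
lnₛ-reciprocal k q 0<q = S (2 ℕ.^ k) ,
  subst (λ t → ExpBound (2 ℕ.^ k) (S (2 ℕ.^ k)) (inv t)) (node-last k q) (go (2 ℕ.^ k) ℕ.≤-refl) ,
  trans (diff (2 ℕ.^ k)) (cong₂ (λ s t → m * (inv s - inv t)) (node-zero k q) (node-last k q))
  where
  m : ℚ
  m = mesh k q
  u : ℕ → ℚ
  u = node k q
  S : ℕ → ℚ
  S j = ∑ j λ i → - m * inv (u (suc i))
  diff : ∀ j → ∑ j (λ i → m * inv (u i)) + S j ≡ m * (inv (u 0) - inv (u j))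
  diff zero    = lem m (inv (u 0))
    where
    lem : ∀ m i → 0ℚ + 0ℚ ≡ m * (i - i)
    lem = solve-∀ ℚ-ring
  diff (suc j) = trans (lem (∑ j λ i → m * inv (u i)) (S j) m (inv (u j)) (inv (u (suc j))))
    (trans (cong (_+ m * (inv (u j) - inv (u (suc j)))) (diff j))
      (lem′ m (inv (u 0)) (inv (u j)) (inv (u (suc j)))))
    where
    lem : ∀ s t m i i′ → s + m * i + (t + - m * i′) ≡ s + t + m * (i - i′)
    lem = solve-∀ ℚ-ring
    lem′ : ∀ m a b c → m * (a - b) + m * (b - c) ≡ m * (a - c)
    lem′ = solve-∀ ℚ-ring
  go : ∀ j → j ℕ.≤ 2 ℕ.^ k → ExpBound j (S j) (inv (u j))
  go zero    _ = subst (λ t → ExpBound 0 0ℚ (inv t)) (sym (node-zero k q)) one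
  go (suc j) h = subst (ExpBound (suc j) (S (suc j)))
    (trans (cong (inv (u j) *_) eq) (trans (lem (inv (u j)) (u j) (inv (u (suc j))))
      (trans (cong (_* inv (u (suc j))) (inv-inverse (pos⇒≢0 0<u))) (*-identityˡ (inv (u (suc j)))))))
    (step (subst (0ℚ ≤_) (sym eq) (0≤* {u j} (<⇒≤ 0<u) (<⇒≤ (inv-pos 0<u′)))) (go j (ℕ.<⇒≤ h)))
    where
    0<u : 0ℚ < u j
    0<u = node-pos k q j 0<q (ℕ.<⇒≤ h)
    0<u′ : 0ℚ < u (suc j)
    0<u′ = node-pos k q (suc j) 0<q h
    back : ∀ u m → u + m + - m ≡ u
    back = solve-∀ ℚ-ring
    eq : 1ℚ + - m * inv (u (suc j)) ≡ u j * inv (u (suc j))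
    eq = trans (1+m/u (- m) (pos⇒≢0 0<u′)) (cong (_* inv (u (suc j)))
      (trans (cong (_+ - m) (node-suc k q j)) (back (u j) m)))
    lem : ∀ i u v → i * (u * v) ≡ u * i * v
    lem = solve-∀ ℚ-ring

-- (q-1)(1-1/q) ≤ q for q ≥ 1
lnₛ-reciprocal-≤ : ∀ k q c → 1ℚ ≤ q → q ≤ c →
  ∃[ z ] ExpBound (2 ℕ.^ k) z (inv q) × lnₛ k q ≤ c * ½ ^ k - z
lnₛ-reciprocal-≤ k q c 1≤q q≤c =
  let z , E , eq = lnₛ-reciprocal k q (<-≤-trans 0<1 1≤q)
  in z , E , ≤-by
    ((1ℚ + (c - q)) * ½ ^ k + (q - 1ℚ) * ½ ^ k * inv q)
    (0≤+ {(1ℚ + (c - q)) * ½ ^ k} {(q - 1ℚ) * ½ ^ k * inv q}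
      (0≤* {1ℚ + (c - q)} {½ ^ k} (0≤+ {1ℚ} {c - q} 0≤1 (0≤- q≤c)) (0≤½^ k))
      (0≤* {(q - 1ℚ) * ½ ^ k} {inv q} (0≤* {q - 1ℚ} {½ ^ k} (0≤- 1≤q) (0≤½^ k)) (inv-nonNeg (≤-trans 0≤1 1≤q))))
    (trans (lem (lnₛ k q) z (c * ½ ^ k)) (trans (cong (λ t → c * ½ ^ k - t) eq) (lem′ c (½ ^ k) q (inv q))))
  where
  lem : ∀ l z e → e - z - l ≡ e - (l + z)
  lem = solve-∀ ℚ-ring
  lem′ : ∀ c x q i → c * x - (q - 1ℚ) * x * (1ℚ - i) ≡ (1ℚ + (c - q)) * x + (q - 1ℚ) * x * i
  lem′ = solve-∀ ℚ-ring

-- There are 2^k subintervals in `lnₛ k` and the power in `expₛ k` is also 2^k, so the mean of the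
-- certificate is exactly the base of `expₛ k`.
expₛ-lnₛ : ∀ k q → 0ℚ < q → q ≤ expₛ k (lnₛ k q)
expₛ-lnₛ k q 0<q = ≤-trans (mean-prod E) (≤-reflexive (cong (_^ (2 ℕ.^ k)) eq))
  where
  E : ExpBound (2 ℕ.^ k) (lnₛ k q) q
  E = lnₛ-expBound k q 0<q
  lem : ∀ N c x → 1ℚ + N * (c - 1ℚ) * x ≡ 1ℚ + N * x * (c - 1ℚ)
  lem = solve-∀ ℚ-ring
  lem′ : ∀ c → c ≡ 1ℚ + 1ℚ * (c - 1ℚ)
  lem′ = solve-∀ ℚ-ring
  eq : mean E ≡ 1ℚ + lnₛ k q * ½ ^ k
  eq = trans (lem′ (mean E)) (trans (cong (λ t → 1ℚ + t * (mean E - 1ℚ)) (sym (fromℕ-2^ k)))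
    (trans (sym (lem (fromℕ (2 ℕ.^ k)) (mean E) (½ ^ k)))
      (cong (λ t → 1ℚ + t * ½ ^ k) (mean-sum E))))

power : ∀ {m z q} → 0ℚ ≤ q → ExpBound m z q → ∀ j → ExpBound (j ℕ.* m) (fromℕ j * z) (q ^ j)
power {m} {z} {q} 0≤q E zero = subst (λ t → ExpBound 0 t 1ℚ) (sym (*-zeroˡ z)) one
power {m} {z} {q} 0≤q E (suc j) =
  subst₂ (λ l t → ExpBound l t (q * q ^ j)) (ℕ.+-comm (j ℕ.* m) m)
    (trans (lem z (fromℕ j)) (cong (_* z) (sym (fromℕ-suc j))))
    ((E ⊕ power 0≤q E j) 0≤q)
  where
  lem : ∀ z j → z + j * z ≡ (j + 1ℚ) * z
  lem = solve-∀ ℚ-ring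

-- The certificates for q and 1/q multiply to one for 1, so z + z′ ≥ 0. This converts any
-- certificate for q into an upper bound of the left sum; the parameter c lets several q share one
-- error term.
lnₛ-≤ : ∀ k q c {m z} → 1ℚ ≤ q → q ≤ c → ExpBound m z q → lnₛ k q ≤ c * ½ ^ k + z
lnₛ-≤ k q c {m} {z} 1≤q q≤c E =
  let z′ , E′ , h = lnₛ-reciprocal-≤ k q c 1≤q q≤c
  in ≤-trans h (≤-by (z + z′)
    (exponent-nonNeg {z = z + z′} {q * inv q} (≤-reflexive (sym (inv-inverse (pos⇒≢0 (<-≤-trans 0<1 1≤q)))))
      (_⊕_ {z = z} {z′} {q} {inv q} E E′ (≤-trans 0≤1 1≤q)))
    (lem (c * ½ ^ k) z z′))
  where
  lem : ∀ e z z′ → e + z - (e - z′) ≡ z + z′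
  lem = solve-∀ ℚ-ring

-- Numerical bounds for ln 2 and for ln q with q ≥ 3

2ℚ : ℚ
2ℚ = fromℕ 2

1≤2 : 1ℚ ≤ 2ℚ
1≤2 = toWitness {a? = 1ℚ ≤? 2ℚ} _

½≤ln2 : ∀ k → ½ ≤ lnₛ k 2ℚ
½≤ln2 k = lnₛ-lower k 2ℚ 2ℚ 1≤2 ≤-refl

combine : ∀ {m m′} z q z′ q′ z″ q″ → 0ℚ ≤ q → z + z′ ≡ z″ → q″ ≤ q * q′ →
  ExpBound m z q → ExpBound m′ z′ q′ → ExpBound (m′ ℕ.+ m) z″ q″
combine {m} {m′} z q z′ q′ z″ q″ 0≤q eq le E F = weaken {q = q * q′} {q″} le
  (subst (λ t → ExpBound (m′ ℕ.+ m) t (q * q′)) eq (_⊕_ {z = z} {z′} {q} {q′} E F 0≤q))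

single : ∀ w → 0ℚ ≤ 1ℚ + w → ExpBound 1 w (1ℚ + w)
single w h = subst₂ (ExpBound 1) (+-identityˡ w) (*-identityˡ (1ℚ + w)) (step {z = 0ℚ} {1ℚ} {w} h one)

-- (25/24)¹⁷ ≥ 2
17/24-expBound : ExpBound 17 (int 17 / 24) 2ℚ
17/24-expBound =
  combine (int 2 / 3) (int 19201 / 10000) (int 1 / 24) (int 25 / 24) (int 17 / 24) 2ℚ (ge (int 19201 / 10000)) refl
    (toWitness {a? = 2ℚ ≤? (int 19201 / 10000) * (int 25 / 24)} _) e₁₆ e₁
  where
  ge : ∀ q {t : True (0ℚ ≤? q)} → 0ℚ ≤ q
  ge q {t} = toWitness t
  -- Repeated squaring, with each value rounded down to keep the fractions short.
  double : ∀ {m} z q z′ q′ {t : True (0ℚ ≤? q)} {t′ : True (q′ ≤? q * q)} → z + z ≡ z′ →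
    ExpBound m z q → ExpBound (m ℕ.+ m) z′ q′
  double z q z′ q′ {t} {t′} eq E = combine z q z q z′ q′ (toWitness t) eq (toWitness t′) E E
  e₁ : ExpBound 1 (int 1 / 24) (int 25 / 24)
  e₁ = single (int 1 / 24) (ge (1ℚ + int 1 / 24))
  e₂ : ExpBound 2 (int 1 / 12) (int 217 / 200)
  e₂ = double (int 1 / 24) (int 25 / 24) (int 1 / 12) (int 217 / 200) refl e₁
  e₄ : ExpBound 4 (int 1 / 6) (int 2943 / 2500)
  e₄ = double (int 1 / 12) (int 217 / 200) (int 1 / 6) (int 2943 / 2500) refl e₂
  e₈ : ExpBound 8 (int 1 / 3) (int 13857 / 10000)
  e₈ = double (int 1 / 6) (int 2943 / 2500) (int 1 / 3) (int 13857 / 10000) refl e₄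
  e₁₆ : ExpBound 16 (int 2 / 3) (int 19201 / 10000)
  e₁₆ = double (int 1 / 3) (int 13857 / 10000) (int 2 / 3) (int 19201 / 10000) refl e₈

ln2≤ : ∀ k c → 2ℚ ≤ c → lnₛ k 2ℚ ≤ c * ½ ^ k + int 17 / 24
ln2≤ k c 2≤c = lnₛ-≤ k 2ℚ c 1≤2 2≤c 17/24-expBound

-- (6/5)⁶ ≤ 3
-1-expBound : ExpBound 6 (- 1ℚ) (1/ fromℕ 3)
-1-expBound = combine z₄ q₄ z₂ q₂ (- 1ℚ) (1/ fromℕ 3) (toWitness {a? = 0ℚ ≤? q₄} _) refl
  (toWitness {a? = 1/ fromℕ 3 ≤? q₄ * q₂} _) e₄ e₂
  where
  z₁ q₁ z₂ q₂ z₄ q₄ : ℚ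
  z₁ = - (int 1 / 6)
  q₁ = int 5 / 6
  z₂ = - (int 1 / 3)
  q₂ = int 25 / 36
  z₄ = - (int 2 / 3)
  q₄ = int 625 / 1296
  e₁ : ExpBound 1 z₁ q₁
  e₁ = single z₁ (toWitness {a? = 0ℚ ≤? 1ℚ + z₁} _)
  e₂ : ExpBound 2 z₂ q₂
  e₂ = combine z₁ q₁ z₁ q₁ z₂ q₂ (toWitness {a? = 0ℚ ≤? q₁} _) refl (toWitness {a? = q₂ ≤? q₁ * q₁} _) e₁ e₁
  e₄ : ExpBound 4 z₄ q₄
  e₄ = combine z₂ q₂ z₂ q₂ z₄ q₄ (toWitness {a? = 0ℚ ≤? q₂} _) refl (toWitness {a? = q₄ ≤? q₂ * q₂} _) e₂ e₂

-- Multiplying the certificate for q by the one for 1/3 at exponent -1 gives the product q/3 ≥ 1.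
1≤ln : ∀ k q → fromℕ 3 ≤ q → 1ℚ ≤ lnₛ k q
1≤ln k q 3≤q = ≤-by (lnₛ k q + - 1ℚ)
  (exponent-nonNeg {z = lnₛ k q + - 1ℚ} {q * 1/ fromℕ 3} (*-monoʳ {fromℕ 3} {q} (1/ fromℕ 3) (toWitness {a? = 0ℚ ≤? 1/ fromℕ 3} _) 3≤q)
    (_⊕_ {z = lnₛ k q} { - 1ℚ} {q} {1/ fromℕ 3} (lnₛ-expBound k q 0<q) -1-expBound (<⇒≤ 0<q)))
  refl
  where
  0<q : 0ℚ < q
  0<q = <-≤-trans (toWitness {a? = 0ℚ <? fromℕ 3} _) 3≤q

-- Approximate functional equations of the logarithm

-- A left sum overestimates ln on either side of 1, so ln 2 and ln 1/2 do not cancel exactly.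
0≤ln2+ln½ : ∀ k → 0ℚ ≤ lnₛ k 2ℚ + lnₛ k ½
0≤ln2+ln½ k = exponent-nonNeg {z = lnₛ k 2ℚ + lnₛ k ½} {2ℚ * ½} ≤-refl
  (_⊕_ {z = lnₛ k 2ℚ} {lnₛ k ½} {2ℚ} {½} (lnₛ-expBound k 2ℚ (<-≤-trans 0<1 1≤2)) (lnₛ-expBound k ½ 0<½) (≤-trans 0≤1 1≤2))

ln2+ln½≤ : ∀ k c → 2ℚ ≤ c → lnₛ k 2ℚ + lnₛ k ½ ≤ c * ½ ^ k + c * ½ ^ k
ln2+ln½≤ k c 2≤c =
  let z , E , h = lnₛ-reciprocal-≤ k 2ℚ c 1≤2 2≤c
      z′ , E′ , eq = lnₛ-reciprocal k ½ 0<½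
  in main (c * ½ ^ k) (½ ^ k) (lnₛ k 2ℚ) (lnₛ k ½) z z′ h
    (exponent-nonNeg {z = z + z′} {inv 2ℚ * inv ½} ≤-refl (_⊕_ {z = z} {z′} {inv 2ℚ} {inv ½} E E′ 0≤½))
    (trans eq (lem′ (½ ^ k))) (0≤- (*-monoʳ {½} {c} (½ ^ k) (0≤½^ k) (≤-trans (toWitness {a? = ½ ≤? 2ℚ} _) 2≤c)))
  where
  lem′ : ∀ x → (½ - 1ℚ) * x * (1ℚ - 2ℚ) ≡ ½ * x
  lem′ = solve-∀ ℚ-ring
  main : ∀ e x b b′ z z′ → b ≤ e - z → 0ℚ ≤ z + z′ → b′ + z′ ≡ ½ * x → 0ℚ ≤ e - ½ * x → b + b′ ≤ e + e
  main e x b b′ z z′ h₁ h₂ h₃ h₄ = ≤-by ((e - z - b) + (z + z′) + (e - ½ * x))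
    (0≤+ {(e - z - b) + (z + z′)} {e - ½ * x} (0≤+ {e - z - b} {z + z′} (0≤- h₁) h₂) h₄)
    (trans (lem e b b′ z z′) (cong (λ t → (e - z - b) + (z + z′) + (e - t)) h₃))
    where
    lem : ∀ e b b′ z z′ → e + e - (b + b′) ≡ (e - z - b) + (z + z′) + (e - (b′ + z′))
    lem = solve-∀ ℚ-ring

1≤q½⇒1≤q : ∀ {q} → 1ℚ ≤ q * ½ → 1ℚ ≤ q
1≤q½⇒1≤q {q} 1≤q½ = ≤-by ((q * ½ - 1ℚ) * 2ℚ + 1ℚ) (0≤+ {(q * ½ - 1ℚ) * 2ℚ} {1ℚ}
  (0≤* {q * ½ - 1ℚ} {2ℚ} (0≤- 1≤q½) (≤-trans 0≤1 1≤2)) 0≤1) (lem q)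
  where
  lem : ∀ q → q - 1ℚ ≡ (q * ½ - 1ℚ) * 2ℚ + 1ℚ
  lem = solve-∀ ℚ-ring

ln-double : ∀ k q c → 1ℚ ≤ q * ½ → q ≤ c → lnₛ k q ≤ c * ½ ^ k + (lnₛ k (q * ½) + lnₛ k 2ℚ)
ln-double k q c 1≤q½ q≤c = lnₛ-≤ k q c (1≤q½⇒1≤q {q} 1≤q½) q≤c
  (subst (ExpBound (2 ℕ.^ k ℕ.+ 2 ℕ.^ k) (lnₛ k (q * ½) + lnₛ k 2ℚ)) (lem q)
    (_⊕_ {z = lnₛ k (q * ½)} {lnₛ k 2ℚ} {q * ½} {2ℚ}
      (lnₛ-expBound k (q * ½) (<-≤-trans 0<1 1≤q½)) (lnₛ-expBound k 2ℚ (<-≤-trans 0<1 1≤2)) (≤-trans 0≤1 1≤q½)))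
  where
  lem : ∀ q → q * ½ * 2ℚ ≡ q
  lem = solve-∀ ℚ-ring

ln-half : ∀ k q c → 1ℚ ≤ q * ½ → q * ½ ≤ c → lnₛ k (q * ½) ≤ c * ½ ^ k + (lnₛ k q + lnₛ k ½)
ln-half k q c 1≤q½ q½≤c = lnₛ-≤ k (q * ½) c 1≤q½ q½≤c
  (_⊕_ {z = lnₛ k q} {lnₛ k ½} {q} {½} (lnₛ-expBound k q 0<q) (lnₛ-expBound k ½ 0<½) (<⇒≤ 0<q))
  where
  0<q : 0ℚ < q
  0<q = <-≤-trans 0<1 (1≤q½⇒1≤q {q} 1≤q½)

-- The j-th power of the certificate for 1/q, times the one for r, has product at least 1. Hence the
-- error c/2^k is counted j times.
ln-power : ∀ k q c j r → 1ℚ ≤ q → q ≤ c → q ^ j ≤ r → 0ℚ < r →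
  fromℕ j * (lnₛ k q - c * ½ ^ k) ≤ lnₛ k r
ln-power k q c j r 1≤q q≤c q^j≤r 0<r =
  let z , E , h = lnₛ-reciprocal-≤ k q c 1≤q q≤c
  in ≤-by
    ((lnₛ k r + fromℕ j * z) + fromℕ j * (c * ½ ^ k - z - lnₛ k q))
    (0≤+ {lnₛ k r + fromℕ j * z} {fromℕ j * (c * ½ ^ k - z - lnₛ k q)}
      (exponent-nonNeg {z = lnₛ k r + fromℕ j * z} {r * inv q ^ j}
        (≤-trans (≤-reflexive (sym one′)) (*-monoʳ {q ^ j} {r} (inv q ^ j) (^-nonNeg 0≤i j) q^j≤r))
        (_⊕_ {z = lnₛ k r} {fromℕ j * z} {r} {inv q ^ j} (lnₛ-expBound k r 0<r) (power 0≤i E j) (<⇒≤ 0<r)))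
      (0≤* {fromℕ j} {c * ½ ^ k - z - lnₛ k q} (0≤fromℕ j) (0≤- h)))
    (lem (lnₛ k r) (fromℕ j) z (c * ½ ^ k) (lnₛ k q))
  where
  0≤i : 0ℚ ≤ inv q
  0≤i = inv-nonNeg (≤-trans 0≤1 1≤q)
  one′ : q ^ j * inv q ^ j ≡ 1ℚ
  one′ = trans (sym (Exp.^-distrib-* q (inv q) j))
    (trans (cong (_^ j) (inv-inverse (pos⇒≢0 (<-≤-trans 0<1 1≤q)))) (1^ j))
  lem : ∀ r j z e l → r - j * (l - e) ≡ r + j * z + j * (e - z - l)
  lem = solve-∀ ℚ-ring

-- Concavity: the tangent of ln at 2p.
ln-tangent : ∀ k x p c → 1ℚ ≤ x → x ≤ c → 1ℚ ≤ p →
  lnₛ k x ≤ c * ½ ^ k + (lnₛ k p + lnₛ k 2ℚ + (x * inv (p * 2ℚ) - 1ℚ))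
ln-tangent k x p c 1≤x x≤c 1≤p = lnₛ-≤ k x c 1≤x x≤c
  (weaken {q = p * 2ℚ * (1ℚ + w)} {x} (≤-reflexive (sym (trans (lem (p * 2ℚ) x (inv (p * 2ℚ)))
      (trans (cong (x *_) (inv-inverse (pos⇒≢0 0<2p))) (*-identityʳ x)))))
    (step {z = lnₛ k p + lnₛ k 2ℚ} {p * 2ℚ} {w} (subst (0ℚ ≤_) (sym (lem′ (x * inv (p * 2ℚ))))
        (0≤* {x} {inv (p * 2ℚ)} (≤-trans 0≤1 1≤x) (<⇒≤ (inv-pos 0<2p))))
      (_⊕_ {z = lnₛ k p} {lnₛ k 2ℚ} {p} {2ℚ} (lnₛ-expBound k p 0<p) (lnₛ-expBound k 2ℚ 0<2) (<⇒≤ 0<p))))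
  where
  w : ℚ
  w = x * inv (p * 2ℚ) - 1ℚ
  0<p : 0ℚ < p
  0<p = <-≤-trans 0<1 1≤p
  0<2 : 0ℚ < 2ℚ
  0<2 = <-≤-trans 0<1 1≤2
  0<2p : 0ℚ < p * 2ℚ
  0<2p = 0<* {p} {2ℚ} 0<p 0<2
  lem : ∀ s x i → s * (1ℚ + (x * i - 1ℚ)) ≡ x * (s * i)
  lem = solve-∀ ℚ-ring
  lem′ : ∀ t → 1ℚ + (t - 1ℚ) ≡ t
  lem′ = solve-∀ ℚ-ring

-- Estimates for the approximate exponential

module _ (k : ℕ) where

  private
    N : ℕ
    N = 2 ℕ.^ k
    h : ℚ
    h = ½ ^ k

    0≤1+fh : ∀ {f} → - 1ℚ ≤ f → 0ℚ ≤ 1ℚ + f * h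
    0≤1+fh {f} -1≤f = ≤-by ((f - - 1ℚ) * h + (1ℚ - h))
      (0≤+ {(f - - 1ℚ) * h} {1ℚ - h} (0≤* {f - - 1ℚ} {h} (0≤- -1≤f) (0≤½^ k)) (0≤- (½^≤1 k)))
      (lem f h)
      where
      lem : ∀ f h → 1ℚ + f * h - 0ℚ ≡ (f - - 1ℚ) * h + (1ℚ - h)
      lem = solve-∀ ℚ-ring

    1+fh≤1 : ∀ {f} → f ≤ 0ℚ → 1ℚ + f * h ≤ 1ℚ
    1+fh≤1 {f} f≤0 = ≤-by ((0ℚ - f) * h) (0≤* {0ℚ - f} {h} (0≤- f≤0) (0≤½^ k)) (lem f h)
      where
      lem : ∀ f h → 1ℚ - (1ℚ + f * h) ≡ (0ℚ - f) * h
      lem = solve-∀ ℚ-ring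

  0≤expₛ : ∀ {f} → - 1ℚ ≤ f → 0ℚ ≤ expₛ k f
  0≤expₛ {f} -1≤f = ^-nonNeg (0≤1+fh {f} -1≤f) N

  expₛ≤1 : ∀ {f} → - 1ℚ ≤ f → f ≤ 0ℚ → expₛ k f ≤ 1ℚ
  expₛ≤1 {f} -1≤f f≤0 = ^≤1 (0≤1+fh {f} -1≤f) (1+fh≤1 {f} f≤0) N

  1+f≤expₛ : ∀ {f} → - 1ℚ ≤ f → 1ℚ + f ≤ expₛ k f
  1+f≤expₛ {f} -1≤f = ≤-trans (≤-reflexive (cong (λ t → 1ℚ + t) (sym eq))) (bernoulli {f * h} (0≤1+fh {f} -1≤f) N)
    where
    lem : ∀ n f h → n * (f * h) ≡ f * (n * h)
    lem = solve-∀ ℚ-ring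
    eq : fromℕ N * (f * h) ≡ f
    eq = trans (lem (fromℕ N) f h) (trans (cong (f *_) (fromℕ-2^ k)) (*-identityʳ f))

  -- On [0,1] the map t^N has Lipschitz constant N, and the two bases differ by η/N: at nonpositive
  -- exponents exp has slope at most 1.
  expₛ-shift : ∀ f η → - 1ℚ ≤ f → f ≤ 0ℚ → 0ℚ ≤ η → 0ℚ ≤ 1ℚ + (f - η) * h →
    expₛ k f - η ≤ expₛ k (f - η)
  expₛ-shift f η -1≤f f≤0 0≤η 0≤base = ≤-by (η - (u ^ N - w ^ N)) (0≤- bound) (lem (u ^ N) (w ^ N) η)
    where
    u w : ℚ
    u = 1ℚ + f * h
    w = 1ℚ + (f - η) * h
    diff : u - w ≡ η * h
    diff = lem′ f η h
      where
      lem′ : ∀ f η h → 1ℚ + f * h - (1ℚ + (f - η) * h) ≡ η * h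
      lem′ = solve-∀ ℚ-ring
    w≤u : w ≤ u
    w≤u = ≤-by (η * h) (0≤* {η} {h} 0≤η (0≤½^ k)) diff
    u≤1 : u ≤ 1ℚ
    u≤1 = 1+fh≤1 {f} f≤0
    bound : u ^ N - w ^ N ≤ η
    bound = ≤-trans (p≤∣p∣ (u ^ N - w ^ N)) (≤-trans
      (^-lipschitz {u} {w} {1ℚ} {η * h} ≤-refl (∣∣-nonNeg (0≤1+fh {f} -1≤f) u≤1) (∣∣-nonNeg 0≤base (≤-trans w≤u u≤1))
        (∣∣-nonNeg (0≤- w≤u) (≤-reflexive diff)) N)
      (≤-reflexive (trans (cong (λ t → fromℕ N * (η * h * t)) (1^ N))
        (trans (lem′ (fromℕ N) η h) (trans (cong (η *_) (fromℕ-2^ k)) (*-identityʳ η))))))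
      where
      lem′ : ∀ n η h → n * (η * h * 1ℚ) ≡ η * (n * h)
      lem′ = solve-∀ ℚ-ring
    lem : ∀ a b η → b - (a - η) ≡ η - (a - b)
    lem = solve-∀ ℚ-ring

  -- (1 + ℓh)(1 - ch) ≤ 1 + (ℓ-c)h for ℓ, c ≥ 0 gives e^(ℓ-c) ≥ e^ℓ e^(-c).
  expₛ-product : ∀ x ℓ f g η → h ≤ ½ → 0ℚ ≤ x → x ≤ expₛ k ℓ → 0ℚ ≤ ℓ → - 1ℚ ≤ f → f ≤ 0ℚ →
    0ℚ ≤ η → η ≤ 1ℚ → ℓ + f - η ≤ g → x * (expₛ k f - η) ≤ expₛ k g
  expₛ-product x ℓ f g η h≤½ 0≤x x≤ 0≤ℓ -1≤f f≤0 0≤η η≤1 ≤g = begin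
    x * (expₛ k f - η)           ≤⟨ *-monoˡ x 0≤x (expₛ-shift f η -1≤f f≤0 0≤η 0≤w) ⟩
    x * expₛ k (f - η)           ≤⟨ *-monoʳ {x} {expₛ k ℓ} (expₛ k (f - η)) (^-nonNeg 0≤w N) x≤ ⟩
    (1ℚ + ℓ * h) ^ N * w ^ N     ≡⟨ Exp.^-distrib-* (1ℚ + ℓ * h) w N ⟨
    ((1ℚ + ℓ * h) * w) ^ N       ≤⟨ ^-mono (0≤* {1ℚ + ℓ * h} {w} 0≤1+ℓh 0≤w) base≤ N ⟩
    expₛ k g                     ∎
    where
    open ≤-Reasoning
    w : ℚ
    w = 1ℚ + (f - η) * h
    0≤w : 0ℚ ≤ w
    0≤w = ≤-by (((f - - 1ℚ) + (1ℚ - η)) * h + 2ℚ * (½ - h))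
      (0≤+ {((f - - 1ℚ) + (1ℚ - η)) * h} {2ℚ * (½ - h)}
        (0≤* {(f - - 1ℚ) + (1ℚ - η)} {h} (0≤+ {f - - 1ℚ} {1ℚ - η} (0≤- -1≤f) (0≤- η≤1)) (0≤½^ k))
        (0≤* {2ℚ} {½ - h} (≤-trans 0≤1 1≤2) (0≤- h≤½)))
      (lem f η h)
      where
      lem : ∀ f η h → 1ℚ + (f - η) * h - 0ℚ ≡ ((f - - 1ℚ) + (1ℚ - η)) * h + 2ℚ * (½ - h)
      lem = solve-∀ ℚ-ring
    0≤1+ℓh : 0ℚ ≤ 1ℚ + ℓ * h
    0≤1+ℓh = 0≤+ {1ℚ} {ℓ * h} 0≤1 (0≤* {ℓ} {h} 0≤ℓ (0≤½^ k))
    base≤ : (1ℚ + ℓ * h) * w ≤ 1ℚ + g * h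
    base≤ = ≤-by ((g - (ℓ + f - η)) * h + ℓ * h * ((0ℚ - f + η) * h))
      (0≤+ {(g - (ℓ + f - η)) * h} {ℓ * h * ((0ℚ - f + η) * h)}
        (0≤* {g - (ℓ + f - η)} {h} (0≤- ≤g) (0≤½^ k))
        (0≤* {ℓ * h} {(0ℚ - f + η) * h} (0≤* {ℓ} {h} 0≤ℓ (0≤½^ k))
          (0≤* {0ℚ - f + η} {h} (0≤+ {0ℚ - f} {η} (0≤- f≤0) 0≤η) (0≤½^ k))))
      (lem ℓ f g η h)
      where
      lem : ∀ ℓ f g η h → 1ℚ + g * h - (1ℚ + ℓ * h) * (1ℚ + (f - η) * h)
        ≡ (g - (ℓ + f - η)) * h + ℓ * h * ((0ℚ - f + η) * h)
      lem = solve-∀ ℚ-ring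

-- From the Newton step to an inequality in p, ln p and ln 2

-- Multiplying by 1 - α e₂ > 0 clears the denominator. Here `e₁` stands for x^α and `e₂` for
-- x^(α-1); of the identity e₁ = x e₂ only a lower bound with error η is available.
newton-step : ∀ L p η α e₁ e₂ → α * e₂ < 1ℚ → 0ℚ ≤ α * e₂ → 0ℚ ≤ η →
  1ℚ + L - (e₁ - L) * inv (α * e₂ - 1ℚ) ≤ p + η → (1ℚ + L) * (e₂ - η) ≤ e₁ →
  e₂ * (α * p + (1ℚ + L) * (1ℚ - α)) ≤ p - 1ℚ + η * (1ℚ + (1ℚ + L))
newton-step L p η α e₁ e₂ αe<1 0≤αe 0≤η hyp h = ≤-by
  ((1ℚ - α * e₂) * (p + η - (1ℚ + L - (e₁ - L) * inv D)) + (e₁ - (1ℚ + L) * (e₂ - η)) + η * (α * e₂))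
  (0≤+ {(1ℚ - α * e₂) * (p + η - (1ℚ + L - (e₁ - L) * inv D)) + (e₁ - (1ℚ + L) * (e₂ - η))} {η * (α * e₂)}
    (0≤+ {(1ℚ - α * e₂) * (p + η - (1ℚ + L - (e₁ - L) * inv D))} {e₁ - (1ℚ + L) * (e₂ - η)}
      (0≤* {1ℚ - α * e₂} {p + η - (1ℚ + L - (e₁ - L) * inv D)} (0≤- (<⇒≤ αe<1)) (0≤- hyp)) (0≤- h))
    (0≤* {η} {α * e₂} 0≤η 0≤αe))
  (trans (lem′ rest (e₁ - L)) (trans (cong (λ t → rest + (e₁ - L) * (1ℚ - t)) (sym (inv-inverse D≢0)))
    (lem L p η α e₁ e₂ (inv D))))
  where
  D rest : ℚ
  D = α * e₂ - 1ℚ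
  rest = p - 1ℚ + η * (1ℚ + (1ℚ + L)) - e₂ * (α * p + (1ℚ + L) * (1ℚ - α))
  D≢0 : D ≢ 0ℚ
  D≢0 eq = <-irrefl (trans (sub (α * e₂)) (trans (cong (_+ 1ℚ) eq) (+-identityˡ 1ℚ))) αe<1
    where
    sub : ∀ t → t ≡ t - 1ℚ + 1ℚ
    sub = solve-∀ ℚ-ring
  lem′ : ∀ r d → r ≡ r + d * (1ℚ - 1ℚ)
  lem′ = solve-∀ ℚ-ring
  lem : ∀ L p η α e₁ e₂ i →
    p - 1ℚ + η * (1ℚ + (1ℚ + L)) - e₂ * (α * p + (1ℚ + L) * (1ℚ - α)) + (e₁ - L) * (1ℚ - (α * e₂ - 1ℚ) * i)
    ≡ (1ℚ - α * e₂) * (p + η - (1ℚ + L - (e₁ - L) * i)) + (e₁ - (1ℚ + L) * (e₂ - η)) + η * (α * e₂)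
  lem = solve-∀ ℚ-ring

-- `v` stands for 1/L, `ℓ` for ln x and `e₂` for x^(-1/L). The sum `s` collects the error factors 1
-- + x of `newton` and p + x of `K₀≤K`.
module _ (p L v η α e₂ ℓ s : ℚ) (s-def : s ≡ (1ℚ + (1ℚ + L)) + (p + (1ℚ + L)))
  (1≤p : 1ℚ ≤ p) (0≤L : 0ℚ ≤ L) (0≤v : 0ℚ ≤ v) (vL≡1 : v * L ≡ 1ℚ) (0≤η : 0ℚ ≤ η)
  (0≤α : 0ℚ ≤ α) (α≤1 : α ≤ 1ℚ) (α≥ : 1ℚ - v - η ≤ α) (1-α≥ : v - η ≤ 1ℚ - α)
  (0≤ℓ : 0ℚ ≤ ℓ) (vℓ≤1 : v * ℓ ≤ 1ℚ) (e₂≥ : 1ℚ - v * ℓ ≤ e₂)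
  (newton : e₂ * (α * p + (1ℚ + L) * (1ℚ - α)) ≤ p - 1ℚ + η * (1ℚ + (1ℚ + L)))
  where

  private
    x K t : ℚ
    x = 1ℚ + L
    K = α * p + x * (1ℚ - α)
    t = v * ℓ
    0≤p : 0ℚ ≤ p
    0≤p = ≤-trans 0≤1 1≤p
    0≤x : 0ℚ ≤ x
    0≤x = 0≤+ {1ℚ} {L} 0≤1 0≤L
    0≤K : 0ℚ ≤ K
    0≤K = 0≤+ {α * p} {x * (1ℚ - α)} (0≤* {α} {p} 0≤α 0≤p) (0≤* {x} {1ℚ - α} 0≤x (0≤- α≤1))
    0≤t : 0ℚ ≤ t
    0≤t = 0≤* {v} {ℓ} 0≤v 0≤ℓ
    -- lower bound of K with 1 - α replaced by v = 1 / L
    K₀ : ℚ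
    K₀ = p + 1ℚ - v * (p - 1ℚ) - η * (p + x)
    K₀≤K : K₀ ≤ K
    K₀≤K = ≤-by ((α - (1ℚ - v - η)) * p + x * (1ℚ - α - (v - η)))
      (0≤+ {(α - (1ℚ - v - η)) * p} {x * (1ℚ - α - (v - η))} (0≤* {α - (1ℚ - v - η)} {p} (0≤- α≥) 0≤p)
        (0≤* {x} {1ℚ - α - (v - η)} 0≤x (0≤- 1-α≥)))
      (trans (cong (λ o → K - (p + o - v * (p - 1ℚ) - η * (p + x))) (sym vL≡1)) (lem p L v η α))
      where
      lem : ∀ p L v η α → α * p + (1ℚ + L) * (1ℚ - α) - (p + v * L - v * (p - 1ℚ) - η * (p + (1ℚ + L)))
        ≡ (α - (1ℚ - v - η)) * p + (1ℚ + L) * (1ℚ - α - (v - η))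
      lem = solve-∀ ℚ-ring

  -- Inserting e₂ ≥ 1 - t and K ≥ K₀ and dropping the nonnegative product t v (p - 1) makes the
  -- inequality linear in t and v.
  scaled : 1ℚ + 1ℚ ≤ v * (p - 1ℚ) + t * (p + 1ℚ) + η * s
  scaled = ≤-by ((p - 1ℚ + η * (1ℚ + x) - e₂ * K) + ((e₂ - (1ℚ - t)) * K + ((1ℚ - t) * (K - K₀) + (t * (v * (p - 1ℚ)) + t * (η * (p + x))))))
    (0≤+ {p - 1ℚ + η * (1ℚ + x) - e₂ * K} {(e₂ - (1ℚ - t)) * K + ((1ℚ - t) * (K - K₀) + (t * (v * (p - 1ℚ)) + t * (η * (p + x))))} (0≤- newton)
      (0≤+ {(e₂ - (1ℚ - t)) * K} {(1ℚ - t) * (K - K₀) + (t * (v * (p - 1ℚ)) + t * (η * (p + x)))} (0≤* {e₂ - (1ℚ - t)} {K} (0≤- e₂≥) 0≤K)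
        (0≤+ {(1ℚ - t) * (K - K₀)} {t * (v * (p - 1ℚ)) + t * (η * (p + x))} (0≤* {1ℚ - t} {K - K₀} (0≤- vℓ≤1) (0≤- K₀≤K))
          (0≤+ {t * (v * (p - 1ℚ))} {t * (η * (p + x))}
            (0≤* {t} {v * (p - 1ℚ)} 0≤t (0≤* {v} {p - 1ℚ} 0≤v (0≤- 1≤p)))
            (0≤* {t} {η * (p + x)} 0≤t (0≤* {η} {p + x} 0≤η (0≤+ {p} {x} 0≤p 0≤x)))))))
    (trans (cong (λ s → v * (p - 1ℚ) + t * (p + 1ℚ) + η * s - (1ℚ + 1ℚ)) s-def) (lem p x v η e₂ t K))
    where
    lem : ∀ p x v η e t K → v * (p - 1ℚ) + t * (p + 1ℚ) + η * ((1ℚ + x) + (p + x)) - (1ℚ + 1ℚ)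
      ≡ (p - 1ℚ + η * (1ℚ + x) - e * K) + ((e - (1ℚ - t)) * K + ((1ℚ - t) * (K - (p + 1ℚ - v * (p - 1ℚ) - η * (p + x))) + (t * (v * (p - 1ℚ)) + t * (η * (p + x)))))
    lem = solve-∀ ℚ-ring

  unscaled : L + L ≤ (p - 1ℚ) + ℓ * (p + 1ℚ) + L * (η * s)
  unscaled = ≤-by (L * (v * (p - 1ℚ) + t * (p + 1ℚ) + η * s - (1ℚ + 1ℚ)))
    (0≤* {L} {v * (p - 1ℚ) + t * (p + 1ℚ) + η * s - (1ℚ + 1ℚ)} 0≤L (0≤- scaled))
    (trans (lem p ℓ L (η * s)) (trans (cong (λ o → o * (p - 1ℚ + ℓ * (p + 1ℚ)) + L * (η * s) - (L + L)) (sym vL≡1))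
      (lem′ p ℓ L v (η * s))))
    where
    lem : ∀ p ℓ L r → (p - 1ℚ) + ℓ * (p + 1ℚ) + L * r - (L + L) ≡ 1ℚ * (p - 1ℚ + ℓ * (p + 1ℚ)) + L * r - (L + L)
    lem = solve-∀ ℚ-ring
    lem′ : ∀ p ℓ L v r → v * L * (p - 1ℚ + ℓ * (p + 1ℚ)) + L * r - (L + L)
      ≡ L * (v * (p - 1ℚ) + v * ℓ * (p + 1ℚ) + r - (1ℚ + 1ℚ))
    lem′ = solve-∀ ℚ-ring

  -- The parameters stand for ln n, ln 2, ln p and 1/(2p).
  module _ (a b λₚ i : ℚ) (bL≡a : b * L ≡ a) (0≤b : 0ℚ ≤ b) (2p*i≡1 : p * 2ℚ * i ≡ 1ℚ)
    (ℓ≤ : ℓ ≤ η + (λₚ + b + (x * i - 1ℚ))) (a≥ : p * (λₚ - η) ≤ a) where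

    private
      P R S : ℚ
      P = p * 2ℚ
      S = P * (p - 1ℚ) + (p + 1ℚ) * (P * (λₚ + b - 1ℚ) + 1ℚ)
      R = P * (p - 1ℚ) + (p + 1ℚ) * (P * (λₚ + b - 1ℚ + η) + 1ℚ) + P * (L * (η * s))
      0≤P : 0ℚ ≤ P
      0≤P = 0≤* {p} {2ℚ} 0≤p (≤-trans 0≤1 1≤2)
      0≤3p-1 : 0ℚ ≤ P + (p - 1ℚ)
      0≤3p-1 = 0≤+ {P} {p - 1ℚ} 0≤P (0≤- 1≤p)

    -- After multiplication by 2p the tangent contributes (p + 1) L on the right, and 4p - (p + 1) =
    -- 3p - 1 is left as the coefficient of L.
    tangent-used : (P + (p - 1ℚ)) * L ≤ R
    tangent-used = ≤-by
      (P * ((p - 1ℚ) + ℓ * (p + 1ℚ) + L * (η * s) - (L + L)) + (p + 1ℚ) * (P * (η + (λₚ + b + (x * i - 1ℚ)) - ℓ)))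
      (0≤+ {P * ((p - 1ℚ) + ℓ * (p + 1ℚ) + L * (η * s) - (L + L))} {(p + 1ℚ) * (P * (η + (λₚ + b + (x * i - 1ℚ)) - ℓ))}
        (0≤* {P} {(p - 1ℚ) + ℓ * (p + 1ℚ) + L * (η * s) - (L + L)} 0≤P (0≤- unscaled))
        (0≤* {p + 1ℚ} {P * (η + (λₚ + b + (x * i - 1ℚ)) - ℓ)} (0≤+ {p} {1ℚ} 0≤p 0≤1)
          (0≤* {P} {η + (λₚ + b + (x * i - 1ℚ)) - ℓ} 0≤P (0≤- ℓ≤))))
      (trans (lem p L η λₚ b (η * s)) (trans (cong (λ o → P * (p - 1ℚ) + (p + 1ℚ) * (P * (λₚ + b - 1ℚ + η) + o * x) + P * (L * (η * s)) - (P + P) * L) (sym 2p*i≡1))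
        (lem′ p L η λₚ b (η * s) i ℓ)))
      where
      lem : ∀ p L η l b r → p * 2ℚ * (p - 1ℚ) + (p + 1ℚ) * (p * 2ℚ * (l + b - 1ℚ + η) + 1ℚ) + p * 2ℚ * (L * r) - (p * 2ℚ + (p - 1ℚ)) * L
        ≡ p * 2ℚ * (p - 1ℚ) + (p + 1ℚ) * (p * 2ℚ * (l + b - 1ℚ + η) + 1ℚ * (1ℚ + L)) + p * 2ℚ * (L * r) - (p * 2ℚ + p * 2ℚ) * L
      lem = solve-∀ ℚ-ring
      lem′ : ∀ p L η l b r i ℓ → p * 2ℚ * (p - 1ℚ) + (p + 1ℚ) * (p * 2ℚ * (l + b - 1ℚ + η) + p * 2ℚ * i * (1ℚ + L)) + p * 2ℚ * (L * r) - (p * 2ℚ + p * 2ℚ) * L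
        ≡ p * 2ℚ * ((p - 1ℚ) + ℓ * (p + 1ℚ) + L * r - (L + L)) + (p + 1ℚ) * (p * 2ℚ * (η + (l + b + ((1ℚ + L) * i - 1ℚ)) - ℓ))
      lem′ = solve-∀ ℚ-ring

    -- Multiplication by b turns L into ln n, and ln n ≥ p ln p then removes n from everything but
    -- the error term.
    cleared : (P + (p - 1ℚ)) * (p * λₚ) ≤ b * S + η * ((P + (p - 1ℚ)) * p + b * (p + 1ℚ) * P + P * a * s)
    cleared = ≤-by (b * (R - (P + (p - 1ℚ)) * L) + (P + (p - 1ℚ)) * (a - p * (λₚ - η)))
      (0≤+ {b * (R - (P + (p - 1ℚ)) * L)} {(P + (p - 1ℚ)) * (a - p * (λₚ - η))}
        (0≤* {b} {R - (P + (p - 1ℚ)) * L} 0≤b (0≤- tangent-used))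
        (0≤* {P + (p - 1ℚ)} {a - p * (λₚ - η)} 0≤3p-1 (0≤- a≥)))
      (trans (cong (λ a → b * S + η * ((P + (p - 1ℚ)) * p + b * (p + 1ℚ) * P + P * a * s) - (P + (p - 1ℚ)) * (p * λₚ)) (sym bL≡a))
        (trans (lem p L η λₚ b s) (cong (λ a → b * (R - (P + (p - 1ℚ)) * L) + (P + (p - 1ℚ)) * (a - p * (λₚ - η))) bL≡a)))
      where
      lem : ∀ p L η l b s → b * (p * 2ℚ * (p - 1ℚ) + (p + 1ℚ) * (p * 2ℚ * (l + b - 1ℚ) + 1ℚ)) + η * ((p * 2ℚ + (p - 1ℚ)) * p + b * (p + 1ℚ) * (p * 2ℚ) + p * 2ℚ * (b * L) * s) - (p * 2ℚ + (p - 1ℚ)) * (p * l)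
        ≡ b * (p * 2ℚ * (p - 1ℚ) + (p + 1ℚ) * (p * 2ℚ * (l + b - 1ℚ + η) + 1ℚ) + p * 2ℚ * (L * (η * s)) - (p * 2ℚ + (p - 1ℚ)) * L) + (p * 2ℚ + (p - 1ℚ)) * (b * L - p * (l - η))
      lem = solve-∀ ℚ-ring

-- The numerical inequality

B₀ : ℚ
B₀ = int 71 / 100

-- The certificate is an expansion in the slacks 71/100 - b, l - 1 and p - 3.
gap : ∀ p b l → fromℕ 3 ≤ p → 0ℚ ≤ b → b ≤ B₀ → 1ℚ ≤ l →
  b * (p * 2ℚ * (p - 1ℚ) + (p + 1ℚ) * (p * 2ℚ * (l + b - 1ℚ) + 1ℚ)) + (½ + int 1 / 100) ≤ (p * 2ℚ + (p - 1ℚ)) * (p * l)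
gap p b l 3≤p 0≤b b≤ 1≤l = ≤-by (T₁ + (T₂ + T₃))
  (0≤+ {T₁} {T₂ + T₃}
    (0≤* {p * (l - 1ℚ)} {c₁ * (p - fromℕ 3) + c₂ + 2ℚ * (B₀ - b) * (p + 1ℚ)} (0≤* {p} {l - 1ℚ} 0≤p (0≤- 1≤l))
      (0≤+ {c₁ * (p - fromℕ 3) + c₂} {2ℚ * (B₀ - b) * (p + 1ℚ)}
        (0≤+ {c₁ * (p - fromℕ 3)} {c₂} (0≤* {c₁} {p - fromℕ 3} (ge c₁) (0≤- 3≤p)) (ge c₂))
        (0≤* {2ℚ * (B₀ - b)} {p + 1ℚ} (0≤* {2ℚ} {B₀ - b} 0≤2 (0≤- b≤)) 0≤p+1)))
    (0≤+ {T₂} {T₃}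
      (0≤* {B₀ - b} {p * 2ℚ * (p - 1ℚ) + (p + 1ℚ) * (p * 2ℚ * (B₀ + b) + 1ℚ)} (0≤- b≤)
        (0≤+ {p * 2ℚ * (p - 1ℚ)} {(p + 1ℚ) * (p * 2ℚ * (B₀ + b) + 1ℚ)} (0≤* {p * 2ℚ} {p - 1ℚ} 0≤2p (0≤- 1≤p))
          (0≤* {p + 1ℚ} {p * 2ℚ * (B₀ + b) + 1ℚ} 0≤p+1
            (0≤+ {p * 2ℚ * (B₀ + b)} {1ℚ} (0≤* {p * 2ℚ} {B₀ + b} 0≤2p (0≤+ {B₀} {b} (ge B₀) 0≤b)) 0≤1))))
      (0≤+ {c₃ * ((p - fromℕ 3) * (p - fromℕ 3)) + c₄ * (p - fromℕ 3)} {c₅}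
        (0≤+ {c₃ * ((p - fromℕ 3) * (p - fromℕ 3))} {c₄ * (p - fromℕ 3)}
          (0≤* {c₃} {(p - fromℕ 3) * (p - fromℕ 3)} (ge c₃) (0≤x² (p - fromℕ 3)))
          (0≤* {c₄} {p - fromℕ 3} (ge c₄) (0≤- 3≤p))) (ge c₅))))
  (lem p b l)
  where
  c₁ c₂ c₃ c₄ c₅ T₁ T₂ T₃ : ℚ
  -- At the corner b = 71/100, l = 1, p = 3 every term but `c₅` vanishes. The summand 1/2 + 1/100
  -- reserves 1/2 for error terms and keeps the contradiction strict.
  c₁ = int 158 / 100
  c₂ = int 232 / 100
  c₃ = int 5718 / 10000
  c₄ = int 21326 / 10000
  c₅ = int 316 / 10000
  T₁ = p * (l - 1ℚ) * (c₁ * (p - fromℕ 3) + c₂ + 2ℚ * (B₀ - b) * (p + 1ℚ))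
  T₂ = (B₀ - b) * (p * 2ℚ * (p - 1ℚ) + (p + 1ℚ) * (p * 2ℚ * (B₀ + b) + 1ℚ))
  T₃ = c₃ * ((p - fromℕ 3) * (p - fromℕ 3)) + c₄ * (p - fromℕ 3) + c₅
  ge : ∀ q {t : True (0ℚ ≤? q)} → 0ℚ ≤ q
  ge q {t} = toWitness t
  0≤2 : 0ℚ ≤ 2ℚ
  0≤2 = ≤-trans 0≤1 1≤2
  1≤p : 1ℚ ≤ p
  1≤p = ≤-trans (fromℕ-mono {1} {3} (s≤s z≤n)) 3≤p
  0≤p : 0ℚ ≤ p
  0≤p = ≤-trans 0≤1 1≤p
  0≤p+1 : 0ℚ ≤ p + 1ℚ
  0≤p+1 = 0≤+ {p} {1ℚ} 0≤p 0≤1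
  0≤2p : 0ℚ ≤ p * 2ℚ
  0≤2p = 0≤* {p} {2ℚ} 0≤p 0≤2
  lem : ∀ p b l → (p * 2ℚ + (p - 1ℚ)) * (p * l) - (b * (p * 2ℚ * (p - 1ℚ) + (p + 1ℚ) * (p * 2ℚ * (l + b - 1ℚ) + 1ℚ)) + (½ + int 1 / 100))
    ≡ p * (l - 1ℚ) * (int 158 / 100 * (p - fromℕ 3) + int 232 / 100 + 2ℚ * (int 71 / 100 - b) * (p + 1ℚ))
      + ((int 71 / 100 - b) * (p * 2ℚ * (p - 1ℚ) + (p + 1ℚ) * (p * 2ℚ * (int 71 / 100 + b) + 1ℚ))
      + (int 5718 / 10000 * ((p - fromℕ 3) * (p - fromℕ 3)) + int 21326 / 10000 * (p - fromℕ 3) + int 316 / 10000))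
  lem = solve-∀ ℚ-ring

-- Propagation of the approximation errors

-- The first five parameters stand for ln n, ln (n/2), ln 2, ln (1/2) and ln x, and `e` for the
-- error of one functional equation. Each estimate meets at most three such errors, multiplied by
-- `V` or `Vℓ`, both at most 2; hence 6 e ≤ η.
module Estimates (a a′ b b′ ℓ e η : ℚ) (½≤b : ½ ≤ b) (b≤a : b ≤ a) (0≤a′ : 0ℚ ≤ a′) (a′<a : a′ < a)
  (0≤ℓ : 0ℚ ≤ ℓ) (ℓ≤L : ℓ ≤ a * inv b) (b′≤0 : b′ ≤ 0ℚ) (0≤b+b′ : 0ℚ ≤ b + b′) (b+b′≤ : b + b′ ≤ e + e)
  (a≤ : a ≤ e + (a′ + b)) (a′≤ : a′ ≤ e + (a + b′)) (0≤e : 0ℚ ≤ e) (6e≤η : fromℕ 6 * e ≤ η)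
  where

  L v V α f : ℚ
  L = a * inv b
  V = inv a
  v = b * V
  α = a′ * V
  f = b′ * V * ℓ

  0<b : 0ℚ < b
  0<b = <-≤-trans 0<½ ½≤b
  0<a : 0ℚ < a
  0<a = <-≤-trans 0<b b≤a
  aV≡1 : a * V ≡ 1ℚ
  aV≡1 = inv-inverse (pos⇒≢0 0<a)
  b*ib≡1 : b * inv b ≡ 1ℚ
  b*ib≡1 = inv-inverse (pos⇒≢0 0<b)
  0<V : 0ℚ < V
  0<V = inv-pos 0<a
  0≤V : 0ℚ ≤ V
  0≤V = <⇒≤ 0<V
  0≤ib : 0ℚ ≤ inv b
  0≤ib = <⇒≤ (inv-pos 0<b)
  ib≤2 : inv b ≤ 2ℚ
  ib≤2 = inv-antimono {½} {b} 0<½ ½≤b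
  V≤2 : V ≤ 2ℚ
  V≤2 = inv-antimono {½} {a} 0<½ (≤-trans ½≤b b≤a)
  0≤v : 0ℚ ≤ v
  0≤v = 0≤* {b} {V} (<⇒≤ 0<b) 0≤V
  0≤L : 0ℚ ≤ L
  0≤L = 0≤* {a} {inv b} (<⇒≤ 0<a) 0≤ib

  vL≡1 : v * L ≡ 1ℚ
  vL≡1 = trans (lem a V b (inv b)) (cong₂ _*_ aV≡1 b*ib≡1)
    where
    lem : ∀ a V b i → b * V * (a * i) ≡ a * V * (b * i)
    lem = solve-∀ ℚ-ring

  bL≡a : b * L ≡ a
  bL≡a = trans (lem a b (inv b)) (trans (cong (a *_) b*ib≡1) (*-identityʳ a))
    where
    lem : ∀ a b i → b * (a * i) ≡ a * (b * i)
    lem = solve-∀ ℚ-ring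

  0≤α : 0ℚ ≤ α
  0≤α = 0≤* {a′} {V} 0≤a′ 0≤V

  α<1 : α < 1ℚ
  α<1 = subst (α <_) aV≡1 (*-monoˡ-<-pos V {{positive 0<V}} a′<a)

  eV≤2e : e * V ≤ e * 2ℚ
  eV≤2e = *-monoˡ {V} {2ℚ} e 0≤e V≤2

  α≥ : 1ℚ - v - η ≤ α
  α≥ = ≤-by ((e + (a′ + b) - a) * V + ((e * 2ℚ - e * V) + (fromℕ 4 * e + (η - fromℕ 6 * e))))
    (0≤+ {(e + (a′ + b) - a) * V} {(e * 2ℚ - e * V) + (fromℕ 4 * e + (η - fromℕ 6 * e))}
      (0≤* {e + (a′ + b) - a} {V} (0≤- a≤) 0≤V)
      (0≤+ {e * 2ℚ - e * V} {fromℕ 4 * e + (η - fromℕ 6 * e)} (0≤- eV≤2e)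
        (0≤+ {fromℕ 4 * e} {η - fromℕ 6 * e} (0≤* {fromℕ 4} {e} (0≤fromℕ 4) 0≤e) (0≤- 6e≤η))))
    (trans (cong (λ o → α - (o - v - η)) (sym aV≡1)) (lem a a′ b V e η))
    where
    lem : ∀ a a′ b V e η → a′ * V - (a * V - b * V - η)
      ≡ (e + (a′ + b) - a) * V + ((e * 2ℚ - e * V) + (fromℕ 4 * e + (η - fromℕ 6 * e)))
    lem = solve-∀ ℚ-ring

  1-α≥ : v - η ≤ 1ℚ - α
  1-α≥ = ≤-by (((e + (a + b′) - a′) + (e + e - (b + b′))) * V + (fromℕ 3 * (e * 2ℚ - e * V) + (η - fromℕ 6 * e)))
    (0≤+ {((e + (a + b′) - a′) + (e + e - (b + b′))) * V} {fromℕ 3 * (e * 2ℚ - e * V) + (η - fromℕ 6 * e)}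
      (0≤* {(e + (a + b′) - a′) + (e + e - (b + b′))} {V}
        (0≤+ {e + (a + b′) - a′} {e + e - (b + b′)} (0≤- a′≤) (0≤- b+b′≤)) 0≤V)
      (0≤+ {fromℕ 3 * (e * 2ℚ - e * V)} {η - fromℕ 6 * e}
        (0≤* {fromℕ 3} {e * 2ℚ - e * V} (0≤fromℕ 3) (0≤- eV≤2e)) (0≤- 6e≤η)))
    (trans (cong (λ o → o - α - (v - η)) (sym aV≡1)) (lem a a′ b b′ V e η))
    where
    lem : ∀ a a′ b b′ V e η → a * V - a′ * V - (b * V - η)
      ≡ ((e + (a + b′) - a′) + (e + e - (b + b′))) * V + (fromℕ 3 * (e * 2ℚ - e * V) + (η - fromℕ 6 * e))
    lem = solve-∀ ℚ-ring

  vℓ≤1 : v * ℓ ≤ 1ℚ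
  vℓ≤1 = ≤-trans (*-monoˡ {ℓ} {L} v 0≤v ℓ≤L) (≤-reflexive vL≡1)

  Vℓ : ℚ
  Vℓ = V * ℓ

  0≤Vℓ : 0ℚ ≤ Vℓ
  0≤Vℓ = 0≤* {V} {ℓ} 0≤V 0≤ℓ

  Vℓ≤2 : Vℓ ≤ 2ℚ
  Vℓ≤2 = ≤-trans (*-monoˡ {ℓ} {L} V 0≤V ℓ≤L) (≤-trans (≤-reflexive
    (trans (lem a V (inv b)) (trans (cong (_* inv b) aV≡1) (*-identityˡ (inv b))))) ib≤2)
    where
    lem : ∀ a V i → V * (a * i) ≡ a * V * i
    lem = solve-∀ ℚ-ring

  -vℓ≤f : 1ℚ - v * ℓ ≤ 1ℚ + f
  -vℓ≤f = ≤-by ((b + b′) * Vℓ) (0≤* {b + b′} {Vℓ} 0≤b+b′ 0≤Vℓ) (lem b b′ V ℓ)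
    where
    lem : ∀ b b′ V ℓ → 1ℚ + b′ * V * ℓ - (1ℚ - b * V * ℓ) ≡ (b + b′) * (V * ℓ)
    lem = solve-∀ ℚ-ring

  -1≤f : - 1ℚ ≤ f
  -1≤f = ≤-by (1ℚ + f) (≤-trans (0≤- vℓ≤1) -vℓ≤f) (lem f)
    where
    lem : ∀ f → f - - 1ℚ ≡ 1ℚ + f
    lem = solve-∀ ℚ-ring

  f≤0 : f ≤ 0ℚ
  f≤0 = ≤-by ((0ℚ - b′) * Vℓ) (0≤* {0ℚ - b′} {Vℓ} (0≤- b′≤0) 0≤Vℓ) (lem b′ V ℓ)
    where
    lem : ∀ b′ V ℓ → 0ℚ - b′ * V * ℓ ≡ (0ℚ - b′) * (V * ℓ)
    lem = solve-∀ ℚ-ring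

  ℓ+f-η≤αℓ : ℓ + f - η ≤ α * ℓ
  ℓ+f-η≤αℓ = ≤-by
    (Vℓ * ((e + (a′ + b) - a) + (e + e - (b + b′))) + (fromℕ 3 * (e * (2ℚ - Vℓ)) + (η - fromℕ 6 * e)))
    (0≤+ {Vℓ * ((e + (a′ + b) - a) + (e + e - (b + b′)))} {fromℕ 3 * (e * (2ℚ - Vℓ)) + (η - fromℕ 6 * e)}
      (0≤* {Vℓ} {(e + (a′ + b) - a) + (e + e - (b + b′))} 0≤Vℓ
        (0≤+ {e + (a′ + b) - a} {e + e - (b + b′)} (0≤- a≤) (0≤- b+b′≤)))
      (0≤+ {fromℕ 3 * (e * (2ℚ - Vℓ))} {η - fromℕ 6 * e}
        (0≤* {fromℕ 3} {e * (2ℚ - Vℓ)} (0≤fromℕ 3) (0≤* {e} {2ℚ - Vℓ} 0≤e (0≤- Vℓ≤2))) (0≤- 6e≤η)))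
    (trans (lem₁ (α * ℓ) ℓ f η) (trans (cong (λ o → α * ℓ - (o * ℓ + f - η)) (sym aV≡1)) (lem a a′ b b′ V e η ℓ)))
    where
    lem₁ : ∀ s ℓ f η → s - (ℓ + f - η) ≡ s - (1ℚ * ℓ + f - η)
    lem₁ = solve-∀ ℚ-ring
    lem : ∀ a a′ b b′ V e η ℓ → a′ * V * ℓ - (a * V * ℓ + b′ * V * ℓ - η)
      ≡ V * ℓ * ((e + (a′ + b) - a) + (e + e - (b + b′))) + (fromℕ 3 * (e * (2ℚ - V * ℓ)) + (η - fromℕ 6 * e))
    lem = solve-∀ ℚ-ring

-- The contradiction at a single index k

fromℕ-* : ∀ m n → fromℕ (m ℕ.* n) ≡ fromℕ m * fromℕ n
fromℕ-* zero    n = sym (*-zeroˡ (fromℕ n))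
fromℕ-* (suc m) n = trans (fromℕ-+ n (m ℕ.* n)) (trans (cong (fromℕ n +_) (fromℕ-* m n))
  (trans (lem (fromℕ m) (fromℕ n)) (cong (_* fromℕ n) (sym (fromℕ-suc m)))))
  where
  lem : ∀ m n → n + m * n ≡ (m + 1ℚ) * n
  lem = solve-∀ ℚ-ring

fromℕ-^ : ∀ m j → fromℕ (m ℕ.^ j) ≡ fromℕ m ^ j
fromℕ-^ m zero    = refl
fromℕ-^ m (suc j) = trans (fromℕ-* m (m ℕ.^ j)) (cong (fromℕ m *_) (fromℕ-^ m j))

-- Bounds the coefficient of η in `cleared`, by ln 2 ≤ 1, ln n ≤ n and x ≤ 2n. Being independent of
-- k, it allows η to be fixed before k.
errorScale : ℚ → ℚ → ℚ
errorScale N P = (P * 2ℚ + (P - 1ℚ)) * P + 1ℚ * (P + 1ℚ) * (P * 2ℚ) + P * 2ℚ * N * ((1ℚ + N * 2ℚ) + (P + N * 2ℚ))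

module Refutation (n p : ℕ) (1<n : 1 ℕ.< n) (3≤p : 3 ℕ.≤ p) (p^p≤n : p ℕ.^ p ℕ.≤ n)
  (k : ℕ) (η : ℚ) where

  N P c e : ℚ
  N = fromℕ n
  P = fromℕ p
  -- 2n bounds each of n, n/2, 2, p and x, so the same error `e` serves all their logarithms.
  c = N * 2ℚ
  e = c * ½ ^ k

  M : ℚ
  M = errorScale N P

  a a′ b b′ ℓ L x : ℚ
  a = lnₛ k N
  a′ = lnₛ k (N * ½)
  b = lnₛ k 2ℚ
  b′ = lnₛ k ½
  L = a * inv b
  x = 1ℚ + L
  ℓ = lnₛ k x

  module _ (0<η : 0ℚ < η) (η≤1 : η ≤ int 1 / 1000) (Mη≤½ : M * η ≤ ½) (h≤½ : ½ ^ k ≤ ½) (6e≤η : fromℕ 6 * e ≤ η) where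

    private
      1≤N : 1ℚ ≤ N
      1≤N = <⇒≤ (1<fromℕ n 1<n)
      0≤N : 0ℚ ≤ N
      0≤N = ≤-trans 0≤1 1≤N
      0<N : 0ℚ < N
      0<N = <-≤-trans 0<1 1≤N
      2≤N : 2ℚ ≤ N
      2≤N = fromℕ-mono {2} {n} 1<n
      3≤P : fromℕ 3 ≤ P
      3≤P = fromℕ-mono {3} {p} 3≤p
      1≤P : 1ℚ ≤ P
      1≤P = ≤-trans (fromℕ-mono {1} {3} (s≤s z≤n)) 3≤P
      0≤P : 0ℚ ≤ P
      0≤P = ≤-trans 0≤1 1≤P
      N≤c : N ≤ c
      N≤c = ≤-by N 0≤N (lem N)
        where
        lem : ∀ N → N * 2ℚ - N ≡ N
        lem = solve-∀ ℚ-ring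
      0≤c : 0ℚ ≤ c
      0≤c = ≤-trans 0≤N N≤c
      2≤c : 2ℚ ≤ c
      2≤c = ≤-trans 2≤N N≤c
      ½N≤N : N * ½ ≤ N
      ½N≤N = ≤-by (N * ½) (0≤* {N} {½} 0≤N 0≤½) (lem N)
        where
        lem : ∀ N → N - N * ½ ≡ N * ½
        lem = solve-∀ ℚ-ring
      p≤n : p ℕ.≤ n
      p≤n = ℕ.≤-trans (≤^ p 3≤p) p^p≤n
        where
        ≤^ : ∀ p → 3 ℕ.≤ p → p ℕ.≤ p ℕ.^ p
        ≤^ p@(suc q) h = ℕ.≤-trans (ℕ.≤-reflexive (sym (ℕ.^-identityʳ p))) (ℕ.^-monoʳ-≤ p {1} {p} (s≤s z≤n))
      P≤c : P ≤ c
      P≤c = ≤-trans (fromℕ-mono p≤n) N≤c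
      0≤e : 0ℚ ≤ e
      0≤e = 0≤* {c} {½ ^ k} 0≤c (0≤½^ k)
      0≤η : 0ℚ ≤ η
      0≤η = <⇒≤ 0<η
      e≤η : e ≤ η
      e≤η = ≤-trans (≤-by (fromℕ 5 * e) (0≤* {fromℕ 5} {e} (0≤fromℕ 5) 0≤e) (lem e)) 6e≤η
        where
        lem : ∀ e → fromℕ 6 * e - e ≡ fromℕ 5 * e
        lem = solve-∀ ℚ-ring
      b≤a : b ≤ a
      b≤a = ≤-by (a - b)
        (≤-trans (0≤* {N - 2ℚ} {inv N * inv N} (0≤- 2≤N) (0≤x² (inv N))) (lnₛ-gap k N 2ℚ 1≤2 2≤N)) refl
      0<b : 0ℚ < b
      0<b = <-≤-trans 0<½ (½≤ln2 k)
      0≤a : 0ℚ ≤ a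
      0≤a = ≤-trans (<⇒≤ 0<b) b≤a
      a≤N : a ≤ N
      a≤N = ≤-trans (lnₛ-upper k N 0<N) (≤-by 1ℚ 0≤1 (lem N))
        where
        lem : ∀ N → N - (N - 1ℚ) ≡ 1ℚ
        lem = solve-∀ ℚ-ring
      0≤L : 0ℚ ≤ L
      0≤L = 0≤* {a} {inv b} 0≤a (<⇒≤ (inv-pos 0<b))
      1≤x : 1ℚ ≤ x
      1≤x = ≤-by L 0≤L (lem L)
        where
        lem : ∀ L → 1ℚ + L - 1ℚ ≡ L
        lem = solve-∀ ℚ-ring
      0≤x : 0ℚ ≤ x
      0≤x = ≤-trans 0≤1 1≤x
      x≤c : x ≤ c
      x≤c = ≤-by ((N - 1ℚ - a) * 2ℚ + (a * (2ℚ - inv b) + 1ℚ))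
        (0≤+ {(N - 1ℚ - a) * 2ℚ} {a * (2ℚ - inv b) + 1ℚ}
          (0≤* {N - 1ℚ - a} {2ℚ} (0≤- (lnₛ-upper k N 0<N)) (≤-trans 0≤1 1≤2))
          (0≤+ {a * (2ℚ - inv b)} {1ℚ} (0≤* {a} {2ℚ - inv b} 0≤a (0≤- (inv-antimono {½} {b} 0<½ (½≤ln2 k)))) 0≤1))
        (lem N a (inv b))
        where
        lem : ∀ N a i → N * 2ℚ - (1ℚ + a * i) ≡ (N - 1ℚ - a) * 2ℚ + (a * (2ℚ - i) + 1ℚ)
        lem = solve-∀ ℚ-ring
      0≤ℓ : 0ℚ ≤ ℓ
      0≤ℓ = lnₛ-nonNeg k x 1≤x
      ℓ≤L : ℓ ≤ L
      ℓ≤L = ≤-trans (lnₛ-upper k x (<-≤-trans 0<1 1≤x)) (≤-reflexive (lem L))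
        where
        lem : ∀ L → 1ℚ + L - 1ℚ ≡ L
        lem = solve-∀ ℚ-ring
      a′<a : a′ < a
      a′<a = ≰⇒> λ a≤a′ → <-irrefl refl (<-≤-trans 0<gap
        (≤-trans (lnₛ-gap k N (N * ½) (1≤½n n 1<n) ½N≤N) (subst (a - a′ ≤_) (+-inverseʳ a′) (+-monoˡ-≤ (- a′) a≤a′))))
        where
        0<gap : 0ℚ < (N - N * ½) * (inv N * inv N)
        0<gap = 0<* {N - N * ½} {inv N * inv N} (subst (0ℚ <_) (lem N) (0<* {N} {½} 0<N 0<½))
          (0<* {inv N} {inv N} (inv-pos 0<N) (inv-pos 0<N))
          where
          lem : ∀ N → N * ½ ≡ N - N * ½
          lem = solve-∀ ℚ-ring
      b′≤0 : b′ ≤ 0ℚ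
      b′≤0 = ≤-trans (lnₛ-upper k ½ 0<½) (toWitness {a? = (½ - 1ℚ) ≤? 0ℚ} _)

    module Est = Estimates a a′ b b′ ℓ e η (½≤ln2 k) b≤a (lnₛ-nonNeg k (N * ½) (1≤½n n 1<n)) a′<a
      0≤ℓ ℓ≤L b′≤0 (0≤ln2+ln½ k) (ln2+ln½≤ k c 2≤c)
      (ln-double k N c (1≤½n n 1<n) N≤c) (ln-half k N c (1≤½n n 1<n) (≤-trans ½N≤N N≤c)) 0≤e 6e≤η
    open Est using (α; f; v)

    e₁ e₂ : ℚ
    e₁ = expₛ k (α * ℓ)
    e₂ = expₛ k f

    private
      0≤e₂ : 0ℚ ≤ e₂
      0≤e₂ = 0≤expₛ k {f} Est.-1≤f
      αe₂<1 : α * e₂ < 1ℚ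
      αe₂<1 = ≤-<-trans (≤-trans (*-monoˡ {e₂} {1ℚ} α Est.0≤α (expₛ≤1 k {f} Est.-1≤f Est.f≤0)) (≤-reflexive (*-identityʳ α))) Est.α<1
      s : ℚ
      s = (1ℚ + x) + (P + x)
      0<2P : 0ℚ < P * 2ℚ
      0<2P = 0<* {P} {2ℚ} (<-≤-trans 0<1 1≤P) (<-≤-trans 0<1 1≤2)
      product : x * (e₂ - η) ≤ e₁
      product = expₛ-product k x ℓ f (α * ℓ) η h≤½ 0≤x (expₛ-lnₛ k x (<-≤-trans 0<1 1≤x)) 0≤ℓ
        Est.-1≤f Est.f≤0 0≤η (≤-trans η≤1 (toWitness {a? = int 1 / 1000 ≤? 1ℚ} _)) Est.ℓ+f-η≤αℓ
      power-bound : P * (lnₛ k P - η) ≤ a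
      power-bound = ≤-trans (*-monoˡ {lnₛ k P - η} {lnₛ k P - e} P 0≤P (+-monoʳ-≤ (lnₛ k P) (neg-antimono-≤ e≤η)))
        (ln-power k P c p N 1≤P P≤c (≤-trans (≤-reflexive (sym (fromℕ-^ p p))) (fromℕ-mono p^p≤n)) 0<N)

    -- The negated inequality is definitionally the k-th term of the theorem's hypothesis with slack
    -- η.
    estimate-fails : ¬ (x - (e₁ - L) * inv (α * e₂ - 1ℚ) ≤ P + η)
    estimate-fails hyp = <-irrefl refl (<-≤-trans ½<g (+-cancelˡ-≤ bS (≤-trans (gap P b (lnₛ k P) 3≤P (<⇒≤ 0<b) b≤B₀ (1≤ln k P 3≤P)) (≤-trans main (+-monoʳ-≤ bS err)))))
      where
      bS g : ℚ
      bS = b * (P * 2ℚ * (P - 1ℚ) + (P + 1ℚ) * (P * 2ℚ * (lnₛ k P + b - 1ℚ) + 1ℚ))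
      g = ½ + int 1 / 100
      ½<g : ½ < g
      ½<g = toWitness {a? = ½ <? g} _
      +-cancelˡ-≤ : ∀ r {p q} → r + p ≤ r + q → p ≤ q
      +-cancelˡ-≤ r {p} {q} h = ≤-by (r + q - (r + p)) (0≤- h) (lem r p q)
        where
        lem : ∀ r p q → q - p ≡ r + q - (r + p)
        lem = solve-∀ ℚ-ring
      b≤B₀ : b ≤ B₀
      -- The allowance 1/1000 for η fits between 17/24 and 71/100.
      b≤B₀ = ≤-trans (ln2≤ k c 2≤c) (≤-trans (+-monoˡ-≤ (int 17 / 24) (≤-trans e≤η η≤1))
        (toWitness {a? = int 1 / 1000 + int 17 / 24 ≤? B₀} _))
      b≤1 : b ≤ 1ℚ
      b≤1 = ≤-trans b≤B₀ (toWitness {a? = B₀ ≤? 1ℚ} _)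
      Er : ℚ
      Er = (P * 2ℚ + (P - 1ℚ)) * P + b * (P + 1ℚ) * (P * 2ℚ) + P * 2ℚ * a * s
      main : (P * 2ℚ + (P - 1ℚ)) * (P * lnₛ k P) ≤ bS + η * Er
      main = cleared P L v η α e₂ ℓ s refl 1≤P 0≤L Est.0≤v Est.vL≡1 0≤η Est.0≤α (<⇒≤ Est.α<1) Est.α≥ Est.1-α≥
        0≤ℓ Est.vℓ≤1 (≤-trans Est.-vℓ≤f (1+f≤expₛ k {f} Est.-1≤f))
        (newton-step L P η α e₁ e₂ αe₂<1 (0≤* {α} {e₂} Est.0≤α 0≤e₂) 0≤η hyp product)
        a b (lnₛ k P) (inv (P * 2ℚ)) Est.bL≡a (<⇒≤ 0<b) (inv-inverse (pos⇒≢0 0<2P))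
        (≤-trans (ln-tangent k x P c 1≤x x≤c 1≤P) (+-monoˡ-≤ (lnₛ k P + b + (x * inv (P * 2ℚ) - 1ℚ)) e≤η))
        power-bound
      0≤2P : 0ℚ ≤ P * 2ℚ
      0≤2P = <⇒≤ 0<2P
      0≤P+1 : 0ℚ ≤ P + 1ℚ
      0≤P+1 = 0≤+ {P} {1ℚ} 0≤P 0≤1
      Er≤M : Er ≤ M
      Er≤M = +-mono-≤ (+-monoʳ-≤ ((P * 2ℚ + (P - 1ℚ)) * P)
          (*-monoʳ {b * (P + 1ℚ)} {1ℚ * (P + 1ℚ)} (P * 2ℚ) 0≤2P (*-monoʳ {b} {1ℚ} (P + 1ℚ) 0≤P+1 b≤1)))
        (*-mono {P * 2ℚ * a} {P * 2ℚ * N} {s} {(1ℚ + c) + (P + c)} (0≤* {P * 2ℚ} {a} 0≤2P 0≤a)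
          (0≤+ {1ℚ + c} {P + c} (0≤+ {1ℚ} {c} 0≤1 0≤c) (0≤+ {P} {c} 0≤P 0≤c))
          (*-monoˡ {a} {N} (P * 2ℚ) 0≤2P a≤N)
          (+-mono-≤ (+-monoʳ-≤ 1ℚ x≤c) (+-monoʳ-≤ P x≤c)))
      err : η * Er ≤ ½
      err = ≤-trans (*-monoˡ {Er} {M} η 0≤η Er≤M) (≤-trans (≤-reflexive (*-comm η M)) Mη≤½)

-- Choice of the precision, and conclusion

0≤errorScale : ∀ N P → 0ℚ ≤ N → 1ℚ ≤ P → 0ℚ ≤ errorScale N P
0≤errorScale N P 0≤N 1≤P = 0≤+ {(P * 2ℚ + (P - 1ℚ)) * P + 1ℚ * (P + 1ℚ) * (P * 2ℚ)} {P * 2ℚ * N * ((1ℚ + N * 2ℚ) + (P + N * 2ℚ))}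
  (0≤+ {(P * 2ℚ + (P - 1ℚ)) * P} {1ℚ * (P + 1ℚ) * (P * 2ℚ)}
    (0≤* {P * 2ℚ + (P - 1ℚ)} {P} (0≤+ {P * 2ℚ} {P - 1ℚ} 0≤2P (0≤- 1≤P)) 0≤P)
    (0≤* {1ℚ * (P + 1ℚ)} {P * 2ℚ} (0≤* {1ℚ} {P + 1ℚ} 0≤1 (0≤+ {P} {1ℚ} 0≤P 0≤1)) 0≤2P))
  (0≤* {P * 2ℚ * N} {(1ℚ + N * 2ℚ) + (P + N * 2ℚ)} (0≤* {P * 2ℚ} {N} 0≤2P 0≤N)
    (0≤+ {1ℚ + N * 2ℚ} {P + N * 2ℚ} (0≤+ {1ℚ} {N * 2ℚ} 0≤1 0≤2N) (0≤+ {P} {N * 2ℚ} 0≤P 0≤2N)))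
  where
  0≤P : 0ℚ ≤ P
  0≤P = ≤-trans 0≤1 1≤P
  0≤2P : 0ℚ ≤ P * 2ℚ
  0≤2P = 0≤* {P} {2ℚ} 0≤P (0≤fromℕ 2)
  0≤2N : 0ℚ ≤ N * 2ℚ
  0≤2N = 0≤* {N} {2ℚ} 0≤N (0≤fromℕ 2)

bound-fails : ∀ n p (1<n : 1 ℕ.< n) → 3 ℕ.≤ p → p ℕ.^ p ℕ.≤ n →
  (let open Logarithms n 1<n) →
  ¬ (1ℝ +ℝ log₂[n]
      -ℝ (((1ℝ +ℝ log₂[n]) ^ℝ logₙ[n/2] ∵ 0<1+log₂[n]) -ℝ log₂[n])
         ÷ℝ (logₙ[n/2] *ℝ ((1ℝ +ℝ log₂[n]) ^ℝ logₙ[1/2] ∵ 0<1+log₂[n]) -ℝ 1ℝ) ∵ denominator#0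
      ≤ℝ fromℚ (fromℕ p))
bound-fails n p 1<n 3≤p p^p≤n hyp =
  let P , N = fromℕ p , fromℕ n
      M = errorScale N P
      0≤M = 0≤errorScale N P (0≤fromℕ n) (fromℕ-mono {1} {p} (ℕ.≤-trans (s≤s z≤n) 3≤p))
      -- The summand 1000 makes one η serve both η ≤ 1/1000 and M η ≤ 1/2. The index K is chosen
      -- afterwards, from the hypothesis at slack η.
      η , 0<η , Kη≤½ = shrink (M + fromℕ 1000) ½ (0≤+ {M} {fromℕ 1000} 0≤M (0≤fromℕ 1000)) 0<½
      0≤η = <⇒≤ 0<η
      K , ev = (hyp η 0<η and ½^-small 1ℚ {½} 0<½) and ½^-small (fromℕ 6 * (N * 2ℚ)) {η} 0<η
      (at-K , ½^K≤) , e≤ = ev K ℕ.≤-refl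
  in Refutation.estimate-fails n p 1<n 3≤p p^p≤n K η 0<η
    (η≤ M η 0≤M 0≤η Kη≤½) (Mη≤ M η 0≤η Kη≤½)
    (subst (_≤ ½) (*-identityˡ (½ ^ K)) ½^K≤)
    (subst (_≤ η) (*-assoc (fromℕ 6) (N * 2ℚ) (½ ^ K)) e≤)
    at-K
  where
  η≤ : ∀ M η → 0ℚ ≤ M → 0ℚ ≤ η → (M + fromℕ 1000) * η ≤ ½ → η ≤ int 1 / 1000
  η≤ M η 0≤M 0≤η h = ≤-by (int 1 / 1000 * ((½ - (M + fromℕ 1000) * η) + M * η + ½))
    (0≤* {int 1 / 1000} {(½ - (M + fromℕ 1000) * η) + M * η + ½} (toWitness {a? = 0ℚ ≤? int 1 / 1000} _)
      (0≤+ {(½ - (M + fromℕ 1000) * η) + M * η} {½} (0≤+ {½ - (M + fromℕ 1000) * η} {M * η} (0≤- h) (0≤* {M} {η} 0≤M 0≤η)) 0≤½))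
    (lem M η)
    where
    lem : ∀ M η → int 1 / 1000 - η ≡ int 1 / 1000 * ((½ - (M + fromℕ 1000) * η) + M * η + ½)
    lem = solve-∀ ℚ-ring
  Mη≤ : ∀ M η → 0ℚ ≤ η → (M + fromℕ 1000) * η ≤ ½ → M * η ≤ ½
  Mη≤ M η 0≤η h = ≤-trans (≤-by (fromℕ 1000 * η) (0≤* {fromℕ 1000} {η} (0≤fromℕ 1000) 0≤η) (lem M η)) h
    where
    lem : ∀ M η → (M + fromℕ 1000) * η - M * η ≡ fromℕ 1000 * η
    lem = solve-∀ ℚ-ring

ratio<½ : ∀ w m .{{_ : ℕ.NonZero m}} → 2 ℕ.* w ℕ.< m → int w / m < ½
ratio<½ w m@(suc k) 2w<m = toℚᵘ-cancel-< (ℚᵘ.<-respˡ-≃ (ℚᵘ.≃-sym (toℚᵘ-fromℚᵘ (ℚᵘ.mkℚᵘ (int w) k)))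
  (ℚᵘ.*<* (subst₂ ℤ._<_ (trans (cong int (ℕ.*-comm 2 w)) (ℤ.pos-* w 2)) (sym (ℤ.*-identityˡ (int m))) (ℤ.+<+ 2w<m))))

open import Data.Integer using (+_)

theorem1 :
    ∀ (n p₁ : ℕ) (carmichael : Carmichael n) → IsSmallestPrimeFactor p₁ n →
    (let 1<n = carmichael⇒1<n carmichael
         open Logarithms n 1<n) →
    1ℝ +ℝ log₂[n]
      -ℝ (((1ℝ +ℝ log₂[n]) ^ℝ logₙ[n/2] ∵ 0<1+log₂[n]) -ℝ log₂[n])
         ÷ℝ (logₙ[n/2] *ℝ ((1ℝ +ℝ log₂[n]) ^ℝ logₙ[1/2] ∵ 0<1+log₂[n]) -ℝ 1ℝ) ∵ denominator#0
      ≤ℝ fromℚ (fromℕ p₁) →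
    ((+ length (fermatWitnesses n)) / (n ∸ 1)) {{1<n⇒nonZero[n∸1] 1<n}} < ½
theorem1 n p₁ carmichael smallest bound =
  [ (λ n<p^p → ratio<½ (length (fermatWitnesses n)) (n ∸ 1)
      {{1<n⇒nonZero[n∸1] (carmichael⇒1<n carmichael)}} (Sieve.fewWitnesses carmichael smallest n<p^p))
  , (λ p^p≤n → contradiction bound
      (bound-fails n p₁ (carmichael⇒1<n carmichael) (Sieve.smallest-≥3 carmichael smallest) p^p≤n))
  ]′ (ℕ.<-≤-connex n (p₁ ℕ.^ p₁))
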